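{- Let $k$ be a positive integer, $\ell\in\{1,\dots,k\}$, and $j\leq k$ a nonnegative integer. Then $B_{\ell^{k+1-\ell}} f\in\Omega^{(k)}_{\max(j,\ell)}$ for every $f\in\Omega^{(k)}_j$.
   Context: For $n\in\mathbb Z$, $B_n=\sum_{i\ge0}s_{i+n}[X]\,s_i[X(t-1)]^\perp$ acting on symmetric functions over $\mathbb Q(q,t)$ ($f^\perp$ adjoint to multiplication by $f$ for the Hall scalar product; $s_i[X(t-1)]$ the plethystic substitution $p_n\mapsto(t^n-1)p_n$); for a partition $\mu$ of length $L$, $B_\mu=\prod_{1\le a<b\le L}(1-te_{ab})B_{\mu_1}\cdots B_{\mu_L}$ with $e_{ab}$ raising the $a$-th index by one and lowering the $b$-th by one. $\ell^{k+1-\ell}$ is the rectangular partition with $k+1-\ell$ parts equal to $\ell$. Main hook-length: $h_M(\mu)=\mu_1+\ell(\mu)-1$. $k$-split: for a partition $\mu$ with $\mu_1\le k$, $\mu^{\to k}=(\mu^{(1)},\dots,\mu^{(s)})$ is obtained by cutting $\mu$, without rearranging parts and starting from the largest parts, into consecutive blocks of rows $\mu^{(i)}$ with $h_M(\mu^{(i)})=k$ for $i<s$ (the last block may have smaller main hook-length). The $k$-split polynomials are $G^{(k)}_{()}=1$ and $G^{(k)}_\mu[X;t]=B_{\mu^{(1)}}G^{(k)}_{(\mu^{(2)},\mu^{(3)},\dots)}[X;t]$. For $0\le j\le k$, $\Omega^{(k)}_j$ is the linear span of $\{G^{(k)}_\mu[X;t]:\mu_1\le k,\ \mu_1=j\}$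 (the empty partition has first part $0$). -}

module Defs where

open import Data.Nat as ℕ using (ℕ; zero; suc; _≤_; _≥_; _⊔_; _∸_; _≡ᵇ_)
open import Data.Integer as ℤ using (ℤ; +_; -[1+_])
open import Data.Rational as ℚ using (ℚ; 0ℚ; 1ℚ)
open import Data.List using (List; []; _∷_; _++_; map; concatMap; foldr; length; take; drop; upTo)
open import Data.Nat.ListAction using (sum)
open import Data.List.Relation.Unary.All using (All)
open import Data.List.Relation.Unary.Linked using (Linked)
open import Data.Product using (_×_; _,_; proj₁; proj₂; Σ)
open import Data.Bool using (Bool; true; false; if_then_else_; _∧_)
open import Relation.Binary.PropositionalEquality using (_≡_)
open import Relation.Nullary using (¬_)

-- ℚ[q,t]: finite lists of terms  c · q^i · t^j  (not normalised)

Poly : Set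
Poly = List (ℚ × ℕ × ℕ)

coeffP : Poly → ℕ → ℕ → ℚ
coeffP [] i j = 0ℚ
coeffP ((c , a , b) ∷ p) i j =
  if (a ≡ᵇ i) ∧ (b ≡ᵇ j) then c ℚ.+ coeffP p i j else coeffP p i j

_≈P_ : Poly → Poly → Set
p ≈P r = ∀ i j → coeffP p i j ≡ coeffP r i j

constP : ℚ → Poly
constP c = (c , 0 , 0) ∷ []

ℕtoℚ : ℕ → ℚ
ℕtoℚ n = (+ n) ℚ./ 1

_+P_ : Poly → Poly → Poly
p +P r = p ++ r

_*P_ : Poly → Poly → Poly
p *P r = concatMap (λ { (c , a , b) → map (λ { (d , a' , b') → (c ℚ.* d , a ℕ.+ a' , b ℕ.+ b') }) r }) p

-- the field K = ℚ(q,t) as fractions num/den of elements of ℚ[q,t]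

K : Set
K = Poly × Poly

_+K_ : K → K → K
(a , b) +K (c , d) = ((a *P d) +P (c *P b)) , (b *P d)

_*K_ : K → K → K
(a , b) *K (c , d) = (a *P c) , (b *P d)

0K : K
0K = [] , constP 1ℚ

1K : K
1K = constP 1ℚ , constP 1ℚ

polyK : Poly → K
polyK p = p , constP 1ℚ

natK : ℕ → K
natK n = polyK (constP (ℕtoℚ n))

natInvK : ℕ → K
natInvK n = constP 1ℚ , constP (ℕtoℚ n)

negtK : K
negtK = polyK ((ℚ.- 1ℚ , 0 , 1) ∷ [])

_≈K_ : K → K → Set
(a , b) ≈K (c , d) = (a *P d) ≈P (c *P b)

ValidK : K → Set
ValidK (a , b) = ¬ (b ≈P [])

-- Symmetric functions over K, in the power-sum basis.
-- A monomial is a list of naturals; an entry r stands for p_(r+1);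
-- the list is a multiset (order irrelevant).

Mono : Set
Mono = List ℕ

Sym : Set
Sym = List (K × Mono)

insertℕ : ℕ → List ℕ → List ℕ
insertℕ x [] = x ∷ []
insertℕ x (y ∷ ys) = if x ℕ.≤ᵇ y then x ∷ y ∷ ys else y ∷ insertℕ x ys

sortℕ : List ℕ → List ℕ
sortℕ [] = []
sortℕ (x ∷ xs) = insertℕ x (sortℕ xs)

eqL : List ℕ → List ℕ → Bool
eqL [] [] = true
eqL (x ∷ xs) (y ∷ ys) = (x ≡ᵇ y) ∧ eqL xs ys
eqL _ _ = false

coeffS : Sym → Mono → K
coeffS [] λ' = 0K
coeffS ((c , μ) ∷ f) λ' =
  if eqL (sortℕ μ) (sortℕ λ') then c +K coeffS f λ' else coeffS f λ'

_≈S_ : Sym → Sym → Set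
f ≈S g = ∀ λ' → coeffS f λ' ≈K coeffS g λ'

ValidS : Sym → Set
ValidS f = All (λ x → ValidK (proj₁ x)) f

scaleS : K → Sym → Sym
scaleS c f = map (λ { (d , μ) → (c *K d , μ) }) f

mulS : Sym → Sym → Sym
mulS f g = concatMap (λ { (c , μ) → map (λ { (d , ν) → (c *K d , μ ++ ν) }) g }) f

oneS : Sym
oneS = (1K , []) ∷ []

-- p_(r+1)
pS : ℕ → Sym
pS r = (1K , r ∷ []) ∷ []

-- complete homogeneous h_n = s_n, via Newton: n h_n = Σ_{r=1}^n p_r h_{n-r}

newtonAux : ℕ → List Sym → Sym
newtonAux r [] = []
newtonAux r (g ∷ gs) = mulS (pS r) g ++ newtonAux (suc r) gs

hList : ℕ → List Sym
hList zero = oneS ∷ []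
hList (suc n) = scaleS (natInvK (suc n)) (newtonAux 0 (hList n)) ∷ hList n

headS : List Sym → Sym
headS [] = []
headS (g ∷ _) = g

h : ℕ → Sym
h n = headS (hList n)

hZ : ℤ → Sym
hZ (+ m) = h m
hZ -[1+ m ] = []

-- plethysm f ↦ f[X(t-1)]  (p_r ↦ (t^r - 1) p_r)

tFactor : Mono → Poly
tFactor [] = constP 1ℚ
tFactor (r ∷ μ) = ((1ℚ , 0 , suc r) ∷ (ℚ.- 1ℚ , 0 , 0) ∷ []) *P tFactor μ

plethT : Sym → Sym
plethT f = map (λ { (c , μ) → (c *K polyK (tFactor μ) , μ) }) f

-- adjoints: p_r^⊥ = r ∂/∂p_r ; (c p_λ)^⊥ = c Π_{r∈λ} p_r^⊥

remOcc : ℕ → Mono → List Mono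
remOcc r [] = []
remOcc r (x ∷ xs) = (if x ≡ᵇ r then xs ∷ [] else []) ++ map (x ∷_) (remOcc r xs)

perpOne : ℕ → Sym → Sym
perpOne r f = concatMap (λ { (c , μ) → map (λ ν → (c *K natK (suc r) , ν)) (remOcc r μ) }) f

perpMono : Mono → Sym → Sym
perpMono λ' f = foldr perpOne f λ'

perpS : Sym → Sym → Sym
perpS g f = concatMap (λ { (c , λ') → scaleS c (perpMono λ' f) }) g

-- B_n = Σ_{i≥0} s_{i+n}[X] s_i[X(t-1)]^⊥ ; the sum is finite on f
-- (terms with i > deg f vanish), so we sum i = 0 … degS f.

degS : Sym → ℕ
degS f = sum (map (λ { (c , μ) → sum (map suc μ) }) f)

B : ℤ → Sym → Sym
B n f = concatMap (λ i → mulS (hZ (n ℤ.+ (+ i))) (perpS (plethT (h i)) f)) (upTo (suc (degS f)))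

Bseq : List ℤ → Sym → Sym
Bseq [] f = f
Bseq (n ∷ ns) f = B n (Bseq ns f)

addAt : ℕ → ℤ → List ℤ → List ℤ
addAt _ _ [] = []
addAt zero d (x ∷ xs) = (x ℤ.+ d) ∷ xs
addAt (suc a) d (x ∷ xs) = x ∷ addAt a d xs

pairs : ℕ → List (ℕ × ℕ)
pairs L = concatMap (λ a → map (λ i → (a , suc (a ℕ.+ i))) (upTo (L ∸ suc a))) (upTo L)

-- apply (1 - t e_ab) to a formal combination of index vectors
raise : ℕ × ℕ → List (K × List ℤ) → List (K × List ℤ)
raise (a , b) ts =
  concatMap (λ { (c , v) → (c , v) ∷ (c *K negtK , addAt b (ℤ.- (+ 1)) (addAt a (+ 1) v)) ∷ [] }) ts

-- B_μ = Π_{a<b} (1 - t e_ab) B_{μ_1} ⋯ B_{μ_L}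
Bμ : List ℕ → Sym → Sym
Bμ μ f = concatMap (λ { (c , v) → scaleS c (Bseq v f) })
                   (foldr raise ((1K , map +_ μ) ∷ []) (pairs (length μ)))

-- fuel-driven recursion; the first block of μ = (m , …) has
-- k + 1 - m rows (main hook-length k), or all remaining rows.
Gfuel : ℕ → ℕ → List ℕ → Sym
Gfuel k zero _ = oneS
Gfuel k (suc n) [] = oneS
Gfuel k (suc n) (m ∷ ms) =
  Bμ (take (suc (k ∸ m)) (m ∷ ms)) (Gfuel k n (drop (suc (k ∸ m)) (m ∷ ms)))

G : ℕ → List ℕ → Sym
G k μ = Gfuel k (length μ) μ

IsPartition : List ℕ → Set
IsPartition μ = All (1 ≤_) μ × Linked _≥_ μ

headOr0 : List ℕ → ℕ
headOr0 [] = 0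
headOr0 (m ∷ _) = m

InΩ : ℕ → ℕ → Sym → Set
InΩ k j f =
  Σ (List (K × List ℕ)) λ ws →
    All (λ w → ValidK (proj₁ w) × IsPartition (proj₂ w)
               × All (_≤ k) (proj₂ w) × headOr0 (proj₂ w) ≡ j) ws
    × (f ≈S concatMap (λ { (c , μ) → scaleS c (G k μ) }) ws)

rect : ℕ → ℕ → List ℕ
rect k ℓ = Data.List.replicate (suc k ∸ ℓ) ℓ

{-# OPTIONS --safe #-}
module Submission where

-- For an integer vector v, B_v changes sign under (a , b) ↦ (b − 1 , a + 1) on adjacent entries,
-- since B_m B_n − t B_{m+1} B_{n−1} does; in terms of the exponents (entry plus number of later
-- entries) this exchanges two of them, so B_v vanishes when two exponents agree.  Let R = ℓ^(n+d)
-- and let u be a block with n rows and first part ℓ + d.  Split R into its first n rows Y and its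
-- last d rows Z.  Applying Π (1 − t e_zx), z ∈ Z and x a row of u, does not change B_R B_u, because
-- raising rows of Z, each at most n times and not all by zero, produces two equal exponents.  This moves Z over
-- to u:  B_R B_u = Π (1 − t e_yz) B_Y B_(Z,u), and antisymmetry expands the right side as
--   Σ_λ (− t)^|λ| B_{ℓ^n + λ} B_{(ℓ^d − reverse λ′ , u)}   over λ inside n × d,
-- where a term vanishes unless ℓ + λ_i ≥ u_i for all i.  The second index straightens to a partition
-- with first part ℓ and all parts at least min(ℓ , u_n).  Hence B_R B_u is a combination of
-- products of two complete blocks, which may be put in front of the rest of the k-split when its
-- first part is at most ℓ; otherwise the second factor is B_R again, and one recurses on the rest.
--
-- The sign rule comes from h_i[X(t−1)]^⊥ h_n − t h_{i−1}[X(t−1)]^⊥ h_{n−1} =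
-- h_n h_i[X(t−1)]^⊥ − h_{n−1} h_{i−1}[X(t−1)]^⊥, proved by Newton's identities.

open import Defs using (Poly; coeffP; _≈P_; constP; _+P_; _*P_; Mono; remOcc; insertℕ; sortℕ; eqL;
  addAt; pairs; IsPartition; headOr0; rect)
open import Data.Nat using (ℕ; _≤_; _⊔_)
open import Level using (0ℓ)
open import Algebra.Bundles using (AbelianGroup; CommutativeRing)
open import Data.Bool using (Bool; true; false; if_then_else_; _∧_; T)
open import Data.Bool.Properties using (T-≡; T-∧)
open import Data.Empty using (⊥)
import Data.Integer.Properties as ℤₚ
open import Data.Integer as ℤ using (ℤ; +_; -[1+_])
open import Data.List as List
  using (List; []; _∷_; _++_; applyUpTo; concatMap; drop; foldr; length; map; take; upTo)
import Data.List.Properties as Listₚ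
open import Data.List.Relation.Binary.Permutation.Propositional as Perm using (_↭_)
import Data.List.Relation.Binary.Permutation.Propositional.Properties as Permₚ
open import Data.List.Relation.Unary.All as LAll using ([]; _∷_)
import Data.List.Relation.Unary.All.Properties as LAllₚ
open import Data.List.Relation.Unary.AllPairs using (AllPairs; []; _∷_)
import Data.List.Relation.Unary.AllPairs.Properties as AllPairsₚ
import Data.List.Relation.Unary.Linked.Properties as Linkedₚ
open import Data.Nat as ℕ using (zero; suc; z≤n; s≤s; _≡ᵇ_)
import Data.Nat.Coprimality as Coprime
open import Data.Nat.Induction using (<-rec)
open import Data.Nat.ListAction using (sum)
import Data.Nat.Properties as ℕₚ
open import Data.Product using (Σ; _×_; _,_; proj₁; proj₂)
open import Data.Rational as ℚ using (ℚ; 0ℚ; 1ℚ; mkℚ)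
import Data.Rational.Properties as ℚₚ
open import Data.Rational.Solver using (module +-*-Solver)
open import Data.Sum using (_⊎_; inj₁; inj₂)
open import Data.Unit using (⊤; tt)
open import Data.Vec.Base as Vec using (Vec; []; _∷_; replicate) renaming (_++_ to _++ᵛ_)
import Data.Vec.Properties as Vecₚ
open import Data.Vec.Relation.Binary.Pointwise.Inductive using (Pointwise; []; _∷_)
open import Data.Vec.Relation.Unary.All as VAll using ([]; _∷_)
open import Function using (Equivalence; id)
open import Relation.Binary.Definitions using (tri<; tri≈; tri>)
open import Relation.Binary.PropositionalEquality as ≡ using (_≡_; _≢_)
import Relation.Binary.Reasoning.Setoid
open import Relation.Nullary using (¬_; contradiction; no; yes)
open import Relation.Nullary.Decidable using (decidable-stable)

-- A raising only shifts indices, so the combinatorics takes place in an abelian group with one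
-- endomorphism, multiplication by - t; the operators B enter through linearity and the sign rule
-- alone. A collision of exponents gives x = - x, hence 2 must be cancellable. The obstacle is the
-- last block of a k-split, which may be short, while the exchange requires exactly k + 1 - j rows
-- in a block with first part j. It is filled up with zeros: on 1 a trailing B_0 acts as the
-- identity, and B_m 1 = 0 for m < 0. Zeros left by straightening are taken off for the same reason.
-- Row counts decide that the new factors are complete: for j = ℓ + d and n = k + 1 - j, the left
-- one has n rows and first part j, the right one d + n = k + 1 - ℓ rows and first part ℓ, so both
-- have main hook-length k. The first part ℓ is no accident: the first row of u already carries the
-- largest exponent allowed. Pairs of polynomials under cross-multiplication do not form a ring,
-- since transitivity fails at zero denominators. The argument therefore runs over fractions that
-- carry a proof of a nonzero denominator, and is carried back at the end.

-- Formal linear combinations and functionals on them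

module LinearCombinations (R : CommutativeRing 0ℓ 0ℓ) where
  open CommutativeRing R renaming (Carrier to C)
  open import Relation.Binary.Reasoning.Setoid setoid
  open import Algebra.Properties.CommutativeSemigroup +-commutativeSemigroup using (interchange)
  open import Algebra.Properties.CommutativeSemigroup *-commutativeSemigroup
    using () renaming (x∙yz≈y∙xz to *-left-comm)

  -- Lists of terms are not normalised, so identities between them are tested by applying
  -- functionals, extended linearly. An operation on lists then becomes its transpose on
  -- functionals.
  ev : {X : Set} → (X → C) → List (C × X) → C
  ev F [] = 0#
  ev F ((c , x) ∷ f) = c * F x + ev F f

  module _ {X : Set} where
    ev-cong : {F G : X → C} → (∀ x → F x ≈ G x) → ∀ f → ev F f ≈ ev G f
    ev-cong e [] = refl
    ev-cong e ((c , x) ∷ f) = +-cong (*-congˡ (e x)) (ev-cong e f)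

    ev-++ : (F : X → C) → ∀ f g → ev F (f ++ g) ≈ ev F f + ev F g
    ev-++ F [] g = sym (+-identityˡ _)
    ev-++ F (_ ∷ f) g = trans (+-congˡ (ev-++ F f g)) (sym (+-assoc _ _ _))

    ev-+ : (F G : X → C) → ∀ f → ev (λ x → F x + G x) f ≈ ev F f + ev G f
    ev-+ F G [] = sym (+-identityˡ _)
    ev-+ F G ((c , x) ∷ f) =
      trans (+-cong (distribˡ c _ _) (ev-+ F G f)) (interchange _ _ _ _)

    ev-* : (d : C) (F : X → C) → ∀ f → ev (λ x → d * F x) f ≈ d * ev F f
    ev-* d F [] = sym (zeroʳ d)
    ev-* d F ((c , x) ∷ f) =
      trans (+-cong (*-left-comm c d _) (ev-* d F f)) (sym (distribˡ d _ _))

    ev-zero : (f : List (C × X)) → ev (λ _ → 0#) f ≈ 0#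
    ev-zero [] = refl
    ev-zero ((c , x) ∷ f) = trans (+-cong (zeroʳ c) (ev-zero f)) (+-identityˡ _)

    ev-map : {Y : Set} (d : C) (s : Y → X) (k : C × Y → C × X) →
             (∀ c y → proj₁ (k (c , y)) ≈ d * c) → (∀ c y → proj₂ (k (c , y)) ≡ s y) →
             (F : X → C) → ∀ f → ev F (map k f) ≈ d * ev (λ y → F (s y)) f
    ev-map d s k e₁ e₂ F [] = sym (zeroʳ d)
    ev-map d s k e₁ e₂ F ((c , y) ∷ f) = begin
      proj₁ (k (c , y)) * F (proj₂ (k (c , y))) + ev F (map k f)
        ≈⟨ +-cong (*-cong (e₁ c y) (reflexive (≡.cong F (e₂ c y)))) (ev-map d s k e₁ e₂ F f) ⟩
      d * c * F (s y) + d * ev _ f  ≈⟨ +-congʳ (*-assoc _ _ _) ⟩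
      d * (c * F (s y)) + d * ev _ f  ≈⟨ distribˡ d _ _ ⟨
      d * (c * F (s y) + ev _ f)  ∎

    ev-concatMap : {Y : Set} (k : C × Y → List (C × X)) (F : X → C) (G : Y → C) →
                   (∀ c y → ev F (k (c , y)) ≈ c * G y) →
                   ∀ f → ev F (concatMap k f) ≈ ev G f
    ev-concatMap k F G e [] = refl
    ev-concatMap k F G e ((c , y) ∷ f) =
      trans (ev-++ F (k (c , y)) _) (+-cong (e c y) (ev-concatMap k F G e f))

  ev-swap : {X Y : Set} (H : X → Y → C) → ∀ f g →
            ev (λ x → ev (H x) g) f ≈ ev (λ y → ev (λ x → H x y) f) g
  ev-swap H [] g = sym (ev-zero g)
  ev-swap H ((c , x) ∷ f) g = begin
    c * ev (H x) g + ev (λ x → ev (H x) g) f  ≈⟨ +-cong (sym (ev-* c (H x) g)) (ev-swap H f g) ⟩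
    ev (λ y → c * H x y) g + ev (λ y → ev (λ x → H x y) f) g  ≈⟨ ev-+ _ _ g ⟨
    ev (λ y → c * H x y + ev (λ x → H x y) f) g  ∎

  -- `κ` assigns to an index the normal form of its class: the identity for exponents of
  -- polynomials, sorting for power-sum monomials.
  module Coefficients {X N : Set} (κ : X → N) (eq : N → N → Bool)
           (eq-refl : ∀ a → eq a a ≡ true) (eq-sound : ∀ a b → eq a b ≡ true → a ≡ b) where

    coef : List (C × X) → X → C
    coef [] x = 0#
    coef ((c , y) ∷ f) x = if eq (κ y) (κ x) then c + coef f x else coef f x

    private
      drop-class : X → List (C × X) → List (C × X)
      drop-class x [] = []
      drop-class x ((c , y) ∷ f) =
        if eq (κ y) (κ x) then drop-class x f else (c , y) ∷ drop-class x f

      length-drop : ∀ x f → length (drop-class x f) ℕ.≤ length f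
      length-drop x [] = z≤n
      length-drop x ((c , y) ∷ f) with eq (κ y) (κ x)
      ... | true = ℕₚ.m≤n⇒m≤1+n (length-drop x f)
      ... | false = s≤s (length-drop x f)

      coef-drop-same : ∀ x x′ → κ x ≡ κ x′ → ∀ f → coef (drop-class x f) x′ ≈ 0#
      coef-drop-same x x′ e [] = refl
      coef-drop-same x x′ e ((c , y) ∷ f) with eq (κ y) (κ x) in q
      ... | true = coef-drop-same x x′ e f
      ... | false rewrite ≡.trans (≡.cong (eq (κ y)) (≡.sym e)) q = coef-drop-same x x′ e f

      coef-drop-other : ∀ x x′ → eq (κ x) (κ x′) ≡ false → ∀ f →
                        coef (drop-class x f) x′ ≈ coef f x′
      coef-drop-other x x′ e [] = refl
      coef-drop-other x x′ e ((c , y) ∷ f) with eq (κ y) (κ x) in q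
      ... | true rewrite ≡.trans (≡.cong (λ z → eq z (κ x′)) (eq-sound _ _ q)) e =
            coef-drop-other x x′ e f
      ... | false with eq (κ y) (κ x′)
      ...   | true = +-congˡ (coef-drop-other x x′ e f)
      ...   | false = coef-drop-other x x′ e f

      ev-split : (F : X → C) → (∀ x y → κ x ≡ κ y → F x ≈ F y) →
                 ∀ x f → ev F f ≈ coef f x * F x + ev F (drop-class x f)
      ev-split F inv x [] = sym (trans (+-identityʳ _) (zeroˡ _))
      ev-split F inv x ((c , y) ∷ f) with eq (κ y) (κ x) in q
      ... | true = begin
        c * F y + ev F f
          ≈⟨ +-cong (*-congˡ (inv y x (eq-sound _ _ q))) (ev-split F inv x f) ⟩
        c * F x + (coef f x * F x + ev F (drop-class x f))  ≈⟨ +-assoc _ _ _ ⟨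
        c * F x + coef f x * F x + ev F (drop-class x f)  ≈⟨ +-congʳ (distribʳ _ _ _) ⟨
        (c + coef f x) * F x + ev F (drop-class x f)  ∎
      ... | false = begin
        c * F y + ev F f  ≈⟨ +-congˡ (ev-split F inv x f) ⟩
        c * F y + (coef f x * F x + ev F (drop-class x f))
          ≈⟨ trans (sym (+-assoc _ _ _)) (trans (+-congʳ (+-comm _ _)) (+-assoc _ _ _)) ⟩
        coef f x * F x + (c * F y + ev F (drop-class x f))  ∎

      -- Each step splits off the whole class of the first index, which contributes its total
      -- coefficient times the value of `F`. What remains is shorter but is no subterm, hence the
      -- induction on the bound `n`.
      vanish : ∀ n (F : X → C) → (∀ x y → κ x ≡ κ y → F x ≈ F y) → ∀ f → length f ℕ.≤ n →
               (∀ x → coef f x ≈ 0# ⊎ F x ≈ 0#) → ev F f ≈ 0#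
      vanish n F inv [] l z = refl
      vanish (suc n) F inv ((c , y) ∷ f) (s≤s l) z = begin
        ev F ((c , y) ∷ f)  ≈⟨ ev-split F inv y ((c , y) ∷ f) ⟩
        coef ((c , y) ∷ f) y * F y + ev F (drop-class y ((c , y) ∷ f))
          ≈⟨ +-cong (product (z y)) rest ⟩
        0# + 0#  ≈⟨ +-identityˡ _ ⟩
        0#  ∎
        where
        product : ∀ {a b} → a ≈ 0# ⊎ b ≈ 0# → a * b ≈ 0#
        product (inj₁ e) = trans (*-congʳ e) (zeroˡ _)
        product (inj₂ e) = trans (*-congˡ e) (zeroʳ _)

        z′ : ∀ x → coef (drop-class y f) x ≈ 0# ⊎ F x ≈ 0#
        z′ x with eq (κ y) (κ x) in q | z x
        ... | true  | _ = inj₁ (coef-drop-same y x (eq-sound _ _ q) f)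
        ... | false | inj₁ e = inj₁ (trans (coef-drop-other y x q f) e)
        ... | false | inj₂ e = inj₂ e

        rest : ev F (drop-class y ((c , y) ∷ f)) ≈ 0#
        rest rewrite eq-refl (κ y) =
          vanish n F inv (drop-class y f) (ℕₚ.≤-trans (length-drop y f) l) z′

    ev-vanish : (F : X → C) → (∀ x y → κ x ≡ κ y → F x ≈ F y) → ∀ f →
                (∀ x → coef f x ≈ 0# ⊎ F x ≈ 0#) → ev F f ≈ 0#
    ev-vanish F inv f = vanish (length f) F inv f ℕₚ.≤-refl

    indicator : X → X → C
    indicator x y = if eq (κ y) (κ x) then 1# else 0#

    indicator-inv : ∀ x y y′ → κ y ≡ κ y′ → indicator x y ≈ indicator x y′
    indicator-inv x y y′ e = reflexive (≡.cong (λ z → if eq z (κ x) then 1# else 0#) e)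

    ev-indicator : ∀ x f → ev (indicator x) f ≈ coef f x
    ev-indicator x [] = refl
    ev-indicator x ((c , y) ∷ f) with eq (κ y) (κ x)
    ... | true = +-cong (*-identityʳ c) (ev-indicator x f)
    ... | false = trans (+-cong (zeroʳ c) (ev-indicator x f)) (+-identityˡ _)

    negate : List (C × X) → List (C × X)
    negate = map (λ { (c , x) → (- c , x) })

    open import Algebra.Properties.Ring ring
      using (-‿distribˡ-*; -‿distribʳ-*; -‿+-comm; -0#≈0#; x∙y⁻¹≈ε⇒x≈y)

    ev-agree : (F G : X → C) → (∀ x y → κ x ≡ κ y → F x ≈ F y) → (∀ x y → κ x ≡ κ y → G x ≈ G y) →
               ∀ f → (∀ x → coef f x ≈ 0# ⊎ F x ≈ G x) → ev F f ≈ ev G f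
    ev-agree F G inv inv′ f z = x∙y⁻¹≈ε⇒x≈y _ _ (begin
      ev F f - ev G f  ≈⟨ ev-sub f ⟨
      ev (λ x → F x - G x) f
        ≈⟨ ev-vanish _ (λ x y e → +-cong (inv x y e) (-‿cong (inv′ x y e))) f z′ ⟩
      0#  ∎)
      where
      ev-sub : ∀ f → ev (λ x → F x - G x) f ≈ ev F f - ev G f
      ev-sub [] = sym (-‿inverseʳ 0#)
      ev-sub ((c , x) ∷ f) = begin
        c * (F x - G x) + ev _ f
          ≈⟨ +-cong (trans (distribˡ c _ _) (+-congˡ (sym (-‿distribʳ-* c (G x))))) (ev-sub f) ⟩
        c * F x - c * G x + (ev F f - ev G f)  ≈⟨ interchange _ _ _ _ ⟩
        c * F x + ev F f + (- (c * G x) - ev G f)  ≈⟨ +-congˡ (-‿+-comm _ _) ⟩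
        c * F x + ev F f - (c * G x + ev G f)  ∎

      z′ : ∀ x → coef f x ≈ 0# ⊎ F x - G x ≈ 0#
      z′ x with z x
      ... | inj₁ e = inj₁ e
      ... | inj₂ e = inj₂ (trans (+-congʳ e) (-‿inverseʳ _))

    ev-negate : (F : X → C) → ∀ f → ev F (negate f) ≈ - ev F f
    ev-negate F [] = sym -0#≈0#
    ev-negate F ((c , x) ∷ f) =
      trans (+-cong (sym (-‿distribˡ-* c (F x))) (ev-negate F f)) (-‿+-comm _ _)

    ev-ext : (F : X → C) → (∀ x y → κ x ≡ κ y → F x ≈ F y) → ∀ f g →
             (∀ x → coef f x ≈ coef g x) → ev F f ≈ ev F g
    ev-ext F inv f g e = x∙y⁻¹≈ε⇒x≈y _ _ (trans (sym ev-diff) (ev-vanish F inv (f ++ negate g) zeros))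
      where
      ev-diff : ∀ {F} → ev F (f ++ negate g) ≈ ev F f - ev F g
      ev-diff = trans (ev-++ _ f _) (+-congˡ (ev-negate _ g))

      zeros : ∀ x → coef (f ++ negate g) x ≈ 0# ⊎ F x ≈ 0#
      zeros x = inj₁ (begin
        coef (f ++ negate g) x  ≈⟨ ev-indicator x (f ++ negate g) ⟨
        ev (indicator x) (f ++ negate g)  ≈⟨ ev-diff ⟩
        ev (indicator x) f - ev (indicator x) g
          ≈⟨ +-cong (ev-indicator x f) (-‿cong (ev-indicator x g)) ⟩
        coef f x - coef g x  ≈⟨ +-congʳ (e x) ⟩
        coef g x - coef g x  ≈⟨ -‿inverseʳ _ ⟩
        0#  ∎)

    -- Indicators of classes are invariant functionals and read off coefficients. Together with
    -- `ev-ext` this identifies coefficientwise equality with equality on invariant functionals.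
    coef-ext : ∀ f g → (∀ F → (∀ x y → κ x ≡ κ y → F x ≈ F y) → ev F f ≈ ev F g) →
               ∀ x → coef f x ≈ coef g x
    coef-ext f g e x =
      trans (sym (ev-indicator x f)) (trans (e _ (indicator-inv x)) (ev-indicator x g))

-- The ring ℚ[q,t]

module Polynomials where
  open LinearCombinations ℚₚ.+-*-commutativeRing
  open ≡.≡-Reasoning

  Exponent : Set
  Exponent = ℕ × ℕ

  same : Exponent → Exponent → Bool
  same (a , b) (i , j) = (a ≡ᵇ i) ∧ (b ≡ᵇ j)

  same-refl : ∀ x → same x x ≡ true
  same-refl (a , b) = Equivalence.to T-≡
    (Equivalence.from T-∧ (ℕₚ.≡⇒≡ᵇ a a ≡.refl , ℕₚ.≡⇒≡ᵇ b b ≡.refl))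

  same-sound : ∀ x y → same x y ≡ true → x ≡ y
  same-sound (a , b) (i , j) e with Equivalence.to T-∧ (Equivalence.from T-≡ e)
  ... | p , q = ≡.cong₂ _,_ (ℕₚ.≡ᵇ⇒≡ a i p) (ℕₚ.≡ᵇ⇒≡ b j q)

  open Coefficients {X = Exponent} id same same-refl same-sound

  private
    invariant : (F : Exponent → ℚ) → ∀ x y → x ≡ y → F x ≡ F y
    invariant F x y e = ≡.cong F e

  coefficients : ∀ p i j → coeffP p i j ≡ coef p (i , j)
  coefficients [] i j = ≡.refl
  coefficients ((c , a , b) ∷ p) i j with (a ≡ᵇ i) ∧ (b ≡ᵇ j)
  ... | true = ≡.cong (c ℚ.+_) (coefficients p i j)
  ... | false = coefficients p i j

  -- Here `κ` is the identity, so every functional is invariant. The record wrapper lets `p` and `r`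
  -- be inferred from the type of an equality proof.
  infix 4 _≋P_
  record _≋P_ (p r : Poly) : Set where
    constructor functionals
    field at : ∀ F → ev F p ≡ ev F r
  open _≋P_ public

  ≈P⇒≋P : ∀ p r → p ≈P r → p ≋P r
  ≈P⇒≋P p r e = functionals λ F → ev-ext F (invariant F) p r (λ x →
    ≡.trans (≡.sym (coefficients p _ _)) (≡.trans (e _ _) (coefficients r _ _)))

  ≋P⇒≈P : ∀ {p r} → p ≋P r → p ≈P r
  ≋P⇒≈P {p} {r} e i j = ≡.trans (coefficients p i j)
    (≡.trans (coef-ext p r (λ F _ → at e F) (i , j)) (≡.sym (coefficients r i j)))

  infixl 6 _⊕_
  _⊕_ : Exponent → Exponent → Exponent
  (a , b) ⊕ (c , d) = (a ℕ.+ c , b ℕ.+ d)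

  ⊕-assoc : ∀ x y z → (x ⊕ y) ⊕ z ≡ x ⊕ (y ⊕ z)
  ⊕-assoc (a , b) (c , d) (e , f) = ≡.cong₂ _,_ (ℕₚ.+-assoc a c e) (ℕₚ.+-assoc b d f)

  ⊕-comm : ∀ x y → x ⊕ y ≡ y ⊕ x
  ⊕-comm (a , b) (c , d) = ≡.cong₂ _,_ (ℕₚ.+-comm a c) (ℕₚ.+-comm b d)

  ev-mul : ∀ F p r → ev F (p *P r) ≡ ev (λ x → ev (λ y → F (x ⊕ y)) r) p
  ev-mul F p r = ev-concatMap _ F _
    (λ c x → ev-map c (x ⊕_) _ (λ _ _ → ≡.refl) (λ _ _ → ≡.refl) F r) p

  -P_ : Poly → Poly
  -P_ = negate

  *P-cong : ∀ {p p′ r r′} → p ≋P p′ → r ≋P r′ → (p *P r) ≋P (p′ *P r′)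
  *P-cong {p} {p′} {r} {r′} e₁ e₂ = functionals λ F → begin
    ev F (p *P r)  ≡⟨ ev-mul F p r ⟩
    ev (λ x → ev (λ y → F (x ⊕ y)) r) p  ≡⟨ ev-cong (λ x → at e₂ _) p ⟩
    ev (λ x → ev (λ y → F (x ⊕ y)) r′) p  ≡⟨ at e₁ _ ⟩
    ev (λ x → ev (λ y → F (x ⊕ y)) r′) p′  ≡⟨ ev-mul F p′ r′ ⟨
    ev F (p′ *P r′)  ∎

  *P-comm : ∀ p r → (p *P r) ≋P (r *P p)
  *P-comm p r = functionals λ F → begin
    ev F (p *P r)  ≡⟨ ev-mul F p r ⟩
    ev (λ x → ev (λ y → F (x ⊕ y)) r) p  ≡⟨ ev-swap (λ x y → F (x ⊕ y)) p r ⟩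
    ev (λ y → ev (λ x → F (x ⊕ y)) p) r
      ≡⟨ ev-cong (λ y → ev-cong (λ x → ≡.cong F (⊕-comm x y)) p) r ⟩
    ev (λ y → ev (λ x → F (y ⊕ x)) p) r  ≡⟨ ev-mul F r p ⟨
    ev F (r *P p)  ∎

  *P-assoc : ∀ p r s → ((p *P r) *P s) ≋P (p *P (r *P s))
  *P-assoc p r s = functionals λ F → begin
    ev F ((p *P r) *P s)  ≡⟨ ev-mul F (p *P r) s ⟩
    ev (λ x → ev (λ y → F (x ⊕ y)) s) (p *P r)  ≡⟨ ev-mul _ p r ⟩
    ev (λ x → ev (λ y → ev (λ z → F (x ⊕ y ⊕ z)) s) r) p
      ≡⟨ ev-cong (λ x → ev-cong (λ y → ev-cong (λ z → ≡.cong F (⊕-assoc x y z)) s) r) p ⟩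
    ev (λ x → ev (λ y → ev (λ z → F (x ⊕ (y ⊕ z))) s) r) p
      ≡⟨ ev-cong (λ x → ev-mul _ r s) p ⟨
    ev (λ x → ev (λ w → F (x ⊕ w)) (r *P s)) p  ≡⟨ ev-mul F p (r *P s) ⟨
    ev F (p *P (r *P s))  ∎

  *P-identityˡ : ∀ p → (constP 1ℚ *P p) ≋P p
  *P-identityˡ p = functionals λ F → ≡.trans (ev-mul F (constP 1ℚ) p)
    (≡.trans (ℚₚ.+-identityʳ _) (ℚₚ.*-identityˡ _))

  *P-distribˡ : ∀ p r s → (p *P (r +P s)) ≋P ((p *P r) +P (p *P s))
  *P-distribˡ p r s = functionals λ F → begin
    ev F (p *P (r ++ s))  ≡⟨ ev-mul F p _ ⟩
    ev (λ x → ev (λ y → F (x ⊕ y)) (r ++ s)) p  ≡⟨ ev-cong (λ x → ev-++ _ r s) p ⟩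
    ev (λ x → ev (λ y → F (x ⊕ y)) r ℚ.+ ev (λ y → F (x ⊕ y)) s) p  ≡⟨ ev-+ _ _ p ⟩
    ev _ p ℚ.+ ev _ p  ≡⟨ ≡.cong₂ ℚ._+_ (ev-mul F p r) (ev-mul F p s) ⟨
    ev F (p *P r) ℚ.+ ev F (p *P s)  ≡⟨ ev-++ F (p *P r) _ ⟨
    ev F ((p *P r) ++ (p *P s))  ∎

  ring : CommutativeRing 0ℓ 0ℓ
  ring = record
    { Carrier = Poly
    ; _≈_ = _≋P_
    ; _+_ = _+P_
    ; _*_ = _*P_
    ; -_ = -P_
    ; 0# = []
    ; 1# = constP 1ℚ
    ; isCommutativeRing = record
      { isRing = record
        { +-isAbelianGroup = record
          { isGroup = record
            { isMonoid = record
              { isSemigroup = record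
                { isMagma = record
                  { isEquivalence = record
                    { refl = functionals λ _ → ≡.refl
                    ; sym = λ e → functionals λ F → ≡.sym (at e F)
                    ; trans = λ e₁ e₂ → functionals λ F → ≡.trans (at e₁ F) (at e₂ F)
                    }
                  ; ∙-cong = λ {p} {p′} {r} {r′} e₁ e₂ → functionals λ F →
                      ≡.trans (ev-++ F p r) (≡.trans
                        (≡.cong₂ ℚ._+_ (at e₁ F) (at e₂ F)) (≡.sym (ev-++ F p′ r′)))
                  }
                ; assoc = λ p r s → functionals λ F → begin
                    ev F ((p ++ r) ++ s)  ≡⟨ ≡.trans (ev-++ F (p ++ r) s) (≡.cong (ℚ._+ ev F s) (ev-++ F p r)) ⟩
                    ev F p ℚ.+ ev F r ℚ.+ ev F s  ≡⟨ ℚₚ.+-assoc (ev F p) (ev F r) (ev F s) ⟩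
                    ev F p ℚ.+ (ev F r ℚ.+ ev F s)
                      ≡⟨ ≡.trans (ev-++ F p (r ++ s)) (≡.cong (ev F p ℚ.+_) (ev-++ F r s)) ⟨
                    ev F (p ++ (r ++ s))  ∎
                }
              ; identity = (λ p → functionals λ F → ≡.refl) , λ p → functionals λ F →
                  ≡.trans (ev-++ F p []) (ℚₚ.+-identityʳ _)
              }
            ; inverse =
                (λ p → functionals λ F → ≡.trans (ev-++ F (-P p) p)
                  (≡.trans (≡.cong (ℚ._+ ev F p) (ev-negate F p)) (ℚₚ.+-inverseˡ (ev F p)))) ,
                (λ p → functionals λ F → ≡.trans (ev-++ F p (-P p))
                  (≡.trans (≡.cong (ev F p ℚ.+_) (ev-negate F p)) (ℚₚ.+-inverseʳ (ev F p))))
            ; ⁻¹-cong = λ {p} {r} e → functionals λ F →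
                ≡.trans (ev-negate F p) (≡.trans (≡.cong ℚ.-_ (at e F)) (≡.sym (ev-negate F r)))
            }
          ; comm = λ p r → functionals λ F →
              ≡.trans (ev-++ F p r) (≡.trans (ℚₚ.+-comm (ev F p) (ev F r)) (≡.sym (ev-++ F r p)))
          }
        ; *-cong = *P-cong
        ; *-assoc = *P-assoc
        ; *-identity = *P-identityˡ , λ p → functionals λ F → ≡.trans (at (*P-comm p (constP 1ℚ)) F) (at (*P-identityˡ p) F)
        ; distrib = *P-distribˡ , λ p r s → functionals λ F → begin
            ev F ((r ++ s) *P p)  ≡⟨ ≡.trans (ev-mul F (r ++ s) p) (ev-++ _ r s) ⟩
            ev _ r ℚ.+ ev _ s  ≡⟨ ≡.cong₂ ℚ._+_ (ev-mul F r p) (ev-mul F s p) ⟨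
            ev F (r *P p) ℚ.+ ev F (s *P p)  ≡⟨ ev-++ F (r *P p) _ ⟨
            ev F ((r *P p) ++ (s *P p))  ∎
        }
      ; *-comm = *P-comm
      }
    }

  -- ℚ[q,t] has no zero divisors

  data _<lex_ : Exponent → Exponent → Set where
    fst< : ∀ {a b c d} → a ℕ.< c → (a , b) <lex (c , d)
    snd< : ∀ {a b d} → b ℕ.< d → (a , b) <lex (a , d)

  lex-rec : (P : Exponent → Set) → (∀ x → (∀ y → y <lex x → P y) → P x) → ∀ x → P x
  lex-rec P step (i , j) = <-rec (λ i → ∀ j → P (i , j))
    (λ i rec₁ → <-rec (λ j → P (i , j)) (λ j rec₂ → step (i , j) λ
      { _ (fst< l) → rec₁ l _ ; _ (snd< l) → rec₂ l })) i j

  lex-compare : ∀ x y → x <lex y ⊎ x ≡ y ⊎ y <lex x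
  lex-compare (a , b) (c , d) with ℕₚ.<-cmp a c
  ... | tri< l _ _ = inj₁ (fst< l)
  ... | tri> _ _ l = inj₂ (inj₂ (fst< l))
  ... | tri≈ _ ≡.refl _ with ℕₚ.<-cmp b d
  ...   | tri< l _ _ = inj₁ (snd< l)
  ...   | tri≈ _ ≡.refl _ = inj₂ (inj₁ ≡.refl)
  ...   | tri> _ _ l = inj₂ (inj₂ (snd< l))

  lex-cancel : ∀ {x y u v} → x ⊕ y ≡ u ⊕ v → u <lex x → y <lex v
  lex-cancel {a , b} {c , d} {e , f} {g , h} q (fst< l) =
    fst< (ℕₚ.≰⇒> λ g≤c → ℕₚ.<-irrefl (≡.sym (≡.cong proj₁ q)) (ℕₚ.+-mono-<-≤ l g≤c))
  lex-cancel {a , b} {c , d} {.a , f} {g , h} q (snd< l) with ℕₚ.+-cancelˡ-≡ a c g (≡.cong proj₁ q)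
  ... | ≡.refl =
    snd< (ℕₚ.≰⇒> λ h≤d → ℕₚ.<-irrefl (≡.sym (≡.cong proj₂ q)) (ℕₚ.+-mono-<-≤ l h≤d))

  lex-irrefl : ∀ {x} → ¬ (x <lex x)
  lex-irrefl (fst< l) = ℕₚ.<-irrefl ≡.refl l
  lex-irrefl (snd< l) = ℕₚ.<-irrefl ≡.refl l

  ⊕-cancelˡ : ∀ x {y z} → x ⊕ y ≡ x ⊕ z → y ≡ z
  ⊕-cancelˡ (a , b) q =
    ≡.cong₂ _,_ (ℕₚ.+-cancelˡ-≡ a _ _ (≡.cong proj₁ q)) (ℕₚ.+-cancelˡ-≡ b _ _ (≡.cong proj₂ q))

  private
    zero-or : ∀ {a b : ℚ} → a ≢ 0ℚ → b ℚ.* a ≡ 0ℚ → b ≡ 0ℚ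
    zero-or {a} {b} a≢0 e = begin
      b  ≡⟨ ℚₚ.*-identityʳ b ⟨
      b ℚ.* 1ℚ  ≡⟨ ≡.cong (b ℚ.*_) (ℚₚ.*-inverseʳ a) ⟨
      b ℚ.* (a ℚ.* (ℚ.1/ a))  ≡⟨ ℚₚ.*-assoc b a _ ⟨
      b ℚ.* a ℚ.* (ℚ.1/ a)  ≡⟨ ≡.cong (ℚ._* (ℚ.1/ a)) e ⟩
      0ℚ ℚ.* (ℚ.1/ a)  ≡⟨ ℚₚ.*-zeroˡ (ℚ.1/ a) ⟩
      0ℚ  ∎
      where instance _ = ℚ.≢-nonZero a≢0

  -- If y is lexicographically minimal in the support of r, then the coefficient of
  -- x ⊕ y in p r is (coef p x)(coef r y) as soon as p has no exponent below x.
  cancel-at-minimum : ∀ p r y → coef r y ≢ 0ℚ → (∀ z → z <lex y → coef r z ≡ 0ℚ) →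
                      (p *P r) ≋P [] → ∀ x → coef p x ≡ 0ℚ
  cancel-at-minimum p r y r≢0 below e = lex-rec _ λ x rec → zero-or r≢0 (begin
    coef p x ℚ.* coef r y  ≡⟨ ℚₚ.*-comm (coef p x) (coef r y) ⟩
    coef r y ℚ.* coef p x  ≡⟨ ≡.cong (coef r y ℚ.*_) (ev-indicator x p) ⟨
    coef r y ℚ.* ev (indicator x) p  ≡⟨ ev-* (coef r y) (indicator x) p ⟨
    ev (λ u → coef r y ℚ.* indicator x u) p  ≡⟨ difference x rec ⟩
    ev (λ u → ev (λ v → indicator (x ⊕ y) (u ⊕ v)) r) p  ≡⟨ ev-mul (indicator (x ⊕ y)) p r ⟨
    ev (indicator (x ⊕ y)) (p *P r)  ≡⟨ at e (indicator (x ⊕ y)) ⟩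
    0ℚ  ∎)
    where
    indicator-≡ : ∀ x → indicator x x ≡ 1ℚ
    indicator-≡ x = ≡.cong (if_then 1ℚ else 0ℚ) (same-refl x)

    indicator-≢ : ∀ x u → u ≢ x → indicator x u ≡ 0ℚ
    indicator-≢ x u u≢x with same u x in q
    ... | true = contradiction (same-sound _ _ q) u≢x
    ... | false = ≡.refl

    indicator-shift : ∀ x v → indicator (x ⊕ y) (x ⊕ v) ≡ indicator y v
    indicator-shift x v = by-cases (same v y) ≡.refl
      where
      by-cases : ∀ b → same v y ≡ b → indicator (x ⊕ y) (x ⊕ v) ≡ indicator y v
      by-cases true q = ≡.trans
        (≡.trans (≡.cong (λ w → indicator (x ⊕ y) (x ⊕ w)) (same-sound v y q)) (indicator-≡ (x ⊕ y)))
        (≡.sym (≡.cong (if_then 1ℚ else 0ℚ) q))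
      by-cases false q = ≡.trans
        (indicator-≢ _ _ λ w → contradiction (≡.trans (≡.sym (≡.trans
          (≡.cong (same v) (≡.sym (⊕-cancelˡ x w))) (same-refl v))) q) λ ())
        (≡.sym (≡.cong (if_then 1ℚ else 0ℚ) q))

    difference : ∀ x → (∀ u → u <lex x → coef p u ≡ 0ℚ) →
      ev (λ u → coef r y ℚ.* indicator x u) p ≡
      ev (λ u → ev (λ v → indicator (x ⊕ y) (u ⊕ v)) r) p
    difference x rec = ev-agree _ _ (invariant _) (invariant _) p agree
      where
      inner-zero : ∀ u → (∀ v → u ⊕ v ≡ x ⊕ y → coef r v ≡ 0ℚ) →
                   ev (λ v → indicator (x ⊕ y) (u ⊕ v)) r ≡ 0ℚ
      inner-zero u z = ≡.trans (ev-agree _ (λ _ → 0ℚ) (invariant _) (invariant _) r split) (ev-zero r)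
        where
        split : ∀ v → coef r v ≡ 0ℚ ⊎ indicator (x ⊕ y) (u ⊕ v) ≡ 0ℚ
        split v with same (u ⊕ v) (x ⊕ y) in q
        ... | true = inj₁ (z v (same-sound _ _ q))
        ... | false = inj₂ ≡.refl

      agree : ∀ u → coef p u ≡ 0ℚ ⊎
              coef r y ℚ.* indicator x u ≡ ev (λ v → indicator (x ⊕ y) (u ⊕ v)) r
      agree u with lex-compare u x
      ... | inj₁ l = inj₁ (rec u l)
      ... | inj₂ (inj₁ ≡.refl) = inj₂ (begin
        coef r y ℚ.* indicator u u  ≡⟨ ≡.cong (coef r y ℚ.*_) (indicator-≡ u) ⟩
        coef r y ℚ.* 1ℚ  ≡⟨ ℚₚ.*-identityʳ _ ⟩
        coef r y  ≡⟨ ev-indicator y r ⟨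
        ev (indicator y) r  ≡⟨ ev-cong (indicator-shift u) r ⟨
        ev (λ v → indicator (u ⊕ y) (u ⊕ v)) r  ∎)
      ... | inj₂ (inj₂ l) = inj₂ (begin
        coef r y ℚ.* indicator x u
          ≡⟨ ≡.cong (coef r y ℚ.*_) (indicator-≢ x u λ { ≡.refl → lex-irrefl l }) ⟩
        coef r y ℚ.* 0ℚ  ≡⟨ ℚₚ.*-zeroʳ (coef r y) ⟩
        0ℚ  ≡⟨ inner-zero u (λ v q → below v (lex-cancel q l)) ⟨
        ev (λ v → indicator (x ⊕ y) (u ⊕ v)) r  ∎)

  -- The negated hypothesis exhibits no exponent of `r`. If some coefficient of `p` were nonzero,
  -- `cancel-at-minimum` and lexicographic induction would make all coefficients of `r` zero;
  -- equality in ℚ is decidable, so arguing by contradiction is allowed.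
  domain : ∀ p r → ¬ (r ≈P []) → (p *P r) ≋P [] → p ≋P []
  domain p r r≉0 e = ≈P⇒≋P p [] λ i j → ≡.trans (coefficients p i j)
    (decidable-stable (coef p (i , j) ℚₚ.≟ 0ℚ) λ p≢0 → r≉0 λ a b → ≡.trans (coefficients r a b)
      (lex-rec (λ y → coef r y ≡ 0ℚ) (λ y below → decidable-stable (coef r y ℚₚ.≟ 0ℚ) λ r≢0 →
        p≢0 (cancel-at-minimum p r y r≢0 below e (i , j))) (a , b)))

-- The ring of fractions

module Fractions (R : CommutativeRing 0ℓ 0ℓ)
  (Nonzero : CommutativeRing.Carrier R → Set) (nonzero-1 : Nonzero (CommutativeRing.1# R))
  (nonzero-* : ∀ a b → Nonzero a → Nonzero b → Nonzero (CommutativeRing._*_ R a b))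
  (nonzero-cancel : ∀ a b → Nonzero b →
    CommutativeRing._≈_ R (CommutativeRing._*_ R a b) (CommutativeRing.0# R) →
    CommutativeRing._≈_ R a (CommutativeRing.0# R)) where
  open CommutativeRing R renaming (Carrier to C)
  open import Relation.Binary.Reasoning.Setoid setoid
  open import Algebra.Properties.Ring ring using (-‿distribˡ-*; x∙y⁻¹≈ε⇒x≈y)

  open import Algebra.Solver.Ring.NaturalCoefficients.Default commutativeSemiring
    using (solve; _:=_; _:+_; _:*_; con)

  cancelʳ : ∀ {a b c} → Nonzero c → a * c ≈ b * c → a ≈ b
  cancelʳ {a} {b} {c} n e = x∙y⁻¹≈ε⇒x≈y a b (nonzero-cancel _ _ n (begin
    (a - b) * c  ≈⟨ distribʳ c a (- b) ⟩
    a * c + - b * c  ≈⟨ +-cong e (sym (-‿distribˡ-* b c)) ⟩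
    b * c - b * c  ≈⟨ -‿inverseʳ _ ⟩
    0#  ∎))

  -- The denominator comes with a proof that it is nonzero, because transitivity of cross-multiplied
  -- equality cancels the middle denominator.
  Fraction : Set
  Fraction = Σ (C × C) (λ x → Nonzero (proj₂ x))

  infix 4 _≃_
  record _≃_ (x y : Fraction) : Set where
    constructor cross
    field eq : proj₁ (proj₁ x) * proj₂ (proj₁ y) ≈ proj₁ (proj₁ y) * proj₂ (proj₁ x)
  open _≃_ public

  infixl 6 _⊞_
  infixl 7 _⊠_
  _⊞_ _⊠_ : Fraction → Fraction → Fraction
  ((a , b) , m) ⊞ ((c , d) , n) = ((a * d) + (c * b) , b * d) , nonzero-* b d m n
  ((a , b) , m) ⊠ ((c , d) , n) = (a * c , b * d) , nonzero-* b d m n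

  ⊟_ : Fraction → Fraction
  ⊟ ((a , b) , m) = (- a , b) , m

  ≃-trans : ∀ {x y z} → x ≃ y → y ≃ z → x ≃ z
  ≃-trans {(a , b) , _} {(c , d) , n} {(e , f) , _} (cross p) (cross q) = cross (cancelʳ n (begin
    a * f * d  ≈⟨ right-comm a f d ⟩
    a * d * f  ≈⟨ *-congʳ p ⟩
    c * b * f  ≈⟨ right-comm c b f ⟩
    c * f * b  ≈⟨ *-congʳ q ⟩
    e * d * b  ≈⟨ right-comm e d b ⟩
    e * b * d  ∎))
    where
    right-comm : ∀ a b c → a * b * c ≈ a * c * b
    right-comm = solve 3 (λ a b c → a :* b :* c := a :* c :* b) refl

  ⊞-cong : ∀ {x x′ y y′} → x ≃ x′ → y ≃ y′ → x ⊞ y ≃ x′ ⊞ y′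
  ⊞-cong {(a , b) , _} {(a′ , b′) , _} {(c , d) , _} {(c′ , d′) , _} (cross p) (cross q) = cross (begin
    (a * d + c * b) * (b′ * d′)  ≈⟨ expand a b c d b′ d′ ⟩
    a * b′ * (d * d′) + c * d′ * (b * b′)  ≈⟨ +-cong (*-congʳ p) (*-congʳ q) ⟩
    a′ * b * (d * d′) + c′ * d * (b * b′)  ≈⟨ collect a′ b c′ d b′ d′ ⟩
    (a′ * d′ + c′ * b′) * (b * d)  ∎)
    where
    expand : ∀ a b c d b′ d′ →
      (a * d + c * b) * (b′ * d′) ≈ a * b′ * (d * d′) + c * d′ * (b * b′)
    expand = solve 6 (λ a b c d b′ d′ → (a :* d :+ c :* b) :* (b′ :* d′) := a :* b′ :* (d :* d′) :+ c :* d′ :* (b :* b′)) refl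
    collect : ∀ a′ b c′ d b′ d′ →
      a′ * b * (d * d′) + c′ * d * (b * b′) ≈ (a′ * d′ + c′ * b′) * (b * d)
    collect = solve 6 (λ a′ b c′ d b′ d′ → a′ :* b :* (d :* d′) :+ c′ :* d :* (b :* b′) := (a′ :* d′ :+ c′ :* b′) :* (b :* d)) refl

  ⊠-cong : ∀ {x x′ y y′} → x ≃ x′ → y ≃ y′ → x ⊠ y ≃ x′ ⊠ y′
  ⊠-cong {(a , b) , _} {(a′ , b′) , _} {(c , d) , _} {(c′ , d′) , _} (cross p) (cross q) = cross (begin
    a * c * (b′ * d′)  ≈⟨ swap-inner a c b′ d′ ⟩
    a * b′ * (c * d′)  ≈⟨ *-cong p q ⟩
    a′ * b * (c′ * d)  ≈⟨ swap-inner a′ b c′ d ⟩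
    a′ * c′ * (b * d)  ∎)
    where
    swap-inner : ∀ a b c d → a * b * (c * d) ≈ a * c * (b * d)
    swap-inner = solve 4 (λ a b c d → a :* b :* (c :* d) := a :* c :* (b :* d)) refl

  ⊞-comm : ∀ x y → x ⊞ y ≃ y ⊞ x
  ⊞-comm ((a , b) , _) ((c , d) , _) = cross
    (solve 4 (λ a b c d → (a :* d :+ c :* b) :* (d :* b) := (c :* b :+ a :* d) :* (b :* d)) refl a b c d)

  ⊞-assoc : ∀ x y z → (x ⊞ y) ⊞ z ≃ x ⊞ (y ⊞ z)
  ⊞-assoc ((a , b) , _) ((c , d) , _) ((e , f) , _) = cross
    (solve 6 (λ a b c d e f → ((a :* d :+ c :* b) :* f :+ e :* (b :* d)) :* (b :* (d :* f)) := (a :* (d :* f) :+ (c :* f :+ e :* d) :* b) :* ((b :* d) :* f)) refl a b c d e f)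

  ⊠-comm : ∀ x y → x ⊠ y ≃ y ⊠ x
  ⊠-comm ((a , b) , _) ((c , d) , _) = cross
    (solve 4 (λ a b c d → a :* c :* (d :* b) := c :* a :* (b :* d)) refl a b c d)

  ⊠-assoc : ∀ x y z → (x ⊠ y) ⊠ z ≃ x ⊠ (y ⊠ z)
  ⊠-assoc ((a , b) , _) ((c , d) , _) ((e , f) , _) = cross
    (solve 6 (λ a b c d e f → ((a :* c) :* e) :* (b :* (d :* f)) := (a :* (c :* e)) :* ((b :* d) :* f)) refl a b c d e f)

  ⊠-distribˡ : ∀ x y z → x ⊠ (y ⊞ z) ≃ (x ⊠ y) ⊞ (x ⊠ z)
  ⊠-distribˡ ((a , b) , _) ((c , d) , _) ((e , f) , _) = cross
    (solve 6 (λ a b c d e f → (a :* (c :* f :+ e :* d)) :* ((b :* d) :* (b :* f)) := ((a :* c) :* (b :* f) :+ (a :* e) :* (b :* d)) :* (b :* (d :* f))) refl a b c d e f)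

  zeroF oneF : Fraction
  zeroF = (0# , 1#) , nonzero-1
  oneF = (1# , 1#) , nonzero-1

  ⊞-identityˡ : ∀ x → zeroF ⊞ x ≃ x
  ⊞-identityˡ ((a , b) , _) = cross
    (solve 2 (λ a b → (con 0 :* b :+ a :* con 1) :* b := a :* (con 1 :* b)) refl a b)

  ⊠-identityˡ : ∀ x → oneF ⊠ x ≃ x
  ⊠-identityˡ ((a , b) , _) = cross
    (solve 2 (λ a b → (con 1 :* a) :* b := a :* (con 1 :* b)) refl a b)

  ⊞-inverseˡ : ∀ x → ⊟ x ⊞ x ≃ zeroF
  ⊞-inverseˡ ((a , b) , _) = cross (begin
    (- a * b + a * b) * 1#  ≈⟨ *-identityʳ _ ⟩
    - a * b + a * b  ≈⟨ distribʳ b (- a) a ⟨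
    (- a + a) * b  ≈⟨ trans (*-congʳ (-‿inverseˡ a)) (zeroˡ b) ⟩
    0#  ≈⟨ zeroˡ _ ⟨
    0# * (b * b)  ∎)

  fractions : CommutativeRing 0ℓ 0ℓ
  fractions = record
    { Carrier = Fraction
    ; _≈_ = _≃_
    ; _+_ = _⊞_
    ; _*_ = _⊠_
    ; -_ = ⊟_
    ; 0# = zeroF
    ; 1# = oneF
    ; isCommutativeRing = record
      { isRing = record
        { +-isAbelianGroup = record
          { isGroup = record
            { isMonoid = record
              { isSemigroup = record
                { isMagma = record
                  { isEquivalence = record
                    { refl = cross refl
                    ; sym = λ e → cross (sym (eq e))
                    ; trans = ≃-trans
                    }
                  ; ∙-cong = ⊞-cong
                  }
                ; assoc = ⊞-assoc
                }
              ; identity = ⊞-identityˡ , λ x → ≃-trans (⊞-comm x zeroF) (⊞-identityˡ x)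
              }
            ; inverse = ⊞-inverseˡ , λ x → ≃-trans (⊞-comm x (⊟ x)) (⊞-inverseˡ x)
            ; ⁻¹-cong = λ {((a , b) , _)} {((c , d) , _)} e → cross
                (trans (sym (-‿distribˡ-* a d)) (trans (-‿cong (eq e)) (-‿distribˡ-* c b)))
            }
          ; comm = ⊞-comm
          }
        ; *-cong = ⊠-cong
        ; *-assoc = ⊠-assoc
        ; *-identity = ⊠-identityˡ , λ x → ≃-trans (⊠-comm x oneF) (⊠-identityˡ x)
        ; distrib = ⊠-distribˡ , λ x y z → ≃-trans (⊠-comm (y ⊞ z) x)
            (≃-trans (⊠-distribˡ x y z) (⊞-cong (⊠-comm x y) (⊠-comm x z)))
        }
      ; *-comm = ⊠-comm
      }
    }

-- Integer indices and integer vectors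

-- Written with the same summands as in `raise`, so that raising a pair of entries reduces to `up`
-- and `down` by computation.
up down : ℤ → ℤ
up x = x ℤ.+ (+ 1)
down x = x ℤ.+ (ℤ.- (+ 1))

up-down : ∀ x → up (down x) ≡ x
up-down x = ≡.trans (ℤₚ.+-assoc x (ℤ.- (+ 1)) (+ 1)) (ℤₚ.+-identityʳ x)

down-up : ∀ x → down (up x) ≡ x
down-up x = ≡.trans (ℤₚ.+-assoc x (+ 1) (ℤ.- (+ 1))) (ℤₚ.+-identityʳ x)

up^ : ℕ → ℤ → ℤ
up^ zero x = x
up^ (suc n) x = up^ n (up x)

up^-up : ∀ d x → up^ d (up x) ≡ up (up^ d x)
up^-up zero x = ≡.refl
up^-up (suc d) x = up^-up d (up x)

up^-+ : ∀ a b x → up^ (a ℕ.+ b) x ≡ up^ a (up^ b x)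
up^-+ zero b x = ≡.refl
up^-+ (suc a) b x = ≡.trans (up^-+ a b (up x)) (≡.cong (up^ a) (up^-up b x))

up^≡+ : ∀ d x → up^ d x ≡ x ℤ.+ (+ d)
up^≡+ zero x = ≡.sym (ℤₚ.+-identityʳ x)
up^≡+ (suc d) x = ≡.trans (up^≡+ d (up x)) (ℤₚ.+-assoc x (+ 1) (+ d))

<⇒≤down : ∀ {x y} → x ℤ.< y → x ℤ.≤ down y
<⇒≤down {y = y} l = ℤₚ.≤-trans (ℤₚ.i<j⇒i≤pred[j] l) (ℤₚ.≤-reflexive (ℤₚ.+-comm (ℤ.- (+ 1)) y))

<up⇒≤ : ∀ {x y} → x ℤ.< up y → x ℤ.≤ y
<up⇒≤ {x} {y} l = ℤₚ.≤-trans (<⇒≤down l) (ℤₚ.≤-reflexive (down-up y))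

x≤up : ∀ x → x ℤ.≤ up x
x≤up x = ℤₚ.≤-trans (ℤₚ.≤-reflexive (≡.sym (ℤₚ.+-identityʳ x))) (ℤₚ.+-monoʳ-≤ x (ℤ.+≤+ z≤n))

up-mono : ∀ {x y} → x ℤ.≤ y → up x ℤ.≤ up y
up-mono l = ℤₚ.+-monoˡ-≤ (+ 1) l

down-mono : ∀ {x y} → x ℤ.≤ y → down x ℤ.≤ down y
down-mono l = ℤₚ.+-monoˡ-≤ (ℤ.- (+ 1)) l

down≤x : ∀ x → down x ℤ.≤ x
down≤x x = ℤₚ.≤-trans (x≤up (down x)) (ℤₚ.≤-reflexive (up-down x))

x≤up^ : ∀ d x → x ℤ.≤ up^ d x
x≤up^ zero x = ℤₚ.≤-refl
x≤up^ (suc d) x = ℤₚ.≤-trans (x≤up x) (x≤up^ d (up x))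

Descending : ∀ {n} → Vec ℤ n → Set
Descending [] = ⊤
Descending (x ∷ xs) = VAll.All (ℤ._≤ x) xs × Descending xs

all-replicate : ∀ {P : ℤ → Set} n {x} → P x → VAll.All P (replicate n x)
all-replicate zero p = []
all-replicate (suc n) p = p ∷ all-replicate n p

descending-replicate : ∀ n x → Descending (replicate n x)
descending-replicate zero x = tt
descending-replicate (suc n) x = all-replicate n ℤₚ.≤-refl , descending-replicate n x

data At (b : ℤ) : ∀ {n} → ℕ → Vec ℤ n → Set where
  here : ∀ {n} {X : Vec ℤ n} → At b 0 (b ∷ X)
  there : ∀ {n p x} {X : Vec ℤ n} → At b p X → At b (suc p) (x ∷ X)

Placed : ∀ {m n} → ℕ → Vec ℤ m → Vec ℤ n → Set
Placed p [] X = ⊤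
Placed p (u ∷ us) X = At u p X × Placed (suc p) us X

placed-there : ∀ {m n p x} (us : Vec ℤ m) {X : Vec ℤ n} → Placed p us X → Placed (suc p) us (x ∷ X)
placed-there [] _ = tt
placed-there (u ∷ us) (a , q) = there a , placed-there us q

placed-self : ∀ {n} (us : Vec ℤ n) → Placed 0 us us
placed-self [] = tt
placed-self (u ∷ us) = here , placed-there us (placed-self us)

-- Calculus of raising operators

module Raising (V : AbelianGroup 0ℓ 0ℓ) (ν : AbelianGroup.Carrier V → AbelianGroup.Carrier V)
  (ν-cong : ∀ {x y} → AbelianGroup._≈_ V x y → AbelianGroup._≈_ V (ν x) (ν y))
  (ν-+ : ∀ x y → AbelianGroup._≈_ V (ν (AbelianGroup._∙_ V x y)) (AbelianGroup._∙_ V (ν x) (ν y)))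
  where
  open AbelianGroup V renaming (Carrier to A; _∙_ to _+_; ε to 0#; _⁻¹ to -_)
  open import Relation.Binary.Reasoning.Setoid setoid
  open import Algebra.Properties.AbelianGroup V using (inverseˡ-unique; identityʳ-unique)
  open import Algebra.Properties.CommutativeSemigroup commutativeSemigroup using (interchange)

  open import Algebra.Solver.CommutativeMonoid commutativeMonoid using (solve; _⊜_; _⊕_)

  +-cong : ∀ {x y u v} → x ≈ y → u ≈ v → x + u ≈ y + v
  +-cong = ∙-cong

  ν-0 : ν 0# ≈ 0#
  ν-0 = identityʳ-unique (ν 0#) (ν 0#) (trans (sym (ν-+ 0# 0#)) (ν-cong (identityˡ 0#)))

  0+0 : ∀ {x y} → x ≈ 0# → y ≈ 0# → x + y ≈ 0#
  0+0 e₁ e₂ = trans (+-cong e₁ e₂) (identityˡ 0#)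

  ν-zero : ∀ {x} → x ≈ 0# → ν x ≈ 0#
  ν-zero e = trans (ν-cong e) ν-0

  -- The product of 1 + ν e_b over the entries b of the second argument, where e_b raises
  -- the first argument and lowers b (so ν is multiplication by - t).
  couple : ∀ {n} → ℤ → Vec ℤ n → (ℤ → Vec ℤ n → A) → A
  couple a [] φ = φ a []
  couple a (b ∷ bs) φ = couple a bs (λ a′ bs′ → φ a′ (b ∷ bs′)) +
                        ν (couple (up a) bs (λ a′ bs′ → φ a′ (down b ∷ bs′)))

  -- The factors that join two blocks: one for each pair with its raised entry on the left and its
  -- lowered entry on the right.
  coupleAll : ∀ {m n} → Vec ℤ m → Vec ℤ n → (Vec ℤ m → Vec ℤ n → A) → A
  coupleAll [] bs φ = φ [] bs
  coupleAll (a ∷ as) bs φ =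
    couple a bs (λ a′ bs′ → coupleAll as bs′ (λ as′ bs″ → φ (a′ ∷ as′) bs″))

  coupleColumn : ∀ {m} → Vec ℤ m → ℤ → (Vec ℤ m → ℤ → A) → A
  coupleColumn [] b φ = φ [] b
  coupleColumn (a ∷ as) b φ = coupleColumn as b (λ as′ → φ (a ∷ as′)) +
                              ν (coupleColumn as (down b) (λ as′ → φ (up a ∷ as′)))

  -- The product of all factors 1 + ν e_ab with a before b. With a word in the operators B as `φ`,
  -- this is the defining formula of B_μ.
  block : ∀ {n} → Vec ℤ n → (Vec ℤ n → A) → A
  block [] φ = φ []
  block (a ∷ as) φ = couple a as (λ a′ as′ → block as′ (λ as″ → φ (a′ ∷ as″)))

  record Linear (L : A → A) : Set where
    field
      cong : ∀ {x y} → x ≈ y → L x ≈ L y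
      add : ∀ x y → L (x + y) ≈ L x + L y
      scale : ∀ x → L (ν x) ≈ ν (L x)
  open Linear public

  ν-linear : Linear ν
  ν-linear = record { cong = ν-cong ; add = ν-+ ; scale = λ _ → refl }

  linear-0 : ∀ {L} → Linear L → L 0# ≈ 0#
  linear-0 {L} l = identityʳ-unique (L 0#) (L 0#) (trans (sym (add l 0# 0#)) (cong l (identityˡ 0#)))

  couple-cong : ∀ {n} a (bs : Vec ℤ n) {φ χ : ℤ → Vec ℤ n → A} → (∀ a bs → φ a bs ≈ χ a bs) → couple a bs φ ≈ couple a bs χ
  couple-cong a [] e = e a []
  couple-cong a (b ∷ bs) e = +-cong (couple-cong a bs (λ _ _ → e _ _))
                                    (ν-cong (couple-cong (up a) bs (λ _ _ → e _ _)))

  couple-+ : ∀ {n} a (bs : Vec ℤ n) (φ χ : ℤ → Vec ℤ n → A) → couple a bs (λ a bs → φ a bs + χ a bs) ≈ couple a bs φ + couple a bs χ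
  couple-+ a [] φ χ = refl
  couple-+ a (b ∷ bs) φ χ = trans
    (+-cong (couple-+ a bs _ _) (trans (ν-cong (couple-+ (up a) bs _ _)) (ν-+ _ _)))
    (interchange _ _ _ _)

  couple-linear : ∀ {L} → Linear L → ∀ {n} a (bs : Vec ℤ n) (φ : ℤ → Vec ℤ n → A) → L (couple a bs φ) ≈ couple a bs (λ a bs → L (φ a bs))
  couple-linear l a [] φ = refl
  couple-linear l a (b ∷ bs) φ = trans (add l _ _) (+-cong (couple-linear l a bs _)
    (trans (scale l _) (ν-cong (couple-linear l (up a) bs _))))

  couple-ν : ∀ {n} a (bs : Vec ℤ n) (φ : ℤ → Vec ℤ n → A) → couple a bs (λ a bs → ν (φ a bs)) ≈ ν (couple a bs φ)
  couple-ν a bs φ = sym (couple-linear ν-linear a bs φ)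

  couple-zero : ∀ {n} a (bs : Vec ℤ n) {φ : ℤ → Vec ℤ n → A} → (∀ a bs → φ a bs ≈ 0#) → couple a bs φ ≈ 0#
  couple-zero a [] e = e a []
  couple-zero a (b ∷ bs) e =
    0+0 (couple-zero a bs (λ _ _ → e _ _)) (ν-zero (couple-zero (up a) bs (λ _ _ → e _ _)))

  couple-up : ∀ {n} a (bs : Vec ℤ n) (φ : ℤ → Vec ℤ n → A) → couple (up a) bs φ ≈ couple a bs (λ a → φ (up a))
  couple-up a [] φ = refl
  couple-up a (b ∷ bs) φ = +-cong (couple-up a bs _) (ν-cong (couple-up (up a) bs _))

  couple-down : ∀ {n} a (bs : Vec ℤ n) (φ : ℤ → Vec ℤ n → A) → couple (down a) bs φ ≈ couple a bs (λ a → φ (down a))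
  couple-down a [] φ = refl
  couple-down a (b ∷ bs) φ = +-cong (couple-down a bs _) (ν-cong (trans
    (reflexive (≡.cong (λ x → couple x bs (λ a bs → φ a (down b ∷ bs)))
      (≡.trans (up-down a) (≡.sym (down-up a)))))
    (couple-down (up a) bs _)))

  couple-++ : ∀ {m n} a (v : Vec ℤ m) (w : Vec ℤ n) (φ : ℤ → Vec ℤ (m ℕ.+ n) → A) → couple a (v ++ᵛ w) φ ≈
              couple a v (λ a′ v′ → couple a′ w (λ a″ w′ → φ a″ (v′ ++ᵛ w′)))
  couple-++ a [] w φ = refl
  couple-++ a (b ∷ v) w φ = +-cong (couple-++ a v w _) (ν-cong (couple-++ (up a) v w _))

  couple-fubini : ∀ {m n} a (v : Vec ℤ m) b (w : Vec ℤ n) (H : ℤ → Vec ℤ m → ℤ → Vec ℤ n → A) →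
    couple a v (λ a′ v′ → couple b w (λ b′ w′ → H a′ v′ b′ w′)) ≈
    couple b w (λ b′ w′ → couple a v (λ a′ v′ → H a′ v′ b′ w′))
  couple-fubini a [] b w H = refl
  couple-fubini a (c ∷ v) b w H = begin
    couple a v (λ a′ v′ → couple b w (λ b′ w′ → H a′ (c ∷ v′) b′ w′)) +
    ν (couple (up a) v (λ a′ v′ → couple b w (λ b′ w′ → H a′ (down c ∷ v′) b′ w′)))
      ≈⟨ +-cong (couple-fubini a v b w (λ a′ v′ → H a′ (c ∷ v′)))
                (ν-cong (couple-fubini (up a) v b w (λ a′ v′ → H a′ (down c ∷ v′)))) ⟩
    couple b w G₁ + ν (couple b w G₂)  ≈⟨ +-cong refl (couple-linear ν-linear b w G₂) ⟩
    couple b w G₁ + couple b w (λ b′ w′ → ν (G₂ b′ w′))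
      ≈⟨ couple-+ b w G₁ (λ b′ w′ → ν (G₂ b′ w′)) ⟨
    couple b w (λ b′ w′ → G₁ b′ w′ + ν (G₂ b′ w′))  ∎
    where
    G₁ G₂ : ℤ → Vec ℤ _ → A
    G₁ b′ w′ = couple a v (λ a′ v′ → H a′ (c ∷ v′) b′ w′)
    G₂ b′ w′ = couple (up a) v (λ a′ v′ → H a′ (down c ∷ v′) b′ w′)

  -- Unlike in `couple-fubini`, both products raise the same entry; they commute because `couple`
  -- only adds to it (`couple-up`).
  couple-comm : ∀ {m n} a (v : Vec ℤ m) (w : Vec ℤ n) (F : ℤ → Vec ℤ m → Vec ℤ n → A) →
    couple a v (λ a′ v′ → couple a′ w (λ a″ w′ → F a″ v′ w′)) ≈
    couple a w (λ a′ w′ → couple a′ v (λ a″ v′ → F a″ v′ w′))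
  couple-comm a [] w F = refl
  couple-comm a (b ∷ v) w F = begin
    couple a v (λ a′ v′ → couple a′ w (λ a″ w′ → F a″ (b ∷ v′) w′)) +
    ν (couple (up a) v (λ a′ v′ → couple a′ w (λ a″ w′ → F a″ (down b ∷ v′) w′)))
      ≈⟨ +-cong (couple-comm a v w (λ a′ v′ → F a′ (b ∷ v′)))
           (ν-cong (couple-comm (up a) v w (λ a′ v′ → F a′ (down b ∷ v′)))) ⟩
    couple a w G₁ + ν (couple (up a) w G₂)
      ≈⟨ +-cong refl (ν-cong (couple-up a w G₂)) ⟩
    couple a w G₁ + ν (couple a w (λ a′ → G₂ (up a′)))
      ≈⟨ +-cong refl (couple-linear ν-linear a w (λ a′ → G₂ (up a′))) ⟩
    couple a w G₁ + couple a w (λ a′ w′ → ν (G₂ (up a′) w′))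
      ≈⟨ couple-+ a w G₁ (λ a′ w′ → ν (G₂ (up a′) w′)) ⟨
    couple a w (λ a′ w′ → G₁ a′ w′ + ν (G₂ (up a′) w′))  ∎
    where
    G₁ G₂ : ℤ → Vec ℤ _ → A
    G₁ a′ w′ = couple a′ v (λ a″ v′ → F a″ (b ∷ v′) w′)
    G₂ a′ w′ = couple a′ v (λ a″ v′ → F a″ (down b ∷ v′) w′)

  coupleAll-cong : ∀ {m n} (as : Vec ℤ m) (bs : Vec ℤ n) {φ χ : Vec ℤ m → Vec ℤ n → A} →
                   (∀ as bs → φ as bs ≈ χ as bs) → coupleAll as bs φ ≈ coupleAll as bs χ
  coupleAll-cong [] bs e = e [] bs
  coupleAll-cong (a ∷ as) bs e = couple-cong a bs (λ _ _ → coupleAll-cong as _ (λ _ _ → e _ _))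

  coupleAll-+ : ∀ {m n} (as : Vec ℤ m) (bs : Vec ℤ n) (φ χ : Vec ℤ m → Vec ℤ n → A) →
    coupleAll as bs (λ as bs → φ as bs + χ as bs) ≈ coupleAll as bs φ + coupleAll as bs χ
  coupleAll-+ [] bs φ χ = refl
  coupleAll-+ (a ∷ as) bs φ χ = trans
    (couple-cong a bs (λ a bs → coupleAll-+ as bs (λ as → φ (a ∷ as)) (λ as → χ (a ∷ as))))
    (couple-+ a bs _ _)

  coupleAll-linear : ∀ {L} → Linear L → ∀ {m n} (as : Vec ℤ m) (bs : Vec ℤ n) (φ : Vec ℤ m → Vec ℤ n → A) →
                     L (coupleAll as bs φ) ≈ coupleAll as bs (λ as bs → L (φ as bs))
  coupleAll-linear l [] bs φ = refl
  coupleAll-linear l (a ∷ as) bs φ =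
    trans (couple-linear l a bs _)
          (couple-cong a bs (λ a bs → coupleAll-linear l as bs (λ as → φ (a ∷ as))))

  -- The entries of `v` are lowered against `a` and raised against `w`. Both are shifts by
  -- constants, so the order does not matter.
  couple-coupleAll : ∀ {m n} a (v : Vec ℤ m) (w : Vec ℤ n) (F : ℤ → Vec ℤ m → Vec ℤ n → A) →
    couple a v (λ a′ v′ → coupleAll v′ w (F a′)) ≈
    coupleAll v w (λ v′ w′ → couple a v′ (λ a′ v″ → F a′ v″ w′))
  couple-coupleAll a [] w F = refl
  couple-coupleAll {suc m} {n} a (b ∷ v) w F = begin
    couple a v (λ a′ v′ → coupleAll (b ∷ v′) w (F a′)) +
    ν (couple (up a) v (λ a′ v′ → coupleAll (down b ∷ v′) w (F a′)))
      ≈⟨ +-cong (rearrange a b) (ν-cong (rearrange (up a) (down b))) ⟩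
    couple b w (G a) + ν (couple (down b) w (G (up a)))
      ≈⟨ +-cong refl (ν-cong (couple-down b w (G (up a)))) ⟩
    couple b w (G a) + ν (couple b w (λ b′ → G (up a) (down b′)))
      ≈⟨ +-cong refl (sym (couple-ν b w (λ b′ → G (up a) (down b′)))) ⟩
    couple b w (G a) + couple b w (λ b′ w′ → ν (G (up a) (down b′) w′))
      ≈⟨ couple-+ b w (G a) (λ b′ w′ → ν (G (up a) (down b′) w′)) ⟨
    couple b w (λ b′ w′ → G a b′ w′ + ν (G (up a) (down b′) w′))
      ≈⟨ couple-cong b w collect ⟩
    coupleAll (b ∷ v) w (λ v′ w′ → couple a v′ (λ a′ v″ → F a′ v″ w′))  ∎
    where
    G : ℤ → ℤ → Vec ℤ n → A
    G a b w = coupleAll v w (λ v′ w′ → couple a v′ (λ a′ v″ → F a′ (b ∷ v″) w′))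

    rearrange : ∀ a b → couple a v (λ a′ v′ → coupleAll (b ∷ v′) w (F a′)) ≈ couple b w (G a)
    rearrange a b = begin
      couple a v (λ a′ v′ → couple b w (λ b′ w′ → coupleAll v′ w′ (λ v″ → F a′ (b′ ∷ v″))))
        ≈⟨ couple-fubini a v b w (λ a′ v′ b′ w′ → coupleAll v′ w′ (λ v″ → F a′ (b′ ∷ v″))) ⟩
      couple b w (λ b′ w′ → couple a v (λ a′ v′ → coupleAll v′ w′ (λ v″ → F a′ (b′ ∷ v″))))
        ≈⟨ couple-cong b w (λ b′ w′ → couple-coupleAll a v w′ (λ a′ v″ → F a′ (b′ ∷ v″))) ⟩
      couple b w (G a)  ∎

    collect : ∀ b′ w′ → G a b′ w′ + ν (G (up a) (down b′) w′) ≈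
              coupleAll v w′ (λ v′ w″ → couple a (b′ ∷ v′) (λ a′ v″ → F a′ v″ w″))
    collect b′ w′ = begin
      G a b′ w′ + ν (G (up a) (down b′) w′)
        ≈⟨ +-cong refl (coupleAll-linear ν-linear v w′ H₂) ⟩
      coupleAll v w′ H₁ + coupleAll v w′ (λ v′ w″ → ν (H₂ v′ w″))
        ≈⟨ coupleAll-+ v w′ H₁ (λ v′ w″ → ν (H₂ v′ w″)) ⟨
      coupleAll v w′ (λ v′ w″ → H₁ v′ w″ + ν (H₂ v′ w″))  ∎
      where
      H₁ H₂ : Vec ℤ m → Vec ℤ n → A
      H₁ v′ w″ = couple a v′ (λ a′ v″ → F a′ (b′ ∷ v″) w″)
      H₂ v′ w″ = couple (up a) v′ (λ a′ v″ → F a′ (down b′ ∷ v″) w″)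

  -- The middle block takes part in both couplings. This is the interchange that moves a part of the
  -- rectangle over to the next block.
  coupleAll-comm : ∀ {l m n} (as : Vec ℤ l) (bs : Vec ℤ m) (us : Vec ℤ n)
    (F : Vec ℤ l → Vec ℤ m → Vec ℤ n → A) →
    coupleAll as bs (λ as′ bs′ → coupleAll bs′ us (F as′)) ≈
    coupleAll bs us (λ bs′ us′ → coupleAll as bs′ (λ as′ bs″ → F as′ bs″ us′))
  coupleAll-comm [] bs us F = refl
  coupleAll-comm (a ∷ as) bs us F = trans
    (couple-cong a bs (λ a′ bs′ → coupleAll-comm as bs′ us (λ as′ → F (a′ ∷ as′))))
    (couple-coupleAll a bs us _)

  block-cong : ∀ {n} (v : Vec ℤ n) {φ χ : Vec ℤ n → A} → (∀ v → φ v ≈ χ v) → block v φ ≈ block v χ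
  block-cong [] e = e []
  block-cong (a ∷ v) e = couple-cong a v (λ _ v′ → block-cong v′ (λ _ → e _))

  block-+ : ∀ {n} (v : Vec ℤ n) (φ χ : Vec ℤ n → A) → block v (λ v → φ v + χ v) ≈ block v φ + block v χ
  block-+ [] φ χ = refl
  block-+ (a ∷ v) φ χ = trans
    (couple-cong a v (λ a v → block-+ v (λ v → φ (a ∷ v)) (λ v → χ (a ∷ v)))) (couple-+ a v _ _)

  block-linear : ∀ {L} → Linear L → ∀ {n} (v : Vec ℤ n) (φ : Vec ℤ n → A) → L (block v φ) ≈ block v (λ v → L (φ v))
  block-linear l [] φ = refl
  block-linear l (a ∷ v) φ =
    trans (couple-linear l a v _) (couple-cong a v (λ a v → block-linear l v (λ v → φ (a ∷ v))))

  -- A pair of rows lies inside `v`, inside `w`, or across.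
  block-++ : ∀ {m n} (v : Vec ℤ m) (w : Vec ℤ n) (φ : Vec ℤ (m ℕ.+ n) → A) → block (v ++ᵛ w) φ ≈
    coupleAll v w (λ v′ w′ → block v′ (λ v″ → block w′ (λ w″ → φ (v″ ++ᵛ w″))))
  block-++ [] w φ = refl
  block-++ (a ∷ v) w φ = begin
    couple a (v ++ᵛ w) (λ a′ z → block z (λ z′ → φ (a′ ∷ z′)))
      ≈⟨ couple-++ a v w _ ⟩
    couple a v (λ a′ v′ → couple a′ w (λ a″ w′ → block (v′ ++ᵛ w′) (λ z′ → φ (a″ ∷ z′))))
      ≈⟨ couple-cong a v (λ a′ v′ → couple-cong a′ w (λ a″ w′ → block-++ v′ w′ _)) ⟩
    couple a v (λ a′ v′ → couple a′ w (λ a″ w′ → coupleAll v′ w′ (Φ a″)))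
      ≈⟨ couple-comm a v w (λ a″ v′ w′ → coupleAll v′ w′ (Φ a″)) ⟩
    couple a w (λ a′ w′ → couple a′ v (λ a″ v′ → coupleAll v′ w′ (Φ a″)))
      ≈⟨ couple-cong a w (λ a′ w′ → couple-coupleAll a′ v w′ Φ) ⟩
    couple a w (λ a′ w′ → coupleAll v w′ (λ v′ w″ → couple a′ v′ (λ a″ v″ → Φ a″ v″ w″)))  ∎
    where
    Φ : ℤ → Vec ℤ _ → Vec ℤ _ → A
    Φ a v w = block v (λ v′ → block w (λ w′ → φ (a ∷ v′ ++ᵛ w′)))

  couple-coupleColumn : ∀ {m n} a (bs : Vec ℤ n) (as : Vec ℤ m) b
    (H : ℤ → Vec ℤ n → Vec ℤ m → ℤ → A) →
    couple a bs (λ a′ bs′ → coupleColumn as b (H a′ bs′)) ≈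
    coupleColumn as b (λ as′ b′ → couple a bs (λ a′ bs′ → H a′ bs′ as′ b′))
  couple-coupleColumn a bs [] b H = refl
  couple-coupleColumn a bs (c ∷ as) b H = trans (couple-+ a bs _ _)
    (+-cong (couple-coupleColumn a bs as b _)
      (trans (couple-ν a bs _) (ν-cong (couple-coupleColumn a bs as (down b) _))))

  coupleColumn-cong : ∀ {m} (as : Vec ℤ m) b {θ η : Vec ℤ m → ℤ → A} → (∀ as b → θ as b ≈ η as b) →
                      coupleColumn as b θ ≈ coupleColumn as b η
  coupleColumn-cong [] b e = e [] b
  coupleColumn-cong (a ∷ as) b e = +-cong (coupleColumn-cong as b (λ _ _ → e _ _))
    (ν-cong (coupleColumn-cong as (down b) (λ _ _ → e _ _)))

  coupleColumn-zero : ∀ {m} (as : Vec ℤ m) b {θ : Vec ℤ m → ℤ → A} → (∀ as b → θ as b ≈ 0#) → coupleColumn as b θ ≈ 0#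
  coupleColumn-zero [] b e = e [] b
  coupleColumn-zero (a ∷ as) b e = 0+0 (coupleColumn-zero as b (λ _ _ → e _ _))
    (ν-zero (coupleColumn-zero as (down b) (λ _ _ → e _ _)))

  -- The recursion of `coupleAll` goes by rows; the dual Cauchy argument also has to take off a
  -- column first.
  coupleAll-∷ : ∀ {m n} (as : Vec ℤ m) b (bs : Vec ℤ n) (Φ : Vec ℤ m → Vec ℤ (suc n) → A) → coupleAll as (b ∷ bs) Φ ≈
    coupleColumn as b (λ as′ b′ → coupleAll as′ bs (λ as″ bs′ → Φ as″ (b′ ∷ bs′)))
  coupleAll-∷ [] b bs Φ = refl
  coupleAll-∷ (a ∷ as) b bs Φ = +-cong (step a b) (ν-cong (step (up a) (down b)))
    where
    step : ∀ a b → couple a bs (λ a′ bs′ → coupleAll as (b ∷ bs′) (λ as′ → Φ (a′ ∷ as′))) ≈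
      coupleColumn as b (λ as′ b′ → coupleAll (a ∷ as′) bs (λ as″ bs′ → Φ as″ (b′ ∷ bs′)))
    step a b = trans
      (couple-cong a bs (λ a′ bs′ → coupleAll-∷ as b bs′ (λ as′ → Φ (a′ ∷ as′))))
      (couple-coupleColumn a bs as b _)

  -- Antisymmetry and its preservation under raising

  Antisymmetric : ∀ {n} → (Vec ℤ n → A) → Set
  Antisymmetric {zero} ψ = ⊤
  Antisymmetric {suc zero} ψ = ⊤
  Antisymmetric {suc (suc n)} ψ =
    (∀ a b s → ψ (a ∷ b ∷ s) + ψ (down b ∷ up a ∷ s) ≈ 0#) ×
    (∀ x → Antisymmetric (λ v → ψ (x ∷ v)))

  tail-anti : ∀ {n} (ψ : Vec ℤ (suc n) → A) → Antisymmetric ψ → ∀ x → Antisymmetric (λ v → ψ (x ∷ v))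
  tail-anti {zero} ψ anti x = tt
  tail-anti {suc n} ψ anti x = proj₂ anti x

  anti-+ : ∀ {n} {ψ χ : Vec ℤ n → A} → Antisymmetric ψ → Antisymmetric χ →
           Antisymmetric (λ v → ψ v + χ v)
  anti-+ {zero} p q = tt
  anti-+ {suc zero} p q = tt
  anti-+ {suc (suc n)} p q =
    (λ a b s → trans (interchange _ _ _ _) (0+0 (proj₁ p a b s) (proj₁ q a b s))) ,
    (λ x → anti-+ (proj₂ p x) (proj₂ q x))

  anti-linear : ∀ {L} → Linear L → ∀ {n} {ψ : Vec ℤ n → A} →
                Antisymmetric ψ → Antisymmetric (λ v → L (ψ v))
  anti-linear l {zero} p = tt
  anti-linear l {suc zero} p = tt
  anti-linear l {suc (suc n)} p =
    (λ a b s → trans (sym (add l _ _)) (trans (cong l (proj₁ p a b s)) (linear-0 l))) ,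
    (λ x → anti-linear l (proj₂ p x))

  private
    pair-up : ∀ x y z w x′ y′ z′ w′ →
      ((x + y) + (z + w)) + ((x′ + y′) + (z′ + w′)) ≈
      (x + x′) + ((y + z′) + ((z + y′) + (w + w′)))
    pair-up = solve 8 (λ x y z w x′ y′ z′ w′ →
      ((x ⊕ y) ⊕ (z ⊕ w)) ⊕ ((x′ ⊕ y′) ⊕ (z′ ⊕ w′)) ⊜
      (x ⊕ x′) ⊕ ((y ⊕ z′) ⊕ ((z ⊕ y′) ⊕ (w ⊕ w′)))) refl

    ν-sum : ∀ {x y} → x + y ≈ 0# → ν x + ν y ≈ 0#
    ν-sum e = trans (sym (ν-+ _ _)) (ν-zero e)

    couple-sum : ∀ {k} c (s : Vec ℤ k) {φ η : ℤ → Vec ℤ k → A} → (∀ c s → φ c s + η c s ≈ 0#) →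
                 couple c s φ + couple c s η ≈ 0#
    couple-sum c s e = trans (sym (couple-+ c s _ _)) (couple-zero c s e)

  -- The factors of two adjacent rows against one `c` form a product symmetric in the rows, so they
  -- preserve the sign rule. Of the four terms per `c`, the exchange matches the two unmixed ones
  -- with themselves and the two mixed ones with each other.
  couple₂-anti : ∀ {n} a b (cs : Vec ℤ n) (ω : ℤ → ℤ → Vec ℤ n → A) →
    (∀ a b cs → ω a b cs + ω (down b) (up a) cs ≈ 0#) →
    couple a cs (λ a′ cs′ → couple b cs′ (λ b′ → ω a′ b′)) +
    couple (down b) cs (λ a′ cs′ → couple (up a) cs′ (λ b′ → ω a′ b′)) ≈ 0#
  couple₂-anti a b [] ω anti = anti a b []
  couple₂-anti a b (c ∷ cs) ω anti = begin
    couple₂ a b (c ∷ cs) ω + couple₂ (down b) (up a) (c ∷ cs) ω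
      ≈⟨ +-cong (expand a b) (expand (down b) (up a)) ⟩
    (X a b + ν (Y a (up b)) + (ν (Y (up a) b) + ν (ν (Z (up a) (up b))))) +
    (X (down b) (up a) + ν (Y (down b) (up (up a))) +
      (ν (Y (up (down b)) (up a)) + ν (ν (Z (up (down b)) (up (up a))))))
      ≈⟨ pair-up _ _ _ _ _ _ _ _ ⟩
    (X a b + X (down b) (up a)) +
    ((ν (Y a (up b)) + ν (Y (up (down b)) (up a))) +
    ((ν (Y (up a) b) + ν (Y (down b) (up (up a)))) +
     (ν (ν (Z (up a) (up b))) + ν (ν (Z (up (down b)) (up (up a)))))))
      ≈⟨ 0+0 (couple₂-anti a b cs (ω′ c) (λ a b cs → anti a b (c ∷ cs))) (0+0 second (0+0 third fourth)) ⟩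
    0#  ∎
    where
    couple₂ : ∀ {n} → ℤ → ℤ → Vec ℤ n → (ℤ → ℤ → Vec ℤ n → A) → A
    couple₂ a b cs ω = couple a cs (λ a′ cs′ → couple b cs′ (λ b′ → ω a′ b′))
    ω′ : ℤ → ℤ → ℤ → Vec ℤ _ → A
    ω′ c a b cs = ω a b (c ∷ cs)

    X Y Z : ℤ → ℤ → A
    X a b = couple₂ a b cs (ω′ c)
    Y a b = couple₂ a b cs (ω′ (down c))
    Z a b = couple₂ a b cs (ω′ (down (down c)))

    expand : ∀ a b → couple₂ a b (c ∷ cs) ω ≈
                     X a b + ν (Y a (up b)) + (ν (Y (up a) b) + ν (ν (Z (up a) (up b))))
    expand a b = +-cong
      (trans (couple-+ a cs _ _) (+-cong refl (couple-ν a cs _)))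
      (trans (ν-cong (trans (couple-+ (up a) cs _ _) (+-cong refl (couple-ν (up a) cs _))))
             (ν-+ _ _))

    up∘down : up (down b) ≡ down (up b)
    up∘down = ≡.trans (up-down b) (≡.sym (down-up b))

    second : ν (Y a (up b)) + ν (Y (up (down b)) (up a)) ≈ 0#
    second = ν-sum (trans
      (+-cong refl (reflexive (≡.cong (λ x → Y x (up a)) up∘down)))
      (couple₂-anti a (up b) cs (ω′ (down c)) (λ a b cs → anti a b (down c ∷ cs))))

    third : ν (Y (up a) b) + ν (Y (down b) (up (up a))) ≈ 0#
    third = ν-sum (couple₂-anti (up a) b cs (ω′ (down c)) (λ a b cs → anti a b (down c ∷ cs)))

    fourth : ν (ν (Z (up a) (up b))) + ν (ν (Z (up (down b)) (up (up a)))) ≈ 0#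
    fourth = ν-sum (ν-sum (trans
      (+-cong refl (reflexive (≡.cong (λ x → Z x (up (up a))) up∘down)))
      (couple₂-anti (up a) (up b) cs (ω′ (down (down c))) (λ a b cs → anti a b (down (down c) ∷ cs)))))

  -- The factors of one row against two adjacent columns are symmetric in the columns; the four
  -- terms pair up as in `couple₂-anti`.
  couple-anti : ∀ {n} c (χ : ℤ → Vec ℤ n → A) → (∀ c → Antisymmetric (χ c)) →
                Antisymmetric (λ z → couple c z χ)
  couple-anti {zero} c χ anti = tt
  couple-anti {suc zero} c χ anti = tt
  couple-anti {suc (suc n)} c χ anti = head-swap , λ x → anti-+
      (couple-anti {suc n} c (λ c z → χ c (x ∷ z)) (λ c → proj₂ (anti c) x))
      (anti-linear ν-linear
        (couple-anti {suc n} (up c) (λ c z → χ c (down x ∷ z)) (λ c → proj₂ (anti c) (down x))))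
    where
    swap : ∀ a b b′ a′ → b′ ≡ down b → a′ ≡ up a → ∀ c s → χ c (a ∷ b ∷ s) + χ c (b′ ∷ a′ ∷ s) ≈ 0#
    swap a b _ _ ≡.refl ≡.refl c s = proj₁ (anti c) a b s

    head-swap : ∀ a b s → couple c (a ∷ b ∷ s) χ + couple c (down b ∷ up a ∷ s) χ ≈ 0#
    head-swap a b s = begin
      ((P c a b + ν (P (up c) a (down b))) + ν (P (up c) (down a) b + ν (P (up (up c)) (down a) (down b)))) +
      ((P c (down b) (up a) + ν (P (up c) (down b) (down (up a)))) +
        ν (P (up c) (down (down b)) (up a) + ν (P (up (up c)) (down (down b)) (down (up a)))))
        ≈⟨ +-cong (+-cong refl (ν-+ _ _)) (+-cong refl (ν-+ _ _)) ⟩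
      ((P c a b + ν (P (up c) a (down b))) + (ν (P (up c) (down a) b) + ν (ν (P (up (up c)) (down a) (down b))))) +
      ((P c (down b) (up a) + ν (P (up c) (down b) (down (up a)))) +
        (ν (P (up c) (down (down b)) (up a)) + ν (ν (P (up (up c)) (down (down b)) (down (up a))))))
        ≈⟨ pair-up _ _ _ _ _ _ _ _ ⟩
      _  ≈⟨ 0+0 (couple-sum c s (swap a b _ _ ≡.refl ≡.refl))
          (0+0 (ν-sum (couple-sum (up c) s (swap a (down b) _ _ ≡.refl ≡.refl)))
          (0+0 (ν-sum (couple-sum (up c) s (swap (down a) b _ _ ≡.refl (≡.trans (down-up a) (≡.sym (up-down a))))))
               (ν-sum (ν-sum (couple-sum (up (up c)) s
                 (swap (down a) (down b) _ _ ≡.refl (≡.trans (down-up a) (≡.sym (up-down a))))))))) ⟩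
      0#  ∎
      where
      P : ℤ → ℤ → ℤ → A
      P c a b = couple c s (λ c′ s′ → χ c′ (a ∷ b ∷ s′))

  coupleAll-anti-columns : ∀ {m n} (as : Vec ℤ m) (Φ : Vec ℤ m → Vec ℤ n → A) →
    (∀ as → Antisymmetric (Φ as)) → Antisymmetric (λ bs → coupleAll as bs Φ)
  coupleAll-anti-columns [] Φ anti = anti []
  coupleAll-anti-columns (a ∷ as) Φ anti = couple-anti a _ (λ a′ →
    coupleAll-anti-columns as (λ as′ → Φ (a′ ∷ as′)) (λ as′ → anti (a′ ∷ as′)))

  anti-couple : ∀ {m n} a (bs : Vec ℤ n) (χ : ℤ → Vec ℤ n → Vec ℤ m → A) →
    (∀ a bs → Antisymmetric (χ a bs)) → Antisymmetric (λ z → couple a bs (λ a bs → χ a bs z))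
  anti-couple a [] χ anti = anti a []
  anti-couple a (b ∷ bs) χ anti = anti-+ (anti-couple a bs _ (λ _ _ → anti _ _))
    (anti-linear ν-linear (anti-couple (up a) bs _ (λ _ _ → anti _ _)))

  coupleAll-anti-rows : ∀ {m n} (bs : Vec ℤ n) (Φ : Vec ℤ m → Vec ℤ n → A) →
    (∀ bs → Antisymmetric (λ as → Φ as bs)) → Antisymmetric (λ as → coupleAll as bs Φ)
  coupleAll-anti-rows {zero} bs Φ anti = tt
  coupleAll-anti-rows {suc zero} bs Φ anti = tt
  coupleAll-anti-rows {suc (suc m)} bs Φ anti =
    (λ a b s → couple₂-anti a b bs
      (λ a b bs → coupleAll s bs (λ s → Φ (a ∷ b ∷ s)))
      (λ a b bs → trans (sym (coupleAll-+ s bs _ _)) (trans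
        (coupleAll-cong s bs {χ = λ _ _ → 0#} (λ s bs → proj₁ (anti bs) a b s)) (coupleAll-0 s bs)))) ,
    (λ x → anti-couple x bs (λ x bs as → coupleAll as bs (λ as → Φ (x ∷ as)))
      (λ x bs → coupleAll-anti-rows {suc m} bs (λ as → Φ (x ∷ as)) (λ bs → proj₂ (anti bs) x)))
    where
    coupleAll-0 : ∀ {m n} (as : Vec ℤ m) (bs : Vec ℤ n) → coupleAll as bs (λ _ _ → 0#) ≈ 0#
    coupleAll-0 [] bs = refl
    coupleAll-0 (a ∷ as) bs = couple-zero a bs (λ _ bs → coupleAll-0 as bs)

  -- The form in which the two-operator relation of B is available: not `φ` itself but (1 + ν e)
  -- `φ`, for the adjacent pair, changes sign under the exchange.
  Exchange : ∀ {n} → (Vec ℤ n → A) → Set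
  Exchange {zero} φ = ⊤
  Exchange {suc zero} φ = ⊤
  Exchange {suc (suc n)} φ =
    (∀ a b s → (φ (a ∷ b ∷ s) + ν (φ (up a ∷ down b ∷ s))) +
               (φ (down b ∷ up a ∷ s) + ν (φ (b ∷ a ∷ s))) ≈ 0#) ×
    (∀ x → Exchange (λ v → φ (x ∷ v)))

  -- The factor of the adjacent pair turns `Exchange` into a sign change; all other factors that
  -- involve the two rows are symmetric in them.
  block-anti : ∀ {n} (φ : Vec ℤ n → A) → Exchange φ → Antisymmetric (λ v → block v φ)
  block-anti {zero} φ ex = tt
  block-anti {suc zero} φ ex = tt
  block-anti {suc (suc n)} φ ex =
    (λ a b s → trans (+-cong (expand a b s) (expand (down b) (up a) s))
      (couple₂-anti a b s (λ a b s → ω a b s + ν (ω (up a) (down b) s)) ω-anti)) ,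
    (λ x → couple-anti x (λ x z → block z (λ z → φ (x ∷ z)))
      (λ x → block-anti {suc n} (λ z → φ (x ∷ z)) (proj₂ ex x)))
    where
    ω : ℤ → ℤ → Vec ℤ n → A
    ω a b s = block s (λ s → φ (a ∷ b ∷ s))

    expand : ∀ a b s → block (a ∷ b ∷ s) φ ≈
      couple a s (λ a s → couple b s (λ b s → ω a b s + ν (ω (up a) (down b) s)))
    expand a b s = begin
      couple a s (λ a s → couple b s (ω a)) + ν (couple (up a) s (λ a s → couple (down b) s (ω a)))
        ≈⟨ +-cong refl (ν-cong (trans (couple-up a s _)
             (couple-cong a s (λ a s → couple-down b s (ω (up a)))))) ⟩
      couple a s (λ a s → couple b s (ω a)) +
      ν (couple a s (λ a s → couple b s (λ b → ω (up a) (down b))))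
        ≈⟨ +-cong refl (trans (couple-linear ν-linear a s _)
             (couple-cong a s (λ a s → couple-linear ν-linear b s (λ b → ω (up a) (down b))))) ⟩
      couple a s (λ a s → couple b s (ω a)) +
      couple a s (λ a s → couple b s (λ b s → ν (ω (up a) (down b) s)))
        ≈⟨ trans (couple-cong a s (λ a s → couple-+ b s (ω a) (λ b s → ν (ω (up a) (down b) s))))
             (couple-+ a s _ _) ⟨
      couple a s (λ a s → couple b s (λ b s → ω a b s + ν (ω (up a) (down b) s)))  ∎

    block-0 : ∀ {k} (s : Vec ℤ k) → block s (λ _ → 0#) ≈ 0#
    block-0 [] = refl
    block-0 (a ∷ s) = couple-zero a s (λ _ s → block-0 s)

    ω-anti : ∀ a b s → (ω a b s + ν (ω (up a) (down b) s)) +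
             (ω (down b) (up a) s + ν (ω (up (down b)) (down (up a)) s)) ≈ 0#
    ω-anti a b s = begin
      (ω a b s + ν (ω (up a) (down b) s)) + (ω (down b) (up a) s + ν (ω (up (down b)) (down (up a)) s))
        ≈⟨ +-cong refl (+-cong refl (ν-cong (reflexive
             (≡.cong₂ (λ x y → ω x y s) (up-down b) (down-up a))))) ⟩
      (ω a b s + ν (ω (up a) (down b) s)) + (ω (down b) (up a) s + ν (ω b a s))
        ≈⟨ +-cong (collect _ _) (collect _ _) ⟩
      block s (λ s → φ (a ∷ b ∷ s) + ν (φ (up a ∷ down b ∷ s))) +
      block s (λ s → φ (down b ∷ up a ∷ s) + ν (φ (b ∷ a ∷ s)))
        ≈⟨ block-+ s _ _ ⟨
      block s (λ s → (φ (a ∷ b ∷ s) + ν (φ (up a ∷ down b ∷ s))) +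
                     (φ (down b ∷ up a ∷ s) + ν (φ (b ∷ a ∷ s))))
        ≈⟨ block-cong s (proj₁ ex a b) ⟩
      block s (λ _ → 0#)  ≈⟨ block-0 s ⟩
      0#  ∎
      where
      collect : ∀ (χ η : Vec ℤ n → A) → block s χ + ν (block s η) ≈ block s (λ s → χ s + ν (η s))
      collect χ η = trans (+-cong refl (block-linear ν-linear s η)) (sym (block-+ s χ (λ s → ν (η s))))

  -- Collisions, the dual Cauchy expansion and straightening

  module Straightening (halve : ∀ {x} → x + x ≈ 0# → x ≈ 0#) where

    -- The two exponents agree and the exchange fixes the vector, so the value is its own negative.
    swap-equal : ∀ {n} (ψ : Vec ℤ (suc (suc n)) → A) → Antisymmetric ψ → ∀ a s → ψ (a ∷ up a ∷ s) ≈ 0#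
    swap-equal ψ anti a s = halve (trans
      (+-cong refl (reflexive (≡.cong (λ x → ψ (x ∷ up a ∷ s)) (≡.sym (down-up a)))))
      (proj₁ anti a (up a) s))

    swap-zero : ∀ {n} (ψ : Vec ℤ (suc (suc n)) → A) → Antisymmetric ψ → ∀ {a b s} →
                ψ (down b ∷ up a ∷ s) ≈ 0# → ψ (a ∷ b ∷ s) ≈ 0#
    swap-zero ψ anti e = trans (sym (trans (+-cong refl e) (identityʳ _))) (proj₁ anti _ _ _)

    -- Behind an unraised `a`, raising the next entry produces `a` , `up a`, a collision. So in a
    -- constant column everything after an unraised entry stays unraised.
    column-replicate : ∀ n (θ : Vec ℤ (suc n) → ℤ → A) → (∀ b → Antisymmetric (λ as → θ as b)) → ∀ a b →
      coupleColumn (replicate n a) b (λ as → θ (a ∷ as)) ≈ θ (replicate (suc n) a) b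
    column-replicate zero θ anti a b = refl
    column-replicate (suc n) θ anti a b = trans
      (+-cong (column-replicate n (λ as → θ (a ∷ as)) (λ b → tail-anti (λ as → θ as b) (anti b) a) a b)
        (ν-zero (coupleColumn-zero (replicate n a) (down b) (λ as b → swap-equal (λ as → θ as b) (anti b) a as))))
      (identityʳ _)

    ν^ : ℕ → A → A
    ν^ zero x = x
    ν^ (suc d) x = ν (ν^ d x)

    -- Behind a lowered entry `down m`, an untouched `m` collides with it. So all the following
    -- entries are lowered as well, each contributing one `ν` and one raising of `a`.
    row-replicate : ∀ d (χ : ℤ → Vec ℤ (suc d) → A) → (∀ a → Antisymmetric (χ a)) → ∀ a m →
      couple a (replicate d m) (λ a bs → χ a (down m ∷ bs)) ≈
      ν^ d (χ (up^ d a) (replicate (suc d) (down m)))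
    row-replicate zero χ anti a m = refl
    row-replicate (suc d) χ anti a m = trans
      (+-cong
        (couple-zero a (replicate d m) (λ a bs → trans
          (reflexive (≡.cong (λ y → χ a (down m ∷ y ∷ bs)) (≡.sym (up-down m))))
          (swap-equal (χ a) (anti a) (down m) bs)))
        (ν-cong (row-replicate d (λ a z → χ a (down m ∷ z)) (λ a → tail-anti (χ a) (anti a) (down m)) (up a) m)))
      (identityˡ _)

    -- The recursion behind the dual Cauchy expansion Σ_λ ν^|λ| s_λ s_λ′ of the coupling of two
    -- constant vectors: the largest exponent present goes to the right block or to the left one.
    coupleAll-replicate : ∀ n d ℓ m (Φ : Vec ℤ (suc n) → Vec ℤ (suc d) → A) →
      (∀ bs → Antisymmetric (λ as → Φ as bs)) → (∀ as → Antisymmetric (Φ as)) →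
      coupleAll (replicate (suc n) ℓ) (replicate (suc d) m) Φ ≈
      coupleAll (replicate (suc n) ℓ) (replicate d m) (λ as bs → Φ as (m ∷ bs)) +
      ν^ (suc d) (coupleAll (replicate n ℓ) (replicate (suc d) (down m))
                            (λ as → Φ (up^ (suc d) ℓ ∷ as)))
    coupleAll-replicate n d ℓ m Φ rows columns = begin
      coupleAll (replicate (suc n) ℓ) (replicate (suc d) m) Φ
        ≈⟨ coupleAll-∷ (replicate (suc n) ℓ) m (replicate d m) Φ ⟩
      coupleColumn (replicate n ℓ) m (λ as → ψ (ℓ ∷ as)) +
      ν (coupleColumn (replicate n ℓ) (down m) (λ as → ψ (up ℓ ∷ as)))
        ≈⟨ +-cong
             (column-replicate n ψ (λ b → coupleAll-anti-rows (replicate d m) (λ as bs → Φ as (b ∷ bs))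
               (λ bs → rows (b ∷ bs))) ℓ m)
             (ν-cong second) ⟩
      ψ (replicate (suc n) ℓ) m + ν (ν^ d (χ (up^ d (up ℓ)) (replicate (suc d) (down m))))  ∎
      where
      ψ : Vec ℤ (suc n) → ℤ → A
      ψ as b = coupleAll as (replicate d m) (λ as bs → Φ as (b ∷ bs))

      χ : ℤ → Vec ℤ (suc d) → A
      χ a z = coupleAll (replicate n ℓ) z (λ as → Φ (a ∷ as))

      H : ℤ → Vec ℤ d → Vec ℤ n → ℤ → A
      H a bs as b = coupleAll as bs (λ as bs → Φ (a ∷ as) (b ∷ bs))

      second : coupleColumn (replicate n ℓ) (down m) (λ as → ψ (up ℓ ∷ as)) ≈
               ν^ d (χ (up^ d (up ℓ)) (replicate (suc d) (down m)))
      second = begin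
        coupleColumn (replicate n ℓ) (down m) (λ as b → couple (up ℓ) (replicate d m) (λ a bs → H a bs as b))
          ≈⟨ couple-coupleColumn (up ℓ) (replicate d m) (replicate n ℓ) (down m) H ⟨
        couple (up ℓ) (replicate d m) (λ a bs → coupleColumn (replicate n ℓ) (down m) (H a bs))
          ≈⟨ couple-cong (up ℓ) (replicate d m) (λ a bs →
               coupleAll-∷ (replicate n ℓ) (down m) bs (λ as → Φ (a ∷ as))) ⟨
        couple (up ℓ) (replicate d m) (λ a bs → χ a (down m ∷ bs))
          ≈⟨ row-replicate d χ (λ a →
               coupleAll-anti-columns (replicate n ℓ) (λ as → Φ (a ∷ as)) (λ as → columns (a ∷ as)))
               (up ℓ) m ⟩
        ν^ d (χ (up^ d (up ℓ)) (replicate (suc d) (down m)))  ∎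

    -- Each exchange moves `a` one place to the right and raises it by one. After d + p of them it
    -- stands directly before `b`, which then exceeds it by one.
    collide-at : ∀ {d p x} (ψ : Vec ℤ (suc (d ℕ.+ x)) → A) → Antisymmetric ψ →
                 ∀ a (bs : Vec ℤ d) {b} {X : Vec ℤ x} → At b p X → b ≡ up^ (suc (d ℕ.+ p)) a →
                 ψ (a ∷ bs ++ᵛ X) ≈ 0#
    collide-at ψ anti a [] here ≡.refl = swap-equal ψ anti a _
    collide-at ψ anti a [] (there {x = x} at) e = swap-zero ψ anti
      (collide-at {0} (λ z → ψ (down x ∷ z)) (tail-anti ψ anti (down x)) (up a) [] at e)
    collide-at ψ anti a (b ∷ bs) at e = swap-zero ψ anti
      (collide-at (λ z → ψ (down b ∷ z)) (tail-anti ψ anti (down b)) (up a) bs at e)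

    -- The spans of k-split polynomials enter the combinatorics only through these closure
    -- properties.
    record Closed (S : A → Set) : Set where
      field
        resp : ∀ {x y} → x ≈ y → S x → S y
        zero-closed : S 0#
        sum-closed : ∀ {x y} → S x → S y → S (x + y)
        ν-closed : ∀ {x} → S x → S (ν x)
        neg-closed : ∀ {x} → S x → S (- x)

      null : ∀ {x} → x ≈ 0# → S x
      null e = resp (sym e) zero-closed

      ν^-closed : ∀ d {x} → S x → S (ν^ d x)
      ν^-closed zero s = s
      ν^-closed (suc d) s = ν-closed (ν^-closed d s)

    -- In terms of the exponents v_i + (n − i): all of them are at least lo, and at most hi + n − 1.
    Within : ∀ {n} → ℤ → ℤ → Vec ℤ n → Set
    Within lo hi [] = ⊤
    Within {suc n} lo hi (x ∷ xs) = (lo ℤ.≤ up^ n x) × (x ℤ.≤ hi) × Within lo (up hi) xs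

    -- Some entry carries the largest exponent that `Within` permits. Sorting brings it to the
    -- front, where it becomes a first part equal to `hi`.
    Attains : ∀ {n} → ℤ → Vec ℤ n → Set
    Attains hi [] = ⊥
    Attains hi (x ∷ xs) = x ≡ hi ⊎ Attains (up hi) xs

    HeadIs : ∀ {n} → ℤ → Vec ℤ n → Set
    HeadIs hi [] = ⊥
    HeadIs hi (x ∷ xs) = x ≡ hi

    module _ {S : A → Set} (closed : Closed S) where
      open Closed closed

      couple-closed : ∀ {n} a (bs : Vec ℤ n) {φ : ℤ → Vec ℤ n → A} → (∀ a bs → S (φ a bs)) → S (couple a bs φ)
      couple-closed a [] k = k a []
      couple-closed a (b ∷ bs) k = sum-closed (couple-closed a bs (λ _ _ → k _ _))
        (ν-closed (couple-closed (up a) bs (λ _ _ → k _ _)))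

      coupleAll-closed : ∀ {m n} (as : Vec ℤ m) (bs : Vec ℤ n) {φ : Vec ℤ m → Vec ℤ n → A} →
                         (∀ as bs → S (φ as bs)) → S (coupleAll as bs φ)
      coupleAll-closed [] bs k = k [] bs
      coupleAll-closed (a ∷ as) bs k =
        couple-closed a bs (λ _ bs → coupleAll-closed as bs (λ _ _ → k _ _))

      coupleAll-[] : ∀ {m} (as : Vec ℤ m) (φ : Vec ℤ m → Vec ℤ 0 → A) → S (φ as []) → S (coupleAll as [] φ)
      coupleAll-[] [] φ k = k
      coupleAll-[] (a ∷ as) φ k = coupleAll-[] as (λ as → φ (a ∷ as)) k

      -- X is the part of the right block that is not coupled; us lists its entries from position p on.
      -- An exponent that occurs among them cannot go to the right block, so it goes to the left one.
      laplace : ∀ n d ℓ m p low {x} (X : Vec ℤ x) (us : Vec ℤ n) (Ψ : Vec ℤ n → Vec ℤ (d ℕ.+ x) → A) →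
        (∀ z → Antisymmetric (λ as → Ψ as z)) → (∀ as → Antisymmetric (Ψ as)) →
        up^ p m ≡ ℓ → up^ n low ℤ.≤ m → Placed p us X → Descending us → VAll.All (ℤ._≤ up^ d ℓ) us →
        (∀ α β → Pointwise ℤ._≤_ us α → VAll.All (ℓ ℤ.≤_) α → VAll.All (ℤ._≤ up^ d ℓ) α → Descending α →
                 VAll.All (low ℤ.≤_) β → VAll.All (ℤ._≤ m) β → S (Ψ α (β ++ᵛ X))) →
        S (coupleAll (replicate n ℓ) (replicate d m) (λ as bs → Ψ as (bs ++ᵛ X)))
      laplace zero d ℓ m p low X [] Ψ rows columns e l placed desc bound k =
        k [] (replicate d m) [] [] [] tt (all-replicate d l) (all-replicate d ℤₚ.≤-refl)
      laplace (suc n) zero ℓ m p low X us Ψ rows columns e l placed desc bound k =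
        coupleAll-[] (replicate (suc n) ℓ) (λ as bs → Ψ as (bs ++ᵛ X)) (k _ [] (below us bound)
          (all-replicate (suc n) ℤₚ.≤-refl) (all-replicate (suc n) ℤₚ.≤-refl)
          (descending-replicate (suc n) ℓ) [] [])
        where
        below : ∀ {n} (us : Vec ℤ n) → VAll.All (ℤ._≤ ℓ) us → Pointwise ℤ._≤_ us (replicate n ℓ)
        below [] [] = []
        below (u ∷ us) (b ∷ bs) = b ∷ below us bs
      laplace (suc n) (suc d) ℓ m p low X (u ∷ us) Ψ rows columns e l (at , placed) (u≥us , desc) (b ∷ bs) k =
        resp (sym (coupleAll-replicate n d ℓ m (λ as bs → Ψ as (bs ++ᵛ X))
               (λ bs → rows (bs ++ᵛ X)) (λ as → anti-++ (columns as))))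
             (sum-closed first (ν^-closed (suc d) second))
        where
        anti-++ : ∀ {k x} {X : Vec ℤ x} {ψ : Vec ℤ (k ℕ.+ x) → A} →
                  Antisymmetric ψ → Antisymmetric (λ bs → ψ (bs ++ᵛ X))
        anti-++ {zero} anti = tt
        anti-++ {suc zero} anti = tt
        anti-++ {suc (suc k)} anti =
          (λ a b s → proj₁ anti a b (s ++ᵛ _)) , (λ x → anti-++ {suc k} (proj₂ anti x))

        low≤m : low ℤ.≤ m
        low≤m = ℤₚ.≤-trans (x≤up^ (suc n) low) l

        first : S (coupleAll (replicate (suc n) ℓ) (replicate d m) (λ as bs → Ψ as (m ∷ bs ++ᵛ X)))
        -- Since m + p = ℓ, this asks whether u = m + (d + p) + 1, which is the condition for the
        -- new entry `m` to collide with the entry `u` at position p of `X`, behind d further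
        -- entries.
        first with u ℤₚ.≟ up^ (suc d) ℓ
        ... | yes eq = coupleAll-closed (replicate (suc n) ℓ) (replicate d m) (λ as bs →
                null (collide-at (Ψ as) (columns as) m bs at (≡.trans eq (≡.trans
                  (≡.cong (up^ (suc d)) (≡.sym e)) (≡.sym (up^-+ (suc d) p m))))))
        ... | no neq = laplace (suc n) d ℓ m p low X (u ∷ us) (λ as z → Ψ as (m ∷ z))
                (λ z → rows (m ∷ z)) (λ as → tail-anti (Ψ as) (columns as) m) e l (at , placed) (u≥us , desc)
                (u≤ ∷ VAll.map (λ v≤u → ℤₚ.≤-trans v≤u u≤) u≥us)
                (λ α β u≤α ℓ≤α α≤ desc-α low≤β β≤m → k α (m ∷ β) u≤α ℓ≤α
                  (VAll.map (λ a≤ → ℤₚ.≤-trans a≤ step) α≤) desc-α (low≤m ∷ low≤β) (ℤₚ.≤-refl ∷ β≤m))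
          where
          step : up^ d ℓ ℤ.≤ up^ (suc d) ℓ
          step = ℤₚ.≤-trans (x≤up _) (ℤₚ.≤-reflexive (≡.sym (up^-up d ℓ)))
          u≤ : u ℤ.≤ up^ d ℓ
          u≤ = <up⇒≤ (≡.subst (u ℤ.<_) (up^-up d ℓ) (ℤₚ.≤∧≢⇒< b neq))

        second : S (coupleAll (replicate n ℓ) (replicate (suc d) (down m))
                              (λ as bs → Ψ (up^ (suc d) ℓ ∷ as) (bs ++ᵛ X)))
        second = laplace n (suc d) ℓ (down m) (suc p) low X us (λ as z → Ψ (up^ (suc d) ℓ ∷ as) z)
          (λ z → tail-anti (λ as → Ψ as z) (rows z) (up^ (suc d) ℓ)) (λ as → columns (up^ (suc d) ℓ ∷ as))
          (≡.trans (≡.cong (up^ p) (up-down m)) e)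
          (ℤₚ.≤-trans (ℤₚ.≤-reflexive (≡.sym (down-up _)))
            (down-mono (ℤₚ.≤-trans (ℤₚ.≤-reflexive (≡.sym (up^-up n low))) l)))
          placed desc bs
          (λ α β u≤α ℓ≤α α≤ desc-α low≤β β≤m → k (up^ (suc d) ℓ ∷ α) β (b ∷ u≤α)
            (x≤up^ (suc d) ℓ ∷ ℓ≤α) (ℤₚ.≤-refl ∷ α≤) (α≤ , desc-α) low≤β
            (VAll.map (λ q → ℤₚ.≤-trans q (down≤x m)) β≤m))

      -- One insertion of a sort by exponents: `x` stays in front if y ≤ x, the value vanishes if y
      -- = x + 1, and otherwise the two are exchanged with a sign. The bound on `γ` is `up hi`
      -- because its entries sit one place later and are lowered when they move forward.
      insert-closed : ∀ {n} lo hi x (γ : Vec ℤ n) (ψ : Vec ℤ (suc n) → A) → Antisymmetric ψ →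
        lo ℤ.≤ up^ n x → x ℤ.≤ hi → VAll.All (lo ℤ.≤_) γ → VAll.All (ℤ._≤ up hi) γ → Descending γ →
        (∀ γ′ → VAll.All (lo ℤ.≤_) γ′ → VAll.All (ℤ._≤ hi) γ′ → Descending γ′ →
                (x ≡ hi ⊎ HeadIs (up hi) γ → HeadIs hi γ′) → S (ψ γ′)) →
        S (ψ (x ∷ γ))
      insert-closed lo hi x [] ψ anti lo≤ ≤hi [] [] desc k =
        k (x ∷ []) (lo≤ ∷ []) (≤hi ∷ []) ([] , tt) λ { (inj₁ e) → e ; (inj₂ ()) }
      insert-closed {suc n} lo hi x (y ∷ γ) ψ anti lo≤ ≤hi (lo≤y ∷ lo≤γ) (y≤ ∷ γ≤) (y≥γ , desc) k
        with ℤₚ.<-cmp y (up x)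
      ... | tri≈ _ ≡.refl _ = null (swap-equal ψ anti x γ)
      ... | tri< y<up _ _ = k (x ∷ y ∷ γ)
              (ℤₚ.≤-trans lo≤y y≤x ∷ lo≤y ∷ lo≤γ)
              (≤hi ∷ ℤₚ.≤-trans y≤x ≤hi ∷ VAll.map (λ z≤y → ℤₚ.≤-trans z≤y (ℤₚ.≤-trans y≤x ≤hi)) y≥γ)
              ((y≤x ∷ VAll.map (λ z≤y → ℤₚ.≤-trans z≤y y≤x) y≥γ) , y≥γ , desc)
              λ { (inj₁ e) → e
                ; (inj₂ ≡.refl) → contradiction y<up (ℤₚ.≤⇒≯ (up-mono ≤hi)) }
        where
        y≤x : y ℤ.≤ x
        y≤x = <up⇒≤ y<up
      ... | tri> _ _ up<y = resp (sym (inverseˡ-unique _ _ (proj₁ anti x y γ))) (neg-closed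
              (insert-closed lo (down y) (up x) γ (λ z → ψ (down y ∷ z)) (proj₂ anti (down y)) lo≤
                (<⇒≤down up<y) lo≤γ
                (VAll.map (λ z≤y → ℤₚ.≤-trans z≤y (ℤₚ.≤-reflexive (≡.sym (up-down y)))) y≥γ) desc
                (λ { (z ∷ γ′) (lo≤z ∷ lo≤γ′) (z≤ ∷ γ′≤) desc′ head → k (down y ∷ z ∷ γ′)
                       (ℤₚ.≤-trans lo≤z z≤ ∷ lo≤z ∷ lo≤γ′)
                       (down-y≤hi ∷ ℤₚ.≤-trans z≤ down-y≤hi ∷ VAll.map (λ q → ℤₚ.≤-trans q down-y≤hi) γ′≤)
                       ((z≤ ∷ γ′≤) , desc′)
                       λ { (inj₁ ≡.refl) → contradiction up<y (ℤₚ.≤⇒≯ y≤)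
                         ; (inj₂ ≡.refl) → down-up hi } })))
        where
        down-y≤hi : down y ℤ.≤ hi
        down-y≤hi = ℤₚ.≤-trans (down-mono y≤) (ℤₚ.≤-reflexive (down-up hi))

      -- Insertion sort from the right end; bounds on exponents survive since sorting only permutes
      -- them.
      straighten : ∀ {n} lo hi (v : Vec ℤ n) (ψ : Vec ℤ n → A) → Antisymmetric ψ → Within lo hi v →
        (∀ γ → VAll.All (lo ℤ.≤_) γ → VAll.All (ℤ._≤ hi) γ → Descending γ →
               (Attains hi v → HeadIs hi γ) → S (ψ γ)) → S (ψ v)
      straighten lo hi [] ψ anti w k = k [] [] [] tt λ ()
      straighten lo hi (x ∷ xs) ψ anti (lo≤ , ≤hi , w) k =
        straighten lo (up hi) xs (λ z → ψ (x ∷ z)) (tail-anti ψ anti x) w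
          (λ γ lo≤γ γ≤ desc head → insert-closed lo hi x γ ψ anti lo≤ ≤hi lo≤γ γ≤ desc
            (λ γ′ lo≤γ′ γ′≤ desc′ head′ → k γ′ lo≤γ′ γ′≤ desc′
              λ { (inj₁ e) → head′ (inj₁ e) ; (inj₂ t) → head′ (inj₂ (head t)) }))

    -- Exchange of two blocks

    module Blocks (B : ℤ → A → A) (B-linear : ∀ n → Linear (B n))
      (exchange-relation : ∀ a b f → (B a (B b f) + ν (B (up a) (B (down b) f))) +
                                     (B (down b) (B (up a) f) + ν (B b (B a f))) ≈ 0#) where

      word : ∀ {n} → Vec ℤ n → A → A
      word [] f = f
      word (n ∷ v) f = B n (word v f)

      Block : ∀ {n} → Vec ℤ n → A → A
      Block v f = block v (λ w → word w f)

      word-linear : ∀ {n} (v : Vec ℤ n) → Linear (word v)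
      word-linear [] = record { cong = λ e → e ; add = λ _ _ → refl ; scale = λ _ → refl }
      word-linear (n ∷ v) = record
        { cong = λ e → cong (B-linear n) (cong (word-linear v) e)
        ; add = λ x y → trans (cong (B-linear n) (add (word-linear v) x y)) (add (B-linear n) _ _)
        ; scale = λ x → trans (cong (B-linear n) (scale (word-linear v) x)) (scale (B-linear n) _)
        }

      Block-linear : ∀ {n} (v : Vec ℤ n) → Linear (Block v)
      Block-linear v = record
        { cong = λ e → block-cong v (λ w → cong (word-linear w) e)
        ; add = λ x y → trans (block-cong v (λ w → add (word-linear w) x y)) (block-+ v _ _)
        ; scale = λ x → trans (block-cong v (λ w → scale (word-linear w) x))
                              (sym (block-linear ν-linear v (λ w → word w x)))
        }

      word-++ : ∀ {m n} (v : Vec ℤ m) (w : Vec ℤ n) f → word (v ++ᵛ w) f ≡ word v (word w f)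
      word-++ [] w f = ≡.refl
      word-++ (x ∷ v) w f = ≡.cong (B x) (word-++ v w f)

      exchange-linear : ∀ {L} → Linear L → ∀ {n} {φ : Vec ℤ n → A} → Exchange φ → Exchange (λ v → L (φ v))
      exchange-linear l {zero} ex = tt
      exchange-linear l {suc zero} ex = tt
      exchange-linear {L} l {suc (suc n)} {φ} ex =
        (λ a b s → trans (+-cong (collect _ _) (collect _ _))
          (trans (sym (add l _ _)) (trans (cong l (proj₁ ex a b s)) (linear-0 l)))) ,
        (λ x → exchange-linear l {suc n} (proj₂ ex x))
        where
        collect : ∀ x y → L x + ν (L y) ≈ L (x + ν y)
        collect x y = sym (trans (add l x (ν y)) (+-cong refl (scale l y)))

      word-exchange : ∀ {n} f → Exchange {n} (λ v → word v f)
      word-exchange {zero} f = tt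
      word-exchange {suc zero} f = tt
      word-exchange {suc (suc n)} f =
        (λ a b s → exchange-relation a b (word s f)) ,
        (λ x → exchange-linear (B-linear x) (word-exchange {suc n} f))

      Block-anti : ∀ {n} f → Antisymmetric {n} (λ v → Block v f)
      Block-anti f = block-anti (λ w → word w f) (word-exchange f)

      Block-++ : ∀ {m n} (v : Vec ℤ m) (w : Vec ℤ n) f →
                 Block (v ++ᵛ w) f ≈ coupleAll v w (λ v w → Block v (Block w f))
      Block-++ v w f = trans (block-++ v w (λ z → word z f))
        (coupleAll-cong v w (λ v w → block-cong v (λ v → trans
          (block-cong w (λ w → reflexive (word-++ v w f)))
          (sym (block-linear (word-linear v) w (λ w → word w f))))))

      -- Saturated ℓ n ψ : ψ behaves as if its argument were preceded by n entries ℓ, so that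
      -- r + 1 ≤ n raisings of an entry ℓ create a collision with one of them.
      Saturated : ∀ {d} → ℤ → ℕ → (Vec ℤ d → A) → Set
      Saturated {zero} ℓ n ψ = ⊤
      Saturated {suc d} ℓ n ψ =
        (∀ r → r ℕ.< n → ∀ s → ψ (up^ (suc r) ℓ ∷ s) ≈ 0#) × Saturated ℓ (suc n) (λ z → ψ (ℓ ∷ z))

      -- After a placed ℓ, an entry ℓ + 1 collides with it. An entry ℓ + r + 2 is exchanged with it
      -- and becomes ℓ + r + 1 in the earlier place, where the hypothesis applies; so the admissible
      -- number of raisings grows by one.
      saturate : ∀ {d} ℓ n (ψ : Vec ℤ (suc d) → A) → Antisymmetric ψ →
                 (∀ r → r ℕ.< n → ∀ s → ψ (up^ (suc r) ℓ ∷ s) ≈ 0#) → Saturated ℓ n ψ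
      saturate {zero} ℓ n ψ anti z = z , tt
      saturate {suc d} ℓ n ψ anti z = z , saturate ℓ (suc n) (λ z → ψ (ℓ ∷ z)) (tail-anti ψ anti ℓ) z′
        where
        z′ : ∀ r → r ℕ.< suc n → ∀ s → ψ (ℓ ∷ up^ (suc r) ℓ ∷ s) ≈ 0#
        z′ zero l s = swap-equal ψ anti ℓ s
        z′ (suc r) (s≤s l) s = swap-zero ψ anti (trans
          (reflexive (≡.cong (λ x → ψ (x ∷ up ℓ ∷ s))
            (≡.trans (≡.cong down (up^-up (suc r) ℓ)) (down-up _))))
          (z r l (up ℓ ∷ s)))

      drop-prefix : ∀ {d} ℓ n i {ψ : Vec ℤ (n ℕ.+ d) → A} → Saturated ℓ i ψ →
                    Saturated ℓ (n ℕ.+ i) (λ z → ψ (replicate n ℓ ++ᵛ z))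
      drop-prefix ℓ zero i sat = sat
      drop-prefix ℓ (suc n) i {ψ} sat = ≡.subst (λ k → Saturated ℓ k (λ z → ψ (ℓ ∷ replicate n ℓ ++ᵛ z)))
        (ℕₚ.+-suc n i) (drop-prefix ℓ n (suc i) (proj₂ sat))

      coupleAll-saturated : ∀ {k} n d ℓ (u : Vec ℤ k) (θ : Vec ℤ d → Vec ℤ k → A) → k ℕ.≤ n →
        (∀ u → Saturated ℓ n (λ z → θ z u)) → coupleAll (replicate d ℓ) u θ ≈ θ (replicate d ℓ) u
      coupleAll-saturated n zero ℓ u θ k≤n sat = refl
      coupleAll-saturated n (suc d) ℓ u θ k≤n sat = trans
        (couple-first u k≤n (λ a u → coupleAll (replicate d ℓ) u (λ bs → θ (a ∷ bs)))
          (λ r r<n u → coupleAll-zero (replicate d ℓ) u (λ bs u → proj₁ (sat u) r r<n bs)))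
        (coupleAll-saturated (suc n) d ℓ u (λ bs → θ (ℓ ∷ bs)) (ℕₚ.m≤n⇒m≤1+n k≤n) (λ u → proj₂ (sat u)))
        where
        coupleAll-zero : ∀ {m n} (as : Vec ℤ m) (bs : Vec ℤ n) {φ : Vec ℤ m → Vec ℤ n → A} →
                         (∀ as bs → φ as bs ≈ 0#) → coupleAll as bs φ ≈ 0#
        coupleAll-zero [] bs e = e [] bs
        coupleAll-zero (a ∷ as) bs e = couple-zero a bs (λ _ bs → coupleAll-zero as bs (λ _ _ → e _ _))

        -- So far j + 1 raisings have been made and at most k can follow, one per remaining entry of
        -- `u`; the total therefore lies between 1 and n.
        couple-range : ∀ {k} j (u : Vec ℤ k) {ξ : ℤ → Vec ℤ k → A} → j ℕ.+ k ℕ.< n →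
          (∀ r → r ℕ.< n → ∀ u → ξ (up^ (suc r) ℓ) u ≈ 0#) → couple (up^ (suc j) ℓ) u ξ ≈ 0#
        couple-range j [] l z = z j (ℕₚ.≤-<-trans (ℕₚ.m≤m+n j 0) l) []
        couple-range {suc k} j (b ∷ u) {ξ} l z = 0+0
          (couple-range j u (ℕₚ.≤-<-trans (ℕₚ.+-monoʳ-≤ j (ℕₚ.n≤1+n k)) l) (λ r r<n u → z r r<n (b ∷ u)))
          (ν-zero (trans
            (reflexive (≡.cong (λ a → couple a u (λ a u → ξ a (down b ∷ u))) (≡.sym (up^-up (suc j) ℓ))))
            (couple-range (suc j) u (≡.subst (ℕ._< n) (ℕₚ.+-suc j k) l) (λ r r<n u → z r r<n (down b ∷ u)))))

        couple-first : ∀ {k} (u : Vec ℤ k) → k ℕ.≤ n → (ξ : ℤ → Vec ℤ k → A) →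
          (∀ r → r ℕ.< n → ∀ u → ξ (up^ (suc r) ℓ) u ≈ 0#) → couple ℓ u ξ ≈ ξ ℓ u
        couple-first [] l ξ z = refl
        couple-first (b ∷ u) l ξ z = trans
          (+-cong (couple-first u (ℕₚ.<⇒≤ l) (λ a u → ξ a (b ∷ u)) (λ r r<n u → z r r<n (b ∷ u)))
            (ν-zero (couple-range 0 u l (λ r r<n u → z r r<n (down b ∷ u)))))
          (identityʳ _)

      -- The calculation starts from the coupled side: split `bs ++ᵛ u`, let the factors between
      -- `as` and `bs` act before those between `bs` and `u`, reassemble `L ++ᵛ bs` as one block,
      -- and remove the factors against `u` by saturation.
      Block-Block : ∀ n d ℓ (u : Vec ℤ n) f →
        Block (replicate n ℓ ++ᵛ replicate (suc d) ℓ) (Block u f) ≈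
        coupleAll (replicate n ℓ) (replicate (suc d) ℓ) (λ as bs → Block as (Block (bs ++ᵛ u) f))
      Block-Block n d ℓ u f = sym (begin
        coupleAll L R (λ as bs → Block as (Block (bs ++ᵛ u) f))
          ≈⟨ coupleAll-cong L R (λ as bs → trans (cong (Block-linear as) (Block-++ bs u f))
               (coupleAll-linear (Block-linear as) bs u (λ bs u → Block bs (Block u f)))) ⟩
        coupleAll L R (λ as bs → coupleAll bs u (λ bs u → Block as (Block bs (Block u f))))
          ≈⟨ coupleAll-comm L R u (λ as bs u → Block as (Block bs (Block u f))) ⟩
        coupleAll R u (λ bs u → coupleAll L bs (λ as bs → Block as (Block bs (Block u f))))
          ≈⟨ coupleAll-cong R u (λ bs u → Block-++ L bs (Block u f)) ⟨
        coupleAll R u (λ bs u → Block (L ++ᵛ bs) (Block u f))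
          ≈⟨ coupleAll-saturated (n ℕ.+ 0) (suc d) ℓ u (λ bs u → Block (L ++ᵛ bs) (Block u f))
               (ℕₚ.m≤m+n n 0)
               (λ u → drop-prefix ℓ n 0 (sat n (λ z → Block z (Block u f)) (Block-anti (Block u f)))) ⟩
        Block (L ++ᵛ R) (Block u f)  ∎)
        where
        L = replicate n ℓ
        R = replicate (suc d) ℓ
        sat : ∀ n (ψ : Vec ℤ (n ℕ.+ suc d) → A) → Antisymmetric ψ → Saturated ℓ 0 ψ
        sat zero ψ anti = saturate ℓ 0 ψ anti λ _ ()
        sat (suc n) ψ anti = saturate ℓ 0 ψ anti λ _ ()

      -- In the applications `lo` is the smaller of ℓ and the first part of whatever follows `u`, so
      -- that the new second index can still stand in front of it.
      exchange-blocks : ∀ {S} → Closed S → ∀ n d ℓ lo (u : Vec ℤ n) f →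
        Descending u → VAll.All (ℤ._≤ up^ (suc d) ℓ) u → HeadIs (up^ (suc d) ℓ) u →
        VAll.All (lo ℤ.≤_) u → lo ℤ.≤ ℓ →
        (∀ (α : Vec ℤ n) (γ : Vec ℤ (suc d ℕ.+ n)) →
          Pointwise ℤ._≤_ u α → VAll.All (ℓ ℤ.≤_) α → VAll.All (ℤ._≤ up^ (suc d) ℓ) α → Descending α →
          VAll.All (lo ℤ.≤_) γ → VAll.All (ℤ._≤ ℓ) γ → Descending γ → HeadIs ℓ γ → S (Block α (Block γ f))) →
        S (Block (replicate n ℓ ++ᵛ replicate (suc d) ℓ) (Block u f))
      exchange-blocks closed n d ℓ lo u f desc u≤ head lo≤u lo≤ℓ k =
        Closed.resp closed (sym (Block-Block n d ℓ u f))
          (laplace closed n (suc d) ℓ ℓ 0 low u u (λ as z → Block as (Block z f))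
            (λ z → Block-anti (Block z f)) (λ as → anti-linear (Block-linear as) (Block-anti f))
            ≡.refl (ℤₚ.≤-reflexive up^low≡ℓ) (placed-self u) desc u≤
            (λ α β u≤α ℓ≤α α≤ desc-α low≤β β≤ℓ →
              straighten closed lo ℓ (β ++ᵛ u) (λ z → Block α (Block z f))
                (anti-linear (Block-linear α) (Block-anti f))
                (within ℓ ℤₚ.≤-refl β low≤β β≤ℓ u≤)
                (λ γ lo≤γ γ≤ℓ desc-γ head-γ → k α γ u≤α ℓ≤α α≤ desc-α lo≤γ γ≤ℓ desc-γ
                  (head-γ (attains ℓ β u head)))))
        where
        low : ℤ
        -- An entry of the right block is lowered at most once by each of the n rows on the left.
        low = ℓ ℤ.- (+ n)

        up^low≡ℓ : up^ n low ≡ ℓ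
        up^low≡ℓ = ≡.trans (up^≡+ n low) (≡.trans (ℤₚ.+-assoc ℓ _ _)
          (≡.trans (≡.cong (λ z → ℓ ℤ.+ z) (ℤₚ.+-inverseˡ (+ n))) (ℤₚ.+-identityʳ ℓ)))

        up^-mono : ∀ d {x y} → x ℤ.≤ y → up^ d x ℤ.≤ up^ d y
        up^-mono zero l = l
        up^-mono (suc d) l = up^-mono d (up-mono l)

        within-u : ∀ {k} hi (v : Vec ℤ k) → VAll.All (lo ℤ.≤_) v → VAll.All (ℤ._≤ hi) v → Within lo hi v
        within-u hi [] [] [] = tt
        within-u {suc k} hi (x ∷ v) (p ∷ ps) (q ∷ qs) =
          ℤₚ.≤-trans p (x≤up^ k x) , q , within-u (up hi) v ps (VAll.map (λ r → ℤₚ.≤-trans r (x≤up hi)) qs)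

        within : ∀ {k} hi → ℓ ℤ.≤ hi → (β : Vec ℤ k) → VAll.All (low ℤ.≤_) β → VAll.All (ℤ._≤ ℓ) β →
                 VAll.All (ℤ._≤ up^ k hi) u → Within lo hi (β ++ᵛ u)
        within hi ℓ≤hi [] [] [] u≤hi = within-u hi u lo≤u u≤hi
        within {suc k} hi ℓ≤hi (b ∷ β) (p ∷ ps) (q ∷ qs) u≤hi =
          (lower p) , ℤₚ.≤-trans q ℓ≤hi , within (up hi) (ℤₚ.≤-trans ℓ≤hi (x≤up hi)) β ps qs u≤hi
          where
          -- The n entries of `u` that stand behind `b` make up in its exponent for the n possible
          -- lowerings.
          lower : ∀ {b} → low ℤ.≤ b → lo ℤ.≤ up^ (k ℕ.+ n) b
          lower {b} p = ℤₚ.≤-trans lo≤ℓ (ℤₚ.≤-trans (ℤₚ.≤-reflexive (≡.sym up^low≡ℓ))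
            (ℤₚ.≤-trans (up^-mono n p) (ℤₚ.≤-trans (x≤up^ k _) (ℤₚ.≤-reflexive (≡.sym (up^-+ k n b))))))

        -- The first entry of `u` exceeds ℓ by exactly the length of `β`, so its exponent is the top
        -- one and the straightened index begins with ℓ.
        attains : ∀ {k m} hi (β : Vec ℤ k) (v : Vec ℤ m) → HeadIs (up^ k hi) v → Attains hi (β ++ᵛ v)
        attains hi [] (x ∷ v) e = inj₁ e
        attains hi (b ∷ β) v e = inj₂ (attains (up hi) β v e)

-- Commutation of h_n with h_i[X(t-1)]^⊥ from Newton's identities

record Scaling (R : CommutativeRing 0ℓ 0ℓ) (V : AbelianGroup 0ℓ 0ℓ) : Set where
  private module R = CommutativeRing R
  open AbelianGroup V
  field
    _•_ : R.Carrier → Carrier → Carrier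
    •-cong : ∀ {c d x y} → c R.≈ d → x ≈ y → (c • x) ≈ (d • y)
    •-distribˡ : ∀ c x y → (c • (x ∙ y)) ≈ ((c • x) ∙ (c • y))
    •-distribʳ : ∀ c d x → ((c R.+ d) • x) ≈ ((c • x) ∙ (d • x))
    •-assoc : ∀ c d x → ((c R.* d) • x) ≈ (c • (d • x))
    𝟙• : ∀ x → (R.1# • x) ≈ x

module HalfVertexOperators (R : CommutativeRing 0ℓ 0ℓ) (V : AbelianGroup 0ℓ 0ℓ) (S : Scaling R V) where
  open CommutativeRing R using ()
    renaming (Carrier to C; _≈_ to _≃_; _+_ to _⊕_; _*_ to _⊗_; 0# to 𝟘; 1# to 𝟙)
  open AbelianGroup V renaming (Carrier to A; _∙_ to _+_; ε to 0#; _⁻¹ to -_)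
  open Scaling S
  private module R = CommutativeRing R
  open import Relation.Binary.Reasoning.Setoid setoid
  open import Algebra.Properties.AbelianGroup V 
    using (identityʳ-unique; inverseˡ-unique; inverseʳ-unique; ⁻¹-∙-comm; ∙-cancelʳ)
  open import Algebra.Properties.CommutativeSemigroup commutativeSemigroup using (interchange)
  open import Algebra.Solver.CommutativeMonoid commutativeMonoid using (solve; _⊜_) renaming (_⊕_ to _:+_)

  infixl 6 _∔_
  _∔_ : A → A → A
  _∔_ = _+_

  +-cong : ∀ {x y u v} → x ≈ y → u ≈ v → x ∔ u ≈ y ∔ v
  +-cong = ∙-cong

  •-congˡ : ∀ {c x y} → x ≈ y → c • x ≈ c • y
  •-congˡ = •-cong R.refl

  •-0 : ∀ c → c • 0# ≈ 0#
  •-0 c = identityʳ-unique (c • 0#) (c • 0#) (trans (sym (•-distribˡ c 0# 0#)) (•-congˡ (identityˡ 0#)))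

  𝟘• : ∀ x → 𝟘 • x ≈ 0#
  𝟘• x = identityʳ-unique (𝟘 • x) (𝟘 • x) (trans (sym (•-distribʳ 𝟘 𝟘 x)) (•-cong (R.+-identityˡ 𝟘) refl))

  •-comm : ∀ c d x → c • (d • x) ≈ d • (c • x)
  •-comm c d x = trans (sym (•-assoc c d x)) (trans (•-cong (R.*-comm c d) refl) (•-assoc d c x))

  •-neg : ∀ c x → c • (- x) ≈ - (c • x)
  •-neg c x = inverseʳ-unique (c • x) (c • (- x)) (trans (sym (•-distribˡ c x (- x)))
    (trans (•-congˡ (inverseʳ x)) (•-0 c)))

  record Lin (L : A → A) : Set where
    field
      cong : ∀ {x y} → x ≈ y → L x ≈ L y
      add : ∀ x y → L (x + y) ≈ L x + L y
      homogeneous : ∀ c x → L (c • x) ≈ c • L x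

    zero-image : L 0# ≈ 0#
    zero-image = identityʳ-unique (L 0#) (L 0#) (trans (sym (add 0# 0#)) (cong (identityˡ 0#)))

    null-image : ∀ {x} → x ≈ 0# → L x ≈ 0#
    null-image e = trans (cong e) zero-image
  open Lin public

  -- The sum over a + b = n. In Newton's identities `a` stands for the power sum p_(a+1) and `b` for
  -- h_b.
  ad : ℕ → (ℕ → ℕ → A) → A
  ad zero φ = φ 0 0
  ad (suc n) φ = φ 0 (suc n) + ad n (λ a b → φ (suc a) b)

  Σ< : ℕ → (ℕ → A) → A
  Σ< zero φ = 0#
  Σ< (suc n) φ = φ 0 + Σ< n (λ i → φ (suc i))

  ad-cong : ∀ n {φ χ : ℕ → ℕ → A} → (∀ a b → b ℕ.≤ n → φ a b ≈ χ a b) → ad n φ ≈ ad n χ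
  ad-cong zero e = e 0 0 z≤n
  ad-cong (suc n) e = +-cong (e 0 (suc n) ℕₚ.≤-refl) (ad-cong n (λ a b l → e (suc a) b (ℕₚ.m≤n⇒m≤1+n l)))

  ad-+ : ∀ n (φ χ : ℕ → ℕ → A) → ad n (λ a b → φ a b + χ a b) ≈ ad n φ + ad n χ
  ad-+ zero φ χ = refl
  ad-+ (suc n) φ χ = trans (+-cong refl (ad-+ n _ _)) (interchange _ _ _ _)

  ad-Lin : ∀ {L} → Lin L → ∀ n (φ : ℕ → ℕ → A) → L (ad n φ) ≈ ad n (λ a b → L (φ a b))
  ad-Lin l zero φ = refl
  ad-Lin l (suc n) φ = trans (add l _ _) (+-cong refl (ad-Lin l n _))

  ad-last : ∀ n (φ : ℕ → ℕ → A) → ad (suc n) φ ≈ ad n (λ a b → φ a (suc b)) + φ (suc n) 0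
  ad-last zero φ = refl
  ad-last (suc n) φ = trans (+-cong refl (ad-last n (λ a b → φ (suc a) b))) (sym (assoc _ _ _))

  ad-zero : ∀ n {φ : ℕ → ℕ → A} → (∀ a b → φ a b ≈ 0#) → ad n φ ≈ 0#
  ad-zero zero e = e 0 0
  ad-zero (suc n) e = trans (+-cong (e 0 (suc n)) (ad-zero n (λ a b → e (suc a) b))) (identityˡ _)

  •-Lin : ∀ c → Lin (c •_)
  •-Lin c = record { cong = •-congˡ ; add = •-distribˡ c ; homogeneous = λ d x → •-comm c d x }

  Σ<-cong : ∀ n {φ χ : ℕ → A} → (∀ i → φ i ≈ χ i) → Σ< n φ ≈ Σ< n χ
  Σ<-cong zero e = refl
  Σ<-cong (suc n) e = +-cong (e 0) (Σ<-cong n (λ i → e (suc i)))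

  Σ<-+ : ∀ n (φ χ : ℕ → A) → Σ< n (λ i → φ i + χ i) ≈ Σ< n φ + Σ< n χ
  Σ<-+ zero φ χ = sym (identityˡ 0#)
  Σ<-+ (suc n) φ χ = trans (+-cong refl (Σ<-+ n _ _)) (interchange _ _ _ _)

  Σ<-Lin : ∀ {L} → Lin L → ∀ n (φ : ℕ → A) → L (Σ< n φ) ≈ Σ< n (λ i → L (φ i))
  Σ<-Lin l zero φ = zero-image l
  Σ<-Lin l (suc n) φ = trans (add l _ _) (+-cong refl (Σ<-Lin l n _))

  Σ<-zero : ∀ n {φ : ℕ → A} → (∀ i → φ i ≈ 0#) → Σ< n φ ≈ 0#
  Σ<-zero zero e = refl
  Σ<-zero (suc n) e = trans (+-cong (e 0) (Σ<-zero n (λ i → e (suc i)))) (identityˡ _)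

  Σ<-swap : ∀ m n (φ : ℕ → ℕ → A) → Σ< m (λ i → Σ< n (φ i)) ≈ Σ< n (λ j → Σ< m (λ i → φ i j))
  Σ<-swap zero n φ = sym (Σ<-zero n (λ _ → refl))
  Σ<-swap (suc m) n φ = trans (+-cong refl (Σ<-swap m n (λ i → φ (suc i)))) (sym (Σ<-+ n _ _))

  Σ<-extend : ∀ n m (φ : ℕ → A) → (∀ i → n ℕ.≤ i → φ i ≈ 0#) → n ℕ.≤ m → Σ< m φ ≈ Σ< n φ
  Σ<-extend zero m φ z l = Σ<-zero m (λ i → z i z≤n)
  Σ<-extend (suc n) (suc m) φ z (s≤s l) = +-cong refl (Σ<-extend n m _ (λ i l → z (suc i) (s≤s l)) l)

  -- Intended reading: `κ` is - t, `τ r` is t^(r+1) - 1, `M r` and `P r` are multiplication by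
  -- p_(r+1) and its adjoint, `h z` is multiplication by h_z, and `g i` is h_i[X(t-1)]^⊥.
  module Operators
    (κ : C) (τ nat inv : ℕ → C)
    (nat-suc : ∀ n → nat (suc n) ≃ 𝟙 ⊕ nat n) (nat-zero : nat 0 ≃ 𝟘)
    (inv-nat : ∀ n → inv (suc n) ⊗ nat (suc n) ≃ 𝟙)
    (τ-zero : τ 0 ⊕ (𝟙 ⊕ κ) ≃ 𝟘) (τ-suc : ∀ r → τ (suc r) ⊕ κ ⊗ τ r ≃ τ 0)
    (h : ℤ → A → A) (h-Lin : ∀ z → Lin (h z)) (h-0 : ∀ x → h (+ 0) x ≈ x) (h-neg : ∀ m x → h -[1+ m ] x ≈ 0#)
    (g : ℕ → A → A) (g-Lin : ∀ i → Lin (g i)) (g-0 : ∀ x → g 0 x ≈ x)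
    (M P : ℕ → A → A) (M-Lin : ∀ r → Lin (M r)) (P-Lin : ∀ r → Lin (P r))
    (newton-h : ∀ n x → nat (suc n) • h (+ suc n) x ≈ ad n (λ a b → M a (h (+ b) x)))
    (newton-g : ∀ n x → nat (suc n) • g (suc n) x ≈ ad n (λ a b → τ a • P a (g b x)))
    (heisenberg : ∀ r s x → P r (M s x) ≈ M s (P r x) + (if s ≡ᵇ r then nat (suc r) • x else 0#))
    (P-g : ∀ r i x → P r (g i x) ≈ g i (P r x))
    where

    nat-cancel : ∀ n {x y} → nat (suc n) • x ≈ nat (suc n) • y → x ≈ y
    nat-cancel n e = trans (sym (undo _)) (trans (•-congˡ e) (undo _))
      where
      undo : ∀ x → inv (suc n) • (nat (suc n) • x) ≈ x
      undo x = trans (sym (•-assoc _ _ x)) (trans (•-cong (inv-nat n) refl) (𝟙• x))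

    nat-+ : ∀ m n → nat (m ℕ.+ n) ≃ nat m ⊕ nat n
    nat-+ zero n = R.sym (R.trans (R.+-congʳ nat-zero) (R.+-identityˡ _))
    nat-+ (suc m) n = R.trans (nat-suc _) (R.trans (R.+-congˡ (nat-+ m n))
      (R.trans (R.sym (R.+-assoc _ _ _)) (R.+-congʳ (R.sym (nat-suc m)))))

    -- h of the integer m − k
    hd : ℕ → ℕ → A → A
    hd m zero = h (+ m)
    hd zero (suc k) _ = 0#
    hd (suc m) (suc k) = hd m k

    -- Newton's identity for the index m + 1 - k. Truncated subtraction is harmless: at k = m + 1
    -- the coefficient is 0 as it should be, and beyond that `hd` vanishes.
    hd-newton : ∀ m k x → ad m (λ a b → M a (hd b k x)) ≈ nat (suc m ℕ.∸ k) • hd (suc m) k x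
    hd-newton m zero x = sym (newton-h m x)
    hd-newton zero (suc k) x = trans (zero-image (M-Lin 0)) (sym (boundary k))
      where
      boundary : ∀ k → nat (0 ℕ.∸ k) • hd 0 k x ≈ 0#
      boundary zero = trans (•-cong nat-zero refl) (𝟘• _)
      boundary (suc k) = •-0 _
    hd-newton (suc m) (suc k) x = begin
      ad (suc m) (λ a b → M a (hd b (suc k) x))  ≈⟨ ad-last m (λ a b → M a (hd b (suc k) x)) ⟩
      ad m (λ a b → M a (hd b k x)) ∔ M (suc m) 0#  ≈⟨ +-cong (hd-newton m k x) (zero-image (M-Lin (suc m))) ⟩
      nat (suc m ℕ.∸ k) • hd (suc m) k x ∔ 0#  ≈⟨ identityʳ _ ⟩
      nat (suc m ℕ.∸ k) • hd (suc m) k x  ∎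

    delta-sum : ∀ m r x c → ad m (λ a b → if a ≡ᵇ r then c • h (+ b) x else 0#) ≈ c • hd m r x
    delta-sum zero zero x c = refl
    delta-sum zero (suc r) x c = sym (•-0 c)
    delta-sum (suc m) zero x c = trans (+-cong refl (ad-zero m (λ _ _ → refl))) (identityʳ _)
    delta-sum (suc m) (suc r) x c = trans (identityˡ _) (delta-sum m r x c)

    weights : ∀ m r x → nat (suc m ℕ.∸ suc r) • hd m r x ∔ nat (suc r) • hd m r x ≈ nat (suc m) • hd m r x
    weights m r x with r ℕ.≤? m
    ... | yes r≤m = trans (sym (•-distribʳ _ _ _)) (•-cong (R.trans (R.sym (nat-+ (m ℕ.∸ r) (suc r)))
          (R.reflexive (≡.cong nat (≡.trans (ℕₚ.+-suc (m ℕ.∸ r) r) (≡.cong suc (ℕₚ.m∸n+n≡m r≤m)))))) refl)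
    ... | no r≰m = trans (+-cong (null _) (null _)) (trans (identityˡ 0#) (sym (null _)))
      where
      beyond : ∀ m r → m ℕ.< r → hd m r x ≈ 0#
      beyond zero (suc r) l = refl
      beyond (suc m) (suc r) (s≤s l) = beyond m r l
      null : ∀ c → c • hd m r x ≈ 0#
      null c = trans (•-congˡ (beyond m r (ℕₚ.≰⇒> r≰m))) (•-0 c)

    -- The commutator is p_(r+1)^⊥ h_m = h_(m-r-1). Applying `P r` to Newton's identity yields this
    -- term with weight m - r from the induction hypothesis and r + 1 from `heisenberg`, together
    -- the factor m + 1 that is cancelled.
    P-h : ∀ r m x → P r (h (+ m) x) ≈ h (+ m) (P r x) + hd m (suc r) x
    P-h r = <-rec _ step
      where
      step : ∀ m → (∀ {b} → b ℕ.< m → ∀ x → P r (h (+ b) x) ≈ h (+ b) (P r x) + hd b (suc r) x) →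
             ∀ x → P r (h (+ m) x) ≈ h (+ m) (P r x) + hd m (suc r) x
      step zero rec x = trans (cong (P-Lin r) (h-0 x)) (sym (trans (identityʳ _) (h-0 _)))
      step (suc m) rec x = nat-cancel m (begin
        nat (suc m) • P r (h (+ suc m) x)  ≈⟨ homogeneous (P-Lin r) _ _ ⟨
        P r (nat (suc m) • h (+ suc m) x)  ≈⟨ cong (P-Lin r) (newton-h m x) ⟩
        P r (ad m (λ a b → M a (h (+ b) x)))  ≈⟨ ad-Lin (P-Lin r) m _ ⟩
        ad m (λ a b → P r (M a (h (+ b) x)))
          ≈⟨ ad-cong m (λ a b b≤m → trans (heisenberg r a _)
               (+-cong (trans (cong (M-Lin a) (rec (s≤s b≤m) x)) (add (M-Lin a) _ _)) refl)) ⟩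
        ad m (λ a b → X a b + Y a b + Z a b)
          ≈⟨ trans (ad-+ m (λ a b → X a b + Y a b) Z) (+-cong (ad-+ m X Y) refl) ⟩
        ad m X + ad m Y + ad m Z
          ≈⟨ +-cong (+-cong (sym (newton-h m (P r x))) (hd-newton m (suc r) x))
                    (delta-sum m r x (nat (suc r))) ⟩
        nat (suc m) • h (+ suc m) (P r x) + nat (suc m ℕ.∸ suc r) • hd m r x + nat (suc r) • hd m r x
          ≈⟨ trans (assoc _ _ _) (+-cong refl (weights m r x)) ⟩
        nat (suc m) • h (+ suc m) (P r x) + nat (suc m) • hd m r x  ≈⟨ •-distribˡ _ _ _ ⟨
        nat (suc m) • (h (+ suc m) (P r x) + hd (suc m) (suc r) x)  ∎)
        where
        X Y Z : ℕ → ℕ → A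
        X a b = M a (h (+ b) (P r x))
        Y a b = M a (hd b (suc r) x)
        Z a b = if a ≡ᵇ r then nat (suc r) • h (+ b) x else 0#

    down^ : ℕ → ℤ → ℤ
    down^ zero z = z
    down^ (suc n) z = down^ n (down z)

    h-below : ∀ k j x → h (down^ k -[1+ j ]) x ≈ 0#
    h-below zero j x = h-neg j x
    h-below (suc k) j x = h-below k (suc (j ℕ.+ 0)) x

    hd-down^ : ∀ m k x → hd m k x ≈ h (down^ k (+ m)) x
    hd-down^ m zero x = refl
    hd-down^ zero (suc k) x = sym (h-below k 0 x)
    hd-down^ (suc m) (suc k) x = hd-down^ m k x

    P-hZ : ∀ r z x → P r (h z x) ≈ h z (P r x) + h (down^ (suc r) z) x
    P-hZ r (+ m) x = trans (P-h r m x) (+-cong refl (hd-down^ m (suc r) x))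
    P-hZ r -[1+ m ] x = trans (null-image (P-Lin r) (h-neg m x))
      (sym (trans (+-cong (h-neg m _) (h-below (suc r) m x)) (identityˡ 0#)))

    C′ : ℕ → ℤ → A → A
    C′ i z x = h z (g i x)

    -- Z satisfies the commutation relation sought by construction; it agrees with g i (h z x)
    -- because both satisfy the Newton recursion with the operators τ_r P_r.
    W Z : ℕ → ℤ → A → A
    W i z x = C′ i z x + κ • Z i z x
    Z zero z x = C′ zero z x
    Z (suc i) z x = C′ (suc i) z x - W i (down z) x

    absorb : ∀ y → τ 0 • y + (y + κ • y) ≈ 0#
    absorb y = trans (+-cong refl (trans (+-cong (sym (𝟙• y)) refl) (sym (•-distribʳ 𝟙 κ y))))
      (trans (sym (•-distribʳ _ _ y)) (trans (•-cong τ-zero refl) (𝟘• y)))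

    -- The recursion of `Z` summed along a diagonal: each new term is absorbed by τ 0 + 1 + κ = 0.
    -- It evaluates the sums that remain once all weights `τ r` have been reduced to `τ 0`.
    diagonal : ∀ i z x → τ 0 • ad i (λ r s → Z s (down^ r z) x) ≈ - W i z x
    diagonal zero z x = inverseˡ-unique _ _ (begin
      τ 0 • Z 0 z x + (Z 0 z x + κ • Z 0 z x)  ≈⟨ absorb (Z 0 z x) ⟩
      0#  ∎)
    diagonal (suc i) z x = inverseˡ-unique _ _ (begin
      τ 0 • (Zs + ad i (λ r s → Z s (down^ (suc r) z) x)) + (c + κ • Zs)
        ≈⟨ +-cong (trans (•-distribˡ _ _ _) (+-cong refl (diagonal i (down z) x))) refl ⟩
      (τ 0 • Zs + - w) + (c + κ • Zs)
        ≈⟨ solve 4 (λ a b c d → (a :+ b) :+ (c :+ d) ⊜ a :+ ((c :+ b) :+ d)) refl _ _ _ _ ⟩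
      τ 0 • Zs + ((c + - w) + κ • Zs)  ≈⟨ absorb Zs ⟩
      0#  ∎)
      where
      Zs c w : A
      Zs = Z (suc i) z x
      c = C′ (suc i) z x
      w = W i (down z) x

    C′-newton : ∀ i z x → nat (suc i) • C′ (suc i) z x ≈ ad i (λ r s → τ r • C′ s z (P r x))
    C′-newton i z x = trans (sym (homogeneous (h-Lin z) _ _)) (trans (cong (h-Lin z) (newton-g i x))
      (trans (ad-Lin (h-Lin z) i _) (ad-cong i (λ r s _ →
        trans (homogeneous (h-Lin z) _ _) (•-congˡ (cong (h-Lin z) (P-g r s x)))))))

    -- The extra factor 1 on the left, from i + 2 = 1 + (i + 1), produces one `W`. On the right it
    -- comes from `diagonal`, after τ (r + 1) + κ τ r = τ 0 has made the weights constant.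
    Z-newton : ∀ i z x → nat (suc i) • Z (suc i) z x ≈
               ad i (λ r s → τ r • (Z s z (P r x) + Z s (down^ (suc r) z) x))
    Z-newton zero z x = begin
      nat 1 • (C′ 1 z x - W 0 (down z) x)  ≈⟨ •-distribˡ _ _ _ ⟩
      nat 1 • C′ 1 z x + nat 1 • (- W 0 (down z) x)
        ≈⟨ +-cong (C′-newton 0 z x) (trans (•-cong (R.trans (nat-suc 0) (R.trans (R.+-congˡ nat-zero) (R.+-identityʳ 𝟙))) refl) (𝟙• _)) ⟩
      τ 0 • Z 0 z (P 0 x) + - W 0 (down z) x  ≈⟨ +-cong refl (sym (diagonal 0 (down z) x)) ⟩
      τ 0 • Z 0 z (P 0 x) + τ 0 • Z 0 (down z) x  ≈⟨ •-distribˡ _ _ _ ⟨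
      τ 0 • (Z 0 z (P 0 x) + Z 0 (down z) x)  ∎
    -- `U` is κ times the shifted sum one step down. Adding it to both sides allows `τ-suc` to be
    -- used in its additive form.
    Z-newton (suc i) z x = ∙-cancelʳ U _ _ (begin
      nat (suc (suc i)) • (c - w) + U
        ≈⟨ +-cong (trans (•-distribˡ _ _ _) (+-cong (C′-newton (suc i) z x) (•-neg _ w))) refl ⟩
      (ad (suc i) (λ r s → τ r • C′ s z (P r x)) - nat (suc (suc i)) • w) + U
        ≈⟨ +-cong (+-cong (ad-last i φC) (⁻¹-cong (trans (•-cong (nat-suc (suc i)) refl)
             (trans (•-distribʳ _ _ w) (+-cong (𝟙• w) W-newton))))) refl ⟩
      ((c₁ + c₀) - (w + (w₁ + U))) + U
        ≈⟨ +-cong (+-cong refl (trans (sym (⁻¹-∙-comm w (w₁ + U))) (+-cong refl (sym (⁻¹-∙-comm w₁ U))))) refl ⟩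
      ((c₁ + c₀) + (- w + (- w₁ + - U))) + U
        ≈⟨ solve 6 (λ a b c d e f → ((a :+ b) :+ (c :+ (d :+ e))) :+ f ⊜ ((a :+ d) :+ b) :+ (c :+ (e :+ f)))
             refl c₁ c₀ (- w) (- w₁) (- U) U ⟩
      ((c₁ - w₁) + c₀) + (- w + (- U + U))
        ≈⟨ +-cong (+-cong first refl) (trans (+-cong refl (inverseˡ U)) (identityʳ _)) ⟩
      (z₁ + c₀) + - w  ≈⟨ +-cong (sym (ad-last i φZ)) second ⟩
      ad (suc i) (λ r s → τ r • Z s z (P r x)) + (ad (suc i) (λ r s → τ r • Z s (down^ (suc r) z) x) + U)
        ≈⟨ assoc _ _ _ ⟨
      (ad (suc i) (λ r s → τ r • Z s z (P r x)) + ad (suc i) (λ r s → τ r • Z s (down^ (suc r) z) x)) + U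
        ≈⟨ +-cong (trans (ad-cong (suc i) (λ r s _ → •-distribˡ (τ r) (Z s z (P r x)) (Z s (down^ (suc r) z) x)))
             (ad-+ (suc i) φZ φD)) refl ⟨
      ad (suc i) (λ r s → τ r • (Z s z (P r x) + Z s (down^ (suc r) z) x)) + U  ∎)
      where
      c w c₀ c₁ w₁ z₁ U : A
      c = C′ (suc (suc i)) z x
      w = W (suc i) (down z) x
      c₀ = τ (suc i) • C′ 0 z (P (suc i) x)
      c₁ = ad i (λ r s → τ r • C′ (suc s) z (P r x))
      w₁ = ad i (λ r s → τ r • W s (down z) (P r x))
      z₁ = ad i (λ r s → τ r • Z (suc s) z (P r x))
      U = κ • ad i (λ r s → τ r • Z s (down^ (suc r) (down z)) x)

      φC φZ φD : ℕ → ℕ → A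
      φC r s = τ r • C′ s z (P r x)
      φZ r s = τ r • Z s z (P r x)
      φD r s = τ r • Z s (down^ (suc r) z) x

      W-newton : nat (suc i) • w ≈ w₁ + U
      W-newton = begin
        nat (suc i) • (C′ (suc i) (down z) x + κ • Z (suc i) (down z) x)
          ≈⟨ trans (•-distribˡ _ _ _) (+-cong (C′-newton i (down z) x) (trans (•-comm _ _ _)
               (•-congˡ (trans (Z-newton i (down z) x)
                 (trans (ad-cong i (λ r s _ → •-distribˡ _ _ _)) (ad-+ i _ _)))))) ⟩
        ad i (λ r s → τ r • C′ s (down z) (P r x)) +
        κ • (ad i (λ r s → τ r • Z s (down z) (P r x)) +
             ad i (λ r s → τ r • Z s (down^ (suc r) (down z)) x))
          ≈⟨ trans (+-cong refl (•-distribˡ _ _ _)) (sym (assoc _ _ _)) ⟩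
        (ad i (λ r s → τ r • C′ s (down z) (P r x)) + κ • ad i (λ r s → τ r • Z s (down z) (P r x))) + U
          ≈⟨ +-cong (trans (+-cong refl (ad-Lin (•-Lin κ) i _)) (sym (ad-+ i _ _))) refl ⟩
        ad i (λ r s → τ r • C′ s (down z) (P r x) + κ • (τ r • Z s (down z) (P r x))) + U
          ≈⟨ +-cong (ad-cong i (λ r s _ → trans (+-cong refl (•-comm _ _ _)) (sym (•-distribˡ _ _ _)))) refl ⟩
        w₁ + U  ∎

      first : c₁ - w₁ ≈ z₁
      first = begin
        c₁ + - w₁  ≈⟨ +-cong refl (ad-neg i (λ r s → τ r • W s (down z) (P r x))) ⟩
        c₁ + ad i (λ r s → - (τ r • W s (down z) (P r x)))  ≈⟨ ad-+ i _ _ ⟨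
        ad i (λ r s → τ r • C′ (suc s) z (P r x) + - (τ r • W s (down z) (P r x)))
          ≈⟨ ad-cong i (λ r s _ → trans (+-cong refl (sym (•-neg _ _))) (sym (•-distribˡ _ _ _))) ⟩
        z₁  ∎
        where
        ad-neg : ∀ n (φ : ℕ → ℕ → A) → - ad n φ ≈ ad n (λ a b → - φ a b)
        ad-neg zero φ = refl
        ad-neg (suc n) φ = trans (sym (⁻¹-∙-comm _ _)) (+-cong refl (ad-neg n (λ a → φ (suc a))))

      second : - w ≈ ad (suc i) (λ r s → τ r • Z s (down^ (suc r) z) x) + U
      second = begin
        - w  ≈⟨ diagonal (suc i) (down z) x ⟨
        τ 0 • (Z (suc i) (down z) x + ad i (λ r s → Z s (down^ r (down (down z))) x))
          ≈⟨ trans (•-distribˡ _ _ _) (+-cong refl (ad-Lin (•-Lin (τ 0)) i _)) ⟩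
        τ 0 • Z (suc i) (down z) x + ad i (λ r s → τ 0 • Z s (down^ r (down (down z))) x)
          ≈⟨ +-cong refl (ad-cong i (λ r s _ → trans (•-cong (R.sym (τ-suc r)) refl)
               (trans (•-distribʳ _ _ _) (+-cong refl (•-assoc _ _ _))))) ⟩
        τ 0 • Z (suc i) (down z) x +
        ad i (λ r s → τ (suc r) • Z s (down^ r (down (down z))) x +
                      κ • (τ r • Z s (down^ r (down (down z))) x))
          ≈⟨ trans (+-cong refl (trans (ad-+ i _ _) (+-cong refl (sym (ad-Lin (•-Lin κ) i _))))) (sym (assoc _ _ _)) ⟩
        ad (suc i) (λ r s → τ r • Z s (down^ (suc r) z) x) + U  ∎

    g-h-Z : ∀ i z x → g i (h z x) ≈ Z i z x
    g-h-Z = <-rec _ step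
      where
      step : ∀ i → (∀ {s} → s ℕ.< i → ∀ z x → g s (h z x) ≈ Z s z x) → ∀ z x → g i (h z x) ≈ Z i z x
      step zero rec z x = trans (g-0 _) (cong (h-Lin z) (sym (g-0 x)))
      step (suc i) rec z x = nat-cancel i (begin
        nat (suc i) • g (suc i) (h z x)  ≈⟨ newton-g i (h z x) ⟩
        ad i (λ r s → τ r • P r (g s (h z x)))
          ≈⟨ ad-cong i (λ r s s≤i → •-congˡ (trans (P-g r s _)
               (trans (cong (g-Lin s) (P-hZ r z x)) (trans (add (g-Lin s) _ _)
                 (+-cong (rec (s≤s s≤i) z (P r x)) (rec (s≤s s≤i) (down^ (suc r) z) x)))))) ⟩
        ad i (λ r s → τ r • (Z s z (P r x) + Z s (down^ (suc r) z) x))  ≈⟨ Z-newton i z x ⟨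
        nat (suc i) • Z (suc i) z x  ∎)

    g-h : ∀ i z x → g (suc i) (h z x) + (h (down z) (g i x) + κ • g i (h (down z) x)) ≈ h z (g (suc i) x)
    g-h i z x = begin
      g (suc i) (h z x) + (h (down z) (g i x) + κ • g i (h (down z) x))
        ≈⟨ +-cong (g-h-Z (suc i) z x) (+-cong refl (•-congˡ (g-h-Z i (down z) x))) ⟩
      (C′ (suc i) z x + - W i (down z) x) + W i (down z) x  ≈⟨ assoc _ _ _ ⟩
      C′ (suc i) z x + (- W i (down z) x + W i (down z) x)
        ≈⟨ trans (+-cong refl (inverseˡ _)) (identityʳ _) ⟩
      C′ (suc i) z x  ∎

    -- The sign rule for the operators B

    module VertexOperators
      (h-comm : ∀ y z x → h y (h z x) ≈ h z (h y x)) (g-comm : ∀ i j x → g i (g j x) ≈ g j (g i x))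
      (bound : A → ℕ) (g-beyond : ∀ x i → bound x ℕ.≤ i → g i x ≈ 0#)
      (B : ℤ → A → A) (B-sum : ∀ n x → B n x ≈ Σ< (bound x) (λ i → h (n ℤ.+ (+ i)) (g i x))) where

      B-upTo : ∀ n x D → bound x ℕ.≤ D → B n x ≈ Σ< D (λ i → h (n ℤ.+ (+ i)) (g i x))
      B-upTo n x D l = trans (B-sum n x) (sym (Σ<-extend (bound x) D _
        (λ i l → null-image (h-Lin _) (g-beyond x i l)) l))

      -- The cut-off `bound` depends on the representing list and not on its class, so sums are
      -- compared at a common length.
      B-Lin : ∀ n → Lin (B n)
      B-Lin n = record
        { cong = λ {x} {y} e → trans (B-upTo n x (bound x ℕ.⊔ bound y) (ℕₚ.m≤m⊔n _ _))
            (trans (Σ<-cong (bound x ℕ.⊔ bound y) (λ i → cong (h-Lin _) (cong (g-Lin i) e)))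
              (sym (B-upTo n y (bound x ℕ.⊔ bound y) (ℕₚ.m≤n⊔m _ _))))
        ; add = λ x y → let D = bound (x + y) ℕ.⊔ (bound x ℕ.⊔ bound y) in
            trans (B-upTo n (x + y) D (ℕₚ.m≤m⊔n _ _))
              (trans (Σ<-cong D (λ i → trans (cong (h-Lin _) (add (g-Lin i) x y)) (add (h-Lin _) _ _)))
                (trans (Σ<-+ D _ _) (sym (+-cong
                  (B-upTo n x D (ℕₚ.≤-trans (ℕₚ.m≤m⊔n _ _) (ℕₚ.m≤n⊔m (bound (x + y)) _)))
                  (B-upTo n y D (ℕₚ.≤-trans (ℕₚ.m≤n⊔m (bound x) _) (ℕₚ.m≤n⊔m (bound (x + y)) _)))))))
        ; homogeneous = λ c x → let D = bound (c • x) ℕ.⊔ bound x in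
            trans (B-upTo n (c • x) D (ℕₚ.m≤m⊔n _ _))
              (trans (Σ<-cong D (λ i → trans (cong (h-Lin _) (homogeneous (g-Lin i) c x))
                                             (homogeneous (h-Lin _) c _)))
                (trans (sym (Σ<-Lin (•-Lin c) D _))
                  (•-congˡ (sym (B-upTo n x D (ℕₚ.m≤n⊔m (bound (c • x)) _))))))
        }

      -- Coefficients of the normally ordered product of two vertex operators.
      term : ℤ → ℤ → A → ℕ → ℕ → A
      term a b x i k = h (a ℤ.+ (+ i)) (h (b ℤ.+ (+ k)) (g i (g k x)))

      normal : ℕ → ℕ → ℤ → ℤ → A → A
      normal D E a b x = Σ< D (λ i → Σ< E (term a b x i))

      normal-swap : ∀ D a b x → normal D D a b x ≈ normal D D b a x
      normal-swap D a b x = trans (Σ<-swap D D (term a b x)) (Σ<-cong D (λ k → Σ<-cong D (λ i →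
        trans (h-comm _ _ _) (cong (h-Lin _) (cong (h-Lin _) (g-comm i k x))))))

      normal-extend : ∀ D a b x → bound x ℕ.≤ D → normal D (bound x) a b x ≈ normal (bound x) (bound x) a b x
      normal-extend D a b x l = Σ<-extend (bound x) D _ (λ i l → Σ<-zero (bound x) (λ k →
        null-image (h-Lin _) (null-image (h-Lin _) (trans (g-comm i k x) (null-image (g-Lin k) (g-beyond x i l)))))) l

      up-index : ∀ a i → up a ℤ.+ (+ i) ≡ a ℤ.+ (+ suc i)
      up-index a i = ℤₚ.+-assoc a (+ 1) (+ i)

      down-index : ∀ b k → down b ℤ.+ (+ k) ≡ down (b ℤ.+ (+ k))
      down-index b k = ≡.trans (ℤₚ.+-assoc b _ _) (≡.trans
        (≡.cong (λ z → b ℤ.+ z) (ℤₚ.+-comm (ℤ.- (+ 1)) (+ k))) (≡.sym (ℤₚ.+-assoc b _ _)))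

      -- Moving `g` to the right past the inner `h` by `g-h` costs exactly the κ-term and a normally
      -- ordered product with shifted indices. The summand i = 0 is split off, since `g 0` is the
      -- identity and `g-h` concerns `g (suc i)`.
      product-normal : ∀ a b x →
        (B a (B b x) + κ • B (up a) (B (down b) x)) + normal (bound x) (bound x) (up a) (down b) x ≈
        normal (bound x) (bound x) a b x
      product-normal a b x = begin
        (B a y + κ • B (up a) y′) + normal E E (up a) (down b) x
          ≈⟨ +-cong (+-cong (B-upTo a y (suc D) (ℕₚ.m≤n⇒m≤1+n y≤D))
               (trans (•-congˡ (B-upTo (up a) y′ D y′≤D)) (Σ<-Lin (•-Lin κ) D _)))
               (sym (normal-extend D (up a) (down b) x E≤D)) ⟩
        ((h (a ℤ.+ (+ 0)) (g 0 y) + Σ< D S₁) + Σ< D S₂) + Σ< D S₃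
          ≈⟨ solve 4 (λ p q r s → ((p :+ q) :+ r) :+ s ⊜ p :+ ((q :+ r) :+ s)) refl _ _ _ _ ⟩
        h (a ℤ.+ (+ 0)) (g 0 y) + ((Σ< D S₁ + Σ< D S₂) + Σ< D S₃)
          ≈⟨ +-cong first (trans (Σ<-cong D rest) (trans (Σ<-+ D _ S₃) (+-cong (Σ<-+ D S₁ S₂) refl))) ⟨
        normal (suc D) E a b x  ≈⟨ normal-extend (suc D) a b x (ℕₚ.m≤n⇒m≤1+n E≤D) ⟩
        normal E E a b x  ∎
        where
        E D : ℕ
        y y′ : A
        E = bound x
        y = B b x
        y′ = B (down b) x
        D = E ℕ.⊔ (bound y ℕ.⊔ bound y′)
        E≤D : E ℕ.≤ D
        E≤D = ℕₚ.m≤m⊔n E _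
        y≤D : bound y ℕ.≤ D
        y≤D = ℕₚ.≤-trans (ℕₚ.m≤m⊔n (bound y) (bound y′)) (ℕₚ.m≤n⊔m E _)
        y′≤D : bound y′ ℕ.≤ D
        y′≤D = ℕₚ.≤-trans (ℕₚ.m≤n⊔m (bound y) (bound y′)) (ℕₚ.m≤n⊔m E _)

        S₁ S₂ S₃ : ℕ → A
        S₁ i = h (a ℤ.+ (+ suc i)) (g (suc i) y)
        S₂ i = κ • h (up a ℤ.+ (+ i)) (g i y′)
        S₃ i = Σ< E (term (up a) (down b) x i)

        g-B : ∀ i b → g i (B b x) ≈ Σ< E (λ k → g i (h (b ℤ.+ (+ k)) (g k x)))
        g-B i b = trans (cong (g-Lin i) (B-sum b x)) (Σ<-Lin (g-Lin i) E _)

        first : Σ< E (term a b x 0) ≈ h (a ℤ.+ (+ 0)) (g 0 y)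
        first = begin
          Σ< E (term a b x 0)  ≈⟨ Σ<-Lin (h-Lin _) E _ ⟨
          h (a ℤ.+ (+ 0)) (Σ< E (λ k → h (b ℤ.+ (+ k)) (g 0 (g k x))))
            ≈⟨ cong (h-Lin _) (Σ<-cong E (λ k → trans (cong (h-Lin _) (g-0 _)) (sym (g-0 _)))) ⟩
          h (a ℤ.+ (+ 0)) (Σ< E (λ k → g 0 (h (b ℤ.+ (+ k)) (g k x))))  ≈⟨ cong (h-Lin _) (g-B 0 b) ⟨
          h (a ℤ.+ (+ 0)) (g 0 y)  ∎

        inner : ∀ i k → g (suc i) (h (b ℤ.+ (+ k)) (g k x)) +
          (κ • g i (h (down b ℤ.+ (+ k)) (g k x)) + h (down b ℤ.+ (+ k)) (g i (g k x))) ≈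
          h (b ℤ.+ (+ k)) (g (suc i) (g k x))
        inner i k rewrite down-index b k =
          trans (+-cong refl (comm _ _)) (g-h i (b ℤ.+ (+ k)) (g k x))

        rest : ∀ i → Σ< E (term a b x (suc i)) ≈ (S₁ i + S₂ i) + S₃ i
        rest i rewrite up-index a i = begin
          Σ< E (term a b x (suc i))  ≈⟨ Σ<-Lin H E _ ⟨
          H′ (Σ< E (λ k → h (b ℤ.+ (+ k)) (g (suc i) (g k x))))
            ≈⟨ cong H (trans (Σ<-cong E (inner i)) refl) ⟨
          H′ (Σ< E (λ k → G₁ k + (κ • G₂ k + G₃ k)))
            ≈⟨ cong H (trans (Σ<-+ E G₁ _) (+-cong refl (Σ<-+ E _ G₃))) ⟩
          H′ (Σ< E G₁ + (Σ< E (λ k → κ • G₂ k) + Σ< E G₃))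
            ≈⟨ cong H (+-cong (sym (g-B (suc i) b)) (+-cong (trans (sym (Σ<-Lin (•-Lin κ) E G₂))
                 (•-congˡ (sym (g-B i (down b))))) refl)) ⟩
          H′ (g (suc i) y + (κ • g i y′ + Σ< E G₃))
            ≈⟨ trans (add H _ _) (+-cong refl (trans (add H _ _)
                 (+-cong (homogeneous H κ _) (Σ<-Lin H E G₃)))) ⟩
          H′ (g (suc i) y) + (κ • H′ (g i y′) + Σ< E (λ k → H′ (G₃ k)))  ≈⟨ assoc _ _ _ ⟨
          (H′ (g (suc i) y) + κ • H′ (g i y′)) + Σ< E (λ k → H′ (G₃ k))  ∎
          where
          H′ : A → A
          H′ = h (a ℤ.+ (+ suc i))
          H : Lin H′
          H = h-Lin (a ℤ.+ (+ suc i))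
          G₁ G₂ G₃ : ℕ → A
          G₁ k = g (suc i) (h (b ℤ.+ (+ k)) (g k x))
          G₂ k = g i (h (down b ℤ.+ (+ k)) (g k x))
          G₃ k = h (down b ℤ.+ (+ k)) (g i (g k x))

      -- By `product-normal` the first bracket is N a b - N (up a) (down b). As N is symmetric in
      -- its two indices, the exchange turns this difference into its negative.
      B-exchange : ∀ a b x → (B a (B b x) + κ • B (up a) (B (down b) x)) +
                             (B (down b) (B (up a) x) + κ • B b (B a x)) ≈ 0#
      B-exchange a b x = identityʳ-unique (N a b + N (up a) (down b)) _ (begin
        (N a b + N (up a) (down b)) + (Y + Y′)
          ≈⟨ solve 4 (λ p q r s → (p :+ q) :+ (r :+ s) ⊜ (r :+ q) :+ (s :+ p)) refl _ _ _ _ ⟩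
        (Y + N (up a) (down b)) + (Y′ + N a b)
          ≈⟨ +-cong (product-normal a b x) (trans (+-cong refl (normal-swap (bound x) a b x)) swapped) ⟩
        N a b + N (down b) (up a)  ≈⟨ +-cong refl (normal-swap (bound x) (down b) (up a) x) ⟩
        N a b + N (up a) (down b)  ∎)
        where
        N : ℤ → ℤ → A
        N a b = normal (bound x) (bound x) a b x
        Y Y′ : A
        Y = B a (B b x) + κ • B (up a) (B (down b) x)
        Y′ = B (down b) (B (up a) x) + κ • B b (B a x)

        swapped : Y′ + N b a ≈ N (down b) (up a)
        swapped = ≡.subst₂ (λ u v → (B (down b) (B (up a) x) + κ • B u (B v x)) + N u v ≈ N (down b) (up a))
          (up-down b) (down-up a) (product-normal (down b) (up a) x)

-- Symmetric functions over a commutative ring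

module SymmetricFunctions (R : CommutativeRing 0ℓ 0ℓ) (κ : CommutativeRing.Carrier R)
  (nat inv τ : ℕ → CommutativeRing.Carrier R) (tfac : Mono → CommutativeRing.Carrier R) where
  open CommutativeRing R using ()
    renaming (Carrier to C; _≈_ to _≃_; _+_ to _⊕_; _*_ to _⊗_; 0# to 𝟘; 1# to 𝟙)
  private
    module R = CommutativeRing R
    module RR = Relation.Binary.Reasoning.Setoid R.setoid
  open LinearCombinations R

  Sym : Set
  Sym = List (C × Mono)

  scale : C → Sym → Sym
  scale c f = map (λ { (d , μ) → (c ⊗ d , μ) }) f

  mul : Sym → Sym → Sym
  mul f g = concatMap (λ { (c , μ) → map (λ { (d , ν) → (c ⊗ d , μ ++ ν) }) g }) f

  one : Sym
  one = (𝟙 , []) ∷ []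

  p : ℕ → Sym
  p r = (𝟙 , r ∷ []) ∷ []

  newtonAux : ℕ → List Sym → Sym
  newtonAux r [] = []
  newtonAux r (g ∷ gs) = mul (p r) g ++ newtonAux (suc r) gs

  hList : ℕ → List Sym
  hList zero = one ∷ []
  hList (suc n) = scale (inv (suc n)) (newtonAux 0 (hList n)) ∷ hList n

  head : List Sym → Sym
  head [] = []
  head (g ∷ _) = g

  h : ℕ → Sym
  h n = head (hList n)

  hZ : ℤ → Sym
  hZ (+ m) = h m
  hZ -[1+ m ] = []

  pleth : Sym → Sym
  pleth f = map (λ { (c , μ) → (c ⊗ tfac μ , μ) }) f

  perpOne : ℕ → Sym → Sym
  perpOne r f = concatMap (λ { (c , μ) → map (λ ν → (c ⊗ nat (suc r) , ν)) (remOcc r μ) }) f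

  perpMono : Mono → Sym → Sym
  perpMono λ' f = foldr perpOne f λ'

  perpS : Sym → Sym → Sym
  perpS g f = concatMap (λ { (c , λ') → scale c (perpMono λ' f) }) g

  weight : Mono → ℕ
  weight μ = sum (map suc μ)

  deg : Sym → ℕ
  deg f = sum (map (λ { (c , μ) → weight μ }) f)

  B : ℤ → Sym → Sym
  B n f = concatMap (λ i → mul (hZ (n ℤ.+ (+ i))) (perpS (pleth (h i)) f)) (upTo (suc (deg f)))

  Invariant : (Mono → C) → Set
  Invariant F = ∀ {μ ν} → μ ↭ ν → F μ ≃ F ν

  -- Testing equality on permutation-invariant functionals reduces identities between operators
  -- on lists of terms to identities between their transposes.
  infix 4 _≋_
  record _≋_ (f g : Sym) : Set where
    constructor functionals
    field at : ∀ F → Invariant F → ev F f ≃ ev F g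
  open _≋_ public

  negate : Sym → Sym
  negate f = scale (R.- 𝟙) f

  ev-scale : ∀ F c f → ev F (scale c f) ≃ c ⊗ ev F f
  ev-scale F c f = ev-map c (λ μ → μ) _ (λ _ _ → R.refl) (λ _ _ → ≡.refl) F f

  open import Algebra.Properties.Ring R.ring using (-1*x≈-x)

  ev-neg : ∀ F f → ev F (negate f) ≃ R.- ev F f
  ev-neg F f = R.trans (ev-scale F (R.- 𝟙) f) (-1*x≈-x _)

  ≋-refl : ∀ {f} → f ≋ f
  ≋-refl = functionals λ _ _ → R.refl

  V : AbelianGroup 0ℓ 0ℓ
  V = record
    { Carrier = Sym
    ; _≈_ = _≋_
    ; _∙_ = _++_
    ; ε = []
    ; _⁻¹ = negate
    ; isAbelianGroup = record
      { isGroup = record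
        { isMonoid = record
          { isSemigroup = record
            { isMagma = record
              { isEquivalence = record
                { refl = ≋-refl
                ; sym = λ e → functionals λ F i → R.sym (at e F i)
                ; trans = λ e₁ e₂ → functionals λ F i → R.trans (at e₁ F i) (at e₂ F i)
                }
              ; ∙-cong = λ {f} {f′} {g} {g′} e₁ e₂ → functionals λ F i → R.trans (ev-++ F f g)
                  (R.trans (R.+-cong (at e₁ F i) (at e₂ F i)) (R.sym (ev-++ F f′ g′)))
              }
            ; assoc = λ f g k → functionals λ F _ →
                R.reflexive (≡.cong (ev F) (Listₚ.++-assoc f g k))
            }
          ; identity = (λ f → ≋-refl) , λ f → functionals λ F _ →
              R.reflexive (≡.cong (ev F) (Listₚ.++-identityʳ f))
          }
        ; inverse =
            (λ f → functionals λ F _ → R.trans (ev-++ F (negate f) f)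
              (R.trans (R.+-congʳ (ev-neg F f)) (R.-‿inverseˡ _))) ,
            (λ f → functionals λ F _ → R.trans (ev-++ F f (negate f))
              (R.trans (R.+-congˡ (ev-neg F f)) (R.-‿inverseʳ _)))
        ; ⁻¹-cong = λ {f} {g} e → functionals λ F i → R.trans (ev-neg F f)
            (R.trans (R.-‿cong (at e F i)) (R.sym (ev-neg F g)))
        }
      ; comm = λ f g → functionals λ F _ → R.trans (ev-++ F f g)
          (R.trans (R.+-comm _ _) (R.sym (ev-++ F g f)))
      }
    }

  module V = AbelianGroup V
  open import Relation.Binary.Reasoning.Setoid V.setoid
  open import Algebra.Properties.CommutativeSemigroup V.commutativeSemigroup using (interchange)

  infixl 6 _+_
  _+_ : Sym → Sym → Sym
  _+_ = _++_

  infixr 7 _•_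
  _•_ : C → Sym → Sym
  _•_ = scale

  +-cong : ∀ {f f′ g g′} → f ≋ f′ → g ≋ g′ → f + g ≋ f′ + g′
  +-cong = V.∙-cong

  •-cong : ∀ {c d f g} → c ≃ d → f ≋ g → c • f ≋ d • g
  •-cong {c} {d} {f} {g} e₁ e₂ = functionals λ F i → R.trans (ev-scale F c f)
    (R.trans (R.*-cong e₁ (at e₂ F i)) (R.sym (ev-scale F d g)))

  •-congˡ : ∀ {c f g} → f ≋ g → c • f ≋ c • g
  •-congˡ = •-cong R.refl

  •-distribˡ : ∀ c f g → c • (f + g) ≋ c • f + c • g
  •-distribˡ c f g = functionals λ F i → R.trans (ev-scale F c (f + g)) (R.trans
    (R.*-congˡ (ev-++ F f g)) (R.trans (R.distribˡ _ _ _) (R.sym (R.trans (ev-++ F (c • f) (c • g))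
      (R.+-cong (ev-scale F c f) (ev-scale F c g))))))

  •-distribʳ : ∀ c d f → (c ⊕ d) • f ≋ c • f + d • f
  •-distribʳ c d f = functionals λ F i → R.trans (ev-scale F (c ⊕ d) f) (R.trans (R.distribʳ _ _ _)
    (R.sym (R.trans (ev-++ F (c • f) (d • f)) (R.+-cong (ev-scale F c f) (ev-scale F d f)))))

  •-assoc : ∀ c d f → (c ⊗ d) • f ≋ c • d • f
  •-assoc c d f = functionals λ F i → R.trans (ev-scale F (c ⊗ d) f) (R.trans (R.*-assoc _ _ _)
    (R.sym (R.trans (ev-scale F c (d • f)) (R.*-congˡ (ev-scale F d f)))))

  𝟙• : ∀ f → 𝟙 • f ≋ f
  𝟙• f = functionals λ F i → R.trans (ev-scale F 𝟙 f) (R.*-identityˡ _)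

  scaling : Scaling R V
  scaling = record
    { _•_ = _•_
    ; •-cong = •-cong
    ; •-distribˡ = •-distribˡ
    ; •-distribʳ = •-distribʳ
    ; •-assoc = •-assoc
    ; 𝟙• = 𝟙•
    }

  open HalfVertexOperators R V scaling public
    using (•-comm; Lin; cong; add; homogeneous; zero-image; null-image; ad; Σ<; ad-cong; module Operators)

  module _ (L : Sym → Sym) (T : (Mono → C) → Mono → C) (T-invariant : ∀ {F} → Invariant F → Invariant (T F))
           (adjoint : ∀ F f → ev F (L f) ≃ ev (T F) f) where
    -- Values of functionals on `L f` depend on `f` only through transposed functionals; as these
    -- are again invariant, `L` descends to classes of lists.
    transpose⇒Lin : Lin L
    transpose⇒Lin = record
      { cong = λ {f} {g} e → functionals λ F i → R.trans (adjoint F f)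
          (R.trans (at e (T F) (T-invariant i)) (R.sym (adjoint F g)))
      ; add = λ f g → functionals λ F i → R.trans (adjoint F (f + g)) (R.trans (ev-++ (T F) f g)
          (R.sym (R.trans (ev-++ F (L f) (L g)) (R.+-cong (adjoint F f) (adjoint F g)))))
      ; homogeneous = λ c f → functionals λ F i → R.trans (adjoint F (c • f)) (R.trans (ev-scale (T F) c f)
          (R.sym (R.trans (ev-scale F c (L f)) (R.*-congˡ (adjoint F f)))))
      }

  id-Lin : Lin (λ f → f)
  id-Lin = record { cong = λ e → e ; add = λ _ _ → ≋-refl ; homogeneous = λ _ _ → ≋-refl }

  ∘-Lin : ∀ {L M} → Lin L → Lin M → Lin (λ f → L (M f))
  ∘-Lin l m = record
    { cong = λ e → cong l (cong m e)
    ; add = λ f g → V.trans (cong l (add m f g)) (add l _ _)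
    ; homogeneous = λ c f → V.trans (cong l (homogeneous m c f)) (homogeneous l c _)
    }

  +-Lin : ∀ {L M} → Lin L → Lin M → Lin (λ f → L f + M f)
  +-Lin {L} {M} l m = record
    { cong = λ e → +-cong (cong l e) (cong m e)
    ; add = λ f g → V.trans (+-cong (add l f g) (add m f g)) (interchange (L f) (L g) (M f) (M g))
    ; homogeneous = λ c f → V.trans (+-cong (homogeneous l c f) (homogeneous m c f)) (V.sym (•-distribˡ c (L f) (M f)))
    }

  •-Lin : ∀ {L} c → Lin L → Lin (λ f → c • L f)
  •-Lin {L} c l = record
    { cong = λ e → •-congˡ (cong l e)
    ; add = λ f g → V.trans (•-congˡ (add l f g)) (•-distribˡ c (L f) (L g))
    ; homogeneous = λ d f → V.trans (•-congˡ (homogeneous l d f)) (•-comm c d (L f))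
    }

  zero-Lin : Lin (λ _ → [])
  zero-Lin = record { cong = λ _ → ≋-refl ; add = λ _ _ → ≋-refl ; homogeneous = λ _ _ → ≋-refl }

  ev-mul : ∀ F f g → ev F (mul f g) ≃ ev (λ μ → ev (λ ν → F (μ ++ ν)) g) f
  ev-mul F f g = ev-concatMap _ F _
    (λ c μ → ev-map c (μ ++_) _ (λ _ _ → R.refl) (λ _ _ → ≡.refl) F g) f

  mul-Lin : ∀ g → Lin (mul g)
  mul-Lin g = transpose⇒Lin (mul g) (λ F ν → ev (λ μ → F (μ ++ ν)) g)
    (λ i q → ev-cong (λ μ → i (Permₚ.++⁺ˡ μ q)) g)
    (λ F f → R.trans (ev-mul F g f) (ev-swap (λ μ ν → F (μ ++ ν)) g f))

  mul-comm : ∀ f g k → mul f (mul g k) ≋ mul g (mul f k)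
  mul-comm f g k = functionals λ F i → RR.begin
    ev F (mul f (mul g k))  RR.≈⟨ twice F f g ⟩
    ev (λ μ → ev (λ ν → ev (λ ρ → F (μ ++ (ν ++ ρ))) k) g) f  RR.≈⟨ ev-swap _ f g ⟩
    ev (λ ν → ev (λ μ → ev (λ ρ → F (μ ++ (ν ++ ρ))) k) f) g
      RR.≈⟨ ev-cong (λ ν → ev-cong (λ μ → ev-cong (λ ρ → i (Permₚ.shifts μ ν)) k) f) g ⟩
    ev (λ ν → ev (λ μ → ev (λ ρ → F (ν ++ (μ ++ ρ))) k) f) g  RR.≈⟨ twice F g f ⟨
    ev F (mul g (mul f k))  RR.∎
    where
    twice : ∀ F f g → ev F (mul f (mul g k)) ≃ ev (λ μ → ev (λ ν → ev (λ ρ → F (μ ++ (ν ++ ρ))) k) g) f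
    twice F f g = R.trans (ev-mul F f (mul g k)) (ev-cong (λ μ → ev-mul (λ ν → F (μ ++ ν)) g k) f)

  mul-+ : ∀ f g k → mul (f + g) k ≋ mul f k + mul g k
  mul-+ f g k = functionals λ F _ → R.trans (ev-mul F (f + g) k) (R.trans (ev-++ _ f g)
    (R.sym (R.trans (ev-++ F (mul f k) (mul g k)) (R.+-cong (ev-mul F f k) (ev-mul F g k)))))

  mul-• : ∀ c f k → mul (c • f) k ≋ c • mul f k
  mul-• c f k = functionals λ F _ → R.trans (ev-mul F (c • f) k) (R.trans (ev-scale _ c f)
    (R.sym (R.trans (ev-scale F c (mul f k)) (R.*-congˡ (ev-mul F f k)))))

  mul-mul : ∀ f g k → mul (mul f g) k ≋ mul f (mul g k)
  mul-mul f g k = functionals λ F _ → RR.begin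
    ev F (mul (mul f g) k)  RR.≈⟨ ev-mul F (mul f g) k ⟩
    ev (λ μ → ev (λ ρ → F (μ ++ ρ)) k) (mul f g)  RR.≈⟨ ev-mul _ f g ⟩
    ev (λ μ → ev (λ ν → ev (λ ρ → F ((μ ++ ν) ++ ρ)) k) g) f
      RR.≈⟨ ev-cong (λ μ → ev-cong (λ ν → ev-cong (λ ρ →
           R.reflexive (≡.cong F (Listₚ.++-assoc μ ν ρ))) k) g) f ⟩
    ev (λ μ → ev (λ ν → ev (λ ρ → F (μ ++ (ν ++ ρ))) k) g) f
      RR.≈⟨ R.trans (ev-mul F f (mul g k)) (ev-cong (λ μ → ev-mul (λ ν → F (μ ++ ν)) g k) f) ⟨
    ev F (mul f (mul g k))  RR.∎

  mul-one : ∀ f → mul one f ≋ f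
  mul-one f = functionals λ F _ → R.trans (ev-mul F one f) (R.trans (R.+-identityʳ _) (R.*-identityˡ _))

  -- The adjoints p_r^⊥ as derivations

  psum : (Mono → C) → List Mono → C
  psum F [] = 𝟘
  psum F (ν ∷ νs) = F ν ⊕ psum F νs

  psum-map : ∀ F x νs → psum F (map (x ∷_) νs) ≃ psum (λ ν → F (x ∷ ν)) νs
  psum-map F x [] = R.refl
  psum-map F x (ν ∷ νs) = R.+-congˡ (psum-map F x νs)

  psum-cong : ∀ {F G} → (∀ ν → F ν ≃ G ν) → ∀ νs → psum F νs ≃ psum G νs
  psum-cong e [] = R.refl
  psum-cong e (ν ∷ νs) = R.+-cong (e ν) (psum-cong e νs)

  removals : ℕ → (Mono → C) → Mono → C
  removals r F μ = psum F (remOcc r μ)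

  removals-∷ : ∀ r F x μ → removals r F (x ∷ μ) ≃
               (if x ≡ᵇ r then F μ else 𝟘) ⊕ removals r (λ ν → F (x ∷ ν)) μ
  removals-∷ r F x μ with x ≡ᵇ r
  ... | true = R.+-congˡ (psum-map F x (remOcc r μ))
  ... | false = R.trans (psum-map F x (remOcc r μ)) (R.sym (R.+-identityˡ _))

  private
    if-cong : ∀ b {x y : C} → x ≃ y → (if b then x else 𝟘) ≃ (if b then y else 𝟘)
    if-cong true e = e
    if-cong false e = R.refl

  -- A permutation of the parts permutes the ways to remove one. Without this, `perpOne` would not
  -- respect the equality of symmetric functions.
  removals-invariant : ∀ r {F} → Invariant F → Invariant (removals r F)
  removals-invariant r i Perm.refl = R.refl
  removals-invariant r {F} i (Perm.prep {xs} {ys} x q) = R.trans (removals-∷ r F x xs) (R.trans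
    (R.+-cong (if-cong (x ≡ᵇ r) (i q)) (removals-invariant r (λ q′ → i (Perm.prep x q′)) q))
    (R.sym (removals-∷ r F x ys)))
  removals-invariant r {F} i (Perm.swap {xs} {ys} x y q) = RR.begin
    removals r F (x ∷ y ∷ xs)  RR.≈⟨ expand x y xs ⟩
    X x (y ∷ xs) ⊕ (X y (x ∷ xs) ⊕ removals r (λ ν → F (x ∷ y ∷ ν)) xs)
      RR.≈⟨ R.trans (R.sym (R.+-assoc _ _ _)) (R.trans (R.+-congʳ (R.+-comm _ _)) (R.+-assoc _ _ _)) ⟩
    X y (x ∷ xs) ⊕ (X x (y ∷ xs) ⊕ removals r (λ ν → F (x ∷ y ∷ ν)) xs)
      RR.≈⟨ R.+-cong (if-cong (y ≡ᵇ r) (i (Perm.prep x q))) (R.+-cong (if-cong (x ≡ᵇ r) (i (Perm.prep y q)))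
           (R.trans (psum-cong (λ ν → i (Perm.swap x y Perm.refl)) (remOcc r xs))
             (removals-invariant r (λ q′ → i (Perm.prep y (Perm.prep x q′))) q))) ⟩
    X y (x ∷ ys) ⊕ (X x (y ∷ ys) ⊕ removals r (λ ν → F (y ∷ x ∷ ν)) ys)  RR.≈⟨ expand y x ys ⟨
    removals r F (y ∷ x ∷ ys)  RR.∎
    where
    X : ℕ → Mono → C
    X x μ = if x ≡ᵇ r then F μ else 𝟘
    expand : ∀ x y xs → removals r F (x ∷ y ∷ xs) ≃
             X x (y ∷ xs) ⊕ ((if y ≡ᵇ r then F (x ∷ xs) else 𝟘) ⊕ removals r (λ ν → F (x ∷ y ∷ ν)) xs)
    expand x y xs = R.trans (removals-∷ r F x (y ∷ xs)) (R.+-congˡ (removals-∷ r (λ ν → F (x ∷ ν)) y xs))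
  removals-invariant r i (Perm.trans q q′) = R.trans (removals-invariant r i q) (removals-invariant r i q′)

  -- The transpose of `perpOne r`.
  ∂ : ℕ → (Mono → C) → Mono → C
  ∂ r F μ = nat (suc r) ⊗ removals r F μ

  ev-perpOne : ∀ F r f → ev F (perpOne r f) ≃ ev (∂ r F) f
  ev-perpOne F r f = ev-concatMap _ F (∂ r F) (λ c μ → go c (remOcc r μ)) f
    where
    go : ∀ c νs → ev F (map (λ ν → (c ⊗ nat (suc r) , ν)) νs) ≃ c ⊗ (nat (suc r) ⊗ psum F νs)
    go c [] = R.sym (R.trans (R.*-congˡ (R.zeroʳ _)) (R.zeroʳ _))
    go c (ν ∷ νs) = R.trans (R.+-cong (R.*-assoc _ _ _) (go c νs))
      (R.trans (R.sym (R.distribˡ _ _ _)) (R.*-congˡ (R.sym (R.distribˡ _ _ _))))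

  perpOne-Lin : ∀ r → Lin (perpOne r)
  perpOne-Lin r = transpose⇒Lin (perpOne r) (∂ r) (λ i q → R.*-congˡ (removals-invariant r i q))
    (λ F f → ev-perpOne F r f)

  removals-• : ∀ r c F μ → removals r (λ ν → c ⊗ F ν) μ ≃ c ⊗ removals r F μ
  removals-• r c F μ = go (remOcc r μ)
    where
    go : ∀ νs → psum (λ ν → c ⊗ F ν) νs ≃ c ⊗ psum F νs
    go [] = R.sym (R.zeroʳ c)
    go (ν ∷ νs) = R.trans (R.+-congˡ (go νs)) (R.sym (R.distribˡ _ _ _))

  removals-+ : ∀ r F G μ → removals r (λ ν → F ν ⊕ G ν) μ ≃ removals r F μ ⊕ removals r G μ
  removals-+ r F G μ = go (remOcc r μ)
    where
    go : ∀ νs → psum (λ ν → F ν ⊕ G ν) νs ≃ psum F νs ⊕ psum G νs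
    go [] = R.sym (R.+-identityʳ _)
    go (ν ∷ νs) = R.trans (R.+-congˡ (go νs)) (R.trans (R.+-assoc _ _ _) (R.trans
      (R.+-congˡ (R.trans (R.sym (R.+-assoc _ _ _)) (R.trans (R.+-congʳ (R.+-comm _ _)) (R.+-assoc _ _ _))))
      (R.sym (R.+-assoc _ _ _))))

  removals-cong : ∀ r {F G} → (∀ ν → F ν ≃ G ν) → ∀ μ → removals r F μ ≃ removals r G μ
  removals-cong r e μ = psum-cong e (remOcc r μ)

  removals-comm : ∀ r s F μ → removals r (removals s F) μ ≃ removals s (removals r F) μ
  removals-comm r s F [] = R.refl
  removals-comm r s F (x ∷ μ) = RR.begin
    removals r (removals s F) (x ∷ μ)  RR.≈⟨ expand r s ⟩
    X r s ⊕ (X s r ⊕ removals r (removals s (λ ν → F (x ∷ ν))) μ)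
      RR.≈⟨ R.trans (R.sym (R.+-assoc _ _ _)) (R.trans (R.+-cong (R.+-comm _ _) (removals-comm r s _ μ)) (R.+-assoc _ _ _)) ⟩
    X s r ⊕ (X r s ⊕ removals s (removals r (λ ν → F (x ∷ ν))) μ)  RR.≈⟨ expand s r ⟨
    removals s (removals r F) (x ∷ μ)  RR.∎
    where
    X : ℕ → ℕ → C
    X r s = if x ≡ᵇ r then removals s F μ else 𝟘

    removals-if : ∀ r b (F : Mono → C) → removals r (λ ν → if b then F ν else 𝟘) μ ≃
                  (if b then removals r F μ else 𝟘)
    removals-if r true F = R.refl
    removals-if r false F = go (remOcc r μ)
      where
      go : ∀ νs → psum (λ _ → 𝟘) νs ≃ 𝟘
      go [] = R.refl
      go (ν ∷ νs) = R.trans (R.+-identityˡ _) (go νs)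

    expand : ∀ r s → removals r (removals s F) (x ∷ μ) ≃
             X r s ⊕ (X s r ⊕ removals r (removals s (λ ν → F (x ∷ ν))) μ)
    expand r s = R.trans (removals-∷ r (removals s F) x μ) (R.+-congˡ (R.trans
      (removals-cong r (λ ν → removals-∷ s F x ν) μ) (R.trans
      (removals-+ r (λ ν → if x ≡ᵇ s then F ν else 𝟘) (removals s (λ ν → F (x ∷ ν))) μ)
      (R.+-congʳ (removals-if r (x ≡ᵇ s) F)))))

  perpOne-comm : ∀ r s f → perpOne r (perpOne s f) ≋ perpOne s (perpOne r f)
  perpOne-comm r s f = functionals λ F i → RR.begin
    ev F (perpOne r (perpOne s f))  RR.≈⟨ R.trans (ev-perpOne F r (perpOne s f)) (ev-perpOne (∂ r F) s f) ⟩
    ev (∂ s (∂ r F)) f  RR.≈⟨ ev-cong (λ μ → ∂-comm F μ) f ⟩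
    ev (∂ r (∂ s F)) f  RR.≈⟨ R.trans (ev-perpOne F s (perpOne r f)) (ev-perpOne (∂ s F) r f) ⟨
    ev F (perpOne s (perpOne r f))  RR.∎
    where
    open import Algebra.Properties.CommutativeSemigroup R.*-commutativeSemigroup using (x∙yz≈y∙xz)
    ∂-comm : ∀ F μ → ∂ s (∂ r F) μ ≃ ∂ r (∂ s F) μ
    ∂-comm F μ = R.trans (R.*-congˡ (removals-• s _ (removals r F) μ)) (R.trans (x∙yz≈y∙xz _ _ _)
      (R.*-congˡ (R.trans (R.*-congˡ (removals-comm s r F μ)) (R.sym (removals-• r _ (removals s F) μ)))))

  δ : ℕ → ℕ → Sym → Sym
  δ r s f = if s ≡ᵇ r then nat (suc r) • f else []

  -- A part removed from s ∷ μ is either the head, which gives `δ`, or a part of μ.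
  heisenberg : ∀ r s f → perpOne r (mul (p s) f) ≋ mul (p s) (perpOne r f) + δ r s f
  heisenberg r s f = functionals λ F i → RR.begin
    ev F (perpOne r (mul (p s) f))  RR.≈⟨ R.trans (ev-perpOne F r (mul (p s) f)) (ev-p (∂ r F) f) ⟩
    ev (λ μ → ∂ r F (s ∷ μ)) f
      RR.≈⟨ ev-cong (λ μ → R.trans (R.*-congˡ (removals-∷ r F s μ)) (R.trans (R.distribˡ _ _ _) (R.+-comm _ _))) f ⟩
    ev (λ μ → ∂ r (λ ν → F (s ∷ ν)) μ ⊕ nat (suc r) ⊗ (if s ≡ᵇ r then F μ else 𝟘)) f  RR.≈⟨ ev-+ _ _ f ⟩
    ev (∂ r (λ ν → F (s ∷ ν))) f ⊕ ev (λ μ → nat (suc r) ⊗ (if s ≡ᵇ r then F μ else 𝟘)) f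
      RR.≈⟨ R.+-cong (R.sym (R.trans (ev-p F (perpOne r f)) (ev-perpOne _ r f))) (delta F (s ≡ᵇ r)) ⟩
    ev F (mul (p s) (perpOne r f)) ⊕ ev F (δ r s f)  RR.≈⟨ ev-++ F (mul (p s) (perpOne r f)) _ ⟨
    ev F (mul (p s) (perpOne r f) + δ r s f)  RR.∎
    where
    ev-p : ∀ F f → ev F (mul (p s) f) ≃ ev (λ μ → F (s ∷ μ)) f
    ev-p F f = R.trans (ev-mul F (p s) f) (R.trans (R.+-identityʳ _) (R.*-identityˡ _))

    delta : ∀ F b → ev (λ μ → nat (suc r) ⊗ (if b then F μ else 𝟘)) f ≃ ev F (if b then nat (suc r) • f else [])
    delta F true = R.trans (ev-* _ F f) (R.sym (ev-scale F _ f))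
    delta F false = R.trans (ev-cong (λ _ → R.zeroʳ _) f) (ev-zero f)

  -- From lists of raised indices to nested raising operators

  addAt-comm : ∀ a b d e v → addAt a d (addAt b e v) ≡ addAt b e (addAt a d v)
  addAt-comm a b d e [] = ≡.refl
  addAt-comm zero zero d e (x ∷ v) = ≡.cong (_∷ v) (≡.trans (ℤₚ.+-assoc x e d)
    (≡.trans (≡.cong (λ z → x ℤ.+ z) (ℤₚ.+-comm e d)) (≡.sym (ℤₚ.+-assoc x d e))))
  addAt-comm zero (suc b) d e (x ∷ v) = ≡.refl
  addAt-comm (suc a) zero d e (x ∷ v) = ≡.refl
  addAt-comm (suc a) (suc b) d e (x ∷ v) = ≡.cong (x ∷_) (addAt-comm a b d e v)

  raise : ℕ × ℕ → List (C × List ℤ) → List (C × List ℤ)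
  raise (a , b) ts =
    concatMap (λ { (c , v) → (c , v) ∷ (c ⊗ κ , addAt b (ℤ.- (+ 1)) (addAt a (+ 1) v)) ∷ [] }) ts

  Bseq : List ℤ → Sym → Sym
  Bseq [] f = f
  Bseq (n ∷ ns) f = B n (Bseq ns f)

  Bμ : List ℕ → Sym → Sym
  Bμ μ f = concatMap (λ { (c , v) → scale c (Bseq v f) })
                     (foldr raise ((𝟙 , map +_ μ) ∷ []) (pairs (List.length μ)))

  raiseAt : ℕ × ℕ → List ℤ → List ℤ
  raiseAt (a , b) v = addAt b (ℤ.- (+ 1)) (addAt a (+ 1) v)

  raiseAt-comm : ∀ q r v → raiseAt q (raiseAt r v) ≡ raiseAt r (raiseAt q v)
  raiseAt-comm (a , b) (c , d) v = ≡.trans (≡.cong (addAt b _) (addAt-comm a d _ _ _))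
    (≡.trans (addAt-comm b d _ _ _) (≡.cong (addAt d _) (≡.trans
      (≡.cong (addAt b _) (addAt-comm a c _ _ v)) (addAt-comm b c _ _ _))))

  raised : List (ℕ × ℕ) → (List ℤ → Sym) → List ℤ → Sym
  raised [] φ v = φ v
  raised (q ∷ qs) φ v = raised qs φ v + κ • raised qs φ (raiseAt q v)

  raised-+ : ∀ qs (φ χ : List ℤ → Sym) v → raised qs (λ v → φ v + κ • χ v) v ≋ raised qs φ v + κ • raised qs χ v
  raised-+ [] φ χ v = ≋-refl
  raised-+ (q ∷ qs) φ χ v = V.trans
    (+-cong (raised-+ qs φ χ v) (V.trans (•-congˡ (raised-+ qs φ χ (raiseAt q v)))
      (•-distribˡ κ (raised qs φ (raiseAt q v)) (κ • raised qs χ (raiseAt q v)))))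
    (V.trans (interchange (raised qs φ v) (κ • raised qs χ v) (κ • raised qs φ (raiseAt q v)) _)
      (+-cong ≋-refl (V.sym (•-distribˡ κ (raised qs χ v) (κ • raised qs χ (raiseAt q v))))))

  raised-shift : ∀ qs q (φ : List ℤ → Sym) v → raised qs (λ v → φ (raiseAt q v)) v ≡ raised qs φ (raiseAt q v)
  raised-shift [] q φ v = ≡.refl
  raised-shift (r ∷ qs) q φ v = ≡.cong₂ (λ x y → x + κ • y) (raised-shift qs q φ v)
    (≡.trans (raised-shift qs q φ (raiseAt r v)) (≡.cong (raised qs φ) (raiseAt-comm q r v)))

  combination : (List ℤ → Sym) → List (C × List ℤ) → Sym
  combination φ = concatMap (λ { (c , v) → scale c (φ v) })

  combination-cong : ∀ {φ χ : List ℤ → Sym} → (∀ v → φ v ≋ χ v) → ∀ ts → combination φ ts ≋ combination χ ts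
  combination-cong e [] = ≋-refl
  combination-cong e ((c , v) ∷ ts) = +-cong (•-congˡ (e v)) (combination-cong e ts)

  combination-raise : ∀ (φ : List ℤ → Sym) q ts →
    combination φ (raise q ts) ≋ combination (λ v → φ v + κ • φ (raiseAt q v)) ts
  combination-raise φ q [] = ≋-refl
  combination-raise φ q ((c , v) ∷ ts) = begin
    c • φ v + ((c ⊗ κ) • φ (raiseAt q v) + combination φ (raise q ts))
      ≈⟨ V.sym (V.assoc (c • φ v) _ _) ⟩
    (c • φ v + (c ⊗ κ) • φ (raiseAt q v)) + combination φ (raise q ts)
      ≈⟨ +-cong (V.trans (+-cong ≋-refl (•-assoc c κ (φ (raiseAt q v))))
           (V.sym (•-distribˡ c (φ v) (κ • φ (raiseAt q v))))) (combination-raise φ q ts) ⟩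
    c • (φ v + κ • φ (raiseAt q v)) + combination (λ v → φ v + κ • φ (raiseAt q v)) ts  ∎

  -- `foldr` applies the first pair last, whereas `raised` shifts by it first. The shifts commute,
  -- so both orders give the same sum.
  combination-foldr : ∀ (φ : List ℤ → Sym) qs ts →
    combination φ (foldr raise ts qs) ≋ combination (raised qs φ) ts
  combination-foldr φ [] ts = ≋-refl
  combination-foldr φ (q ∷ qs) ts = V.trans (combination-raise φ q (foldr raise ts qs)) (V.trans
    (combination-foldr (λ v → φ v + κ • φ (raiseAt q v)) qs ts)
    (combination-cong (λ v → V.trans (raised-+ qs φ (λ v → φ (raiseAt q v)) v)
      (+-cong ≋-refl (•-congˡ (V.reflexive (raised-shift qs q φ v))))) ts))

  raised-++ : ∀ qs rs (φ : List ℤ → Sym) v → raised (qs ++ rs) φ v ≡ raised qs (raised rs φ) v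
  raised-++ [] rs φ v = ≡.refl
  raised-++ (q ∷ qs) rs φ v = ≡.cong₂ (λ x y → x + κ • y) (raised-++ qs rs φ v) (raised-++ qs rs φ _)

  raised-suc : ∀ qs (φ : List ℤ → Sym) x v →
    raised (map (λ { (a , b) → (suc a , suc b) }) qs) φ (x ∷ v) ≡ raised qs (λ v → φ (x ∷ v)) v
  raised-suc [] φ x v = ≡.refl
  raised-suc (q ∷ qs) φ x v = ≡.cong₂ (λ y z → y + κ • z) (raised-suc qs φ x v) (raised-suc qs φ x _)

  private
    -- Reinserts an entry that the remaining factors of the first row do not touch. Raising
    -- preserves length, so the empty list is only a default case.
    second : ℤ → List ℤ → List ℤ
    second b [] = []
    second b (x ∷ v) = x ∷ b ∷ v

  raised-row-suc : ∀ is (φ : List ℤ → Sym) x b v →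
    raised (map (λ i → (0 , suc (suc i))) is) φ (x ∷ b ∷ v) ≡
    raised (map (λ i → (0 , suc i)) is) (λ w → φ (second b w)) (x ∷ v)
  raised-row-suc [] φ x b v = ≡.refl
  raised-row-suc (i ∷ is) φ x b v =
    ≡.cong₂ (λ y z → y + κ • z) (raised-row-suc is φ x b v) (raised-row-suc is φ _ b _)

  private module Raise = Raising V (κ •_) •-congˡ (•-distribˡ κ)
  open Raise using (couple; couple-cong; block; block-cong)

  raised-row : ∀ {n} x (v : Vec ℤ n) (φ : List ℤ → Sym) →
    raised (map (λ i → (0 , suc i)) (upTo n)) φ (x ∷ Vec.toList v) ≋
    couple x v (λ x v → φ (x ∷ Vec.toList v))
  raised-row x [] φ = ≋-refl
  raised-row {suc n} x (b ∷ v) φ = +-cong (step x b) (•-congˡ (step (up x) (down b)))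
    where
    step : ∀ x b → raised (map (λ i → (0 , suc i)) (applyUpTo suc n)) φ (x ∷ b ∷ Vec.toList v) ≋
           couple x v (λ x v → φ (x ∷ b ∷ Vec.toList v))
    step x b = V.trans (V.reflexive (≡.trans
      (≡.cong (λ qs → raised qs φ (x ∷ b ∷ Vec.toList v)) (≡.trans
        (≡.cong (map _) (≡.sym (Listₚ.map-upTo suc n))) (≡.sym (Listₚ.map-∘ (upTo n)))))
      (raised-row-suc (upTo n) φ x b (Vec.toList v))))
      (raised-row x v (λ w → φ (second b w)))

  pairs-suc : ∀ n → pairs (suc n) ≡
    map (λ i → (0 , suc i)) (upTo n) ++ map (λ { (a , b) → (suc a , suc b) }) (pairs n)
  pairs-suc n = ≡.cong (map (λ i → (0 , suc i)) (upTo n) ++_) (≡.trans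
    (≡.cong (concatMap row) (≡.sym (Listₚ.map-upTo suc n))) (go (upTo n)))
    where
    row row′ : ℕ → List (ℕ × ℕ)
    row a = map (λ i → (a , suc (a ℕ.+ i))) (upTo (suc n ℕ.∸ suc a))
    row′ a = map (λ i → (a , suc (a ℕ.+ i))) (upTo (n ℕ.∸ suc a))
    go : ∀ as → concatMap row (map suc as) ≡ map (λ { (a , b) → (suc a , suc b) }) (concatMap row′ as)
    go [] = ≡.refl
    go (a ∷ as) = ≡.trans (≡.cong₂ _++_ (Listₚ.map-∘ (upTo (n ℕ.∸ suc a))) (go as))
      (≡.sym (Listₚ.map-++ _ (row′ a) (concatMap row′ as)))

  -- `pairs` lists the factors of row 0 first and then those of the remaining rows, the order in
  -- which `block` recurses.
  raised-pairs : ∀ {n} (v : Vec ℤ n) (φ : List ℤ → Sym) →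
    raised (pairs n) φ (Vec.toList v) ≋ block v (λ v → φ (Vec.toList v))
  raised-pairs [] φ = ≋-refl
  raised-pairs {suc n} (x ∷ v) φ = begin
    raised (pairs (suc n)) φ (x ∷ Vec.toList v)
      ≈⟨ V.reflexive (≡.trans (≡.cong (λ qs → raised qs φ (x ∷ Vec.toList v)) (pairs-suc n))
           (raised-++ (map (λ i → (0 , suc i)) (upTo n)) _ φ _)) ⟩
    raised (map (λ i → (0 , suc i)) (upTo n)) (raised (map _ (pairs n)) φ) (x ∷ Vec.toList v)
      ≈⟨ raised-row x v (raised (map _ (pairs n)) φ) ⟩
    couple x v (λ x v → raised (map _ (pairs n)) φ (x ∷ Vec.toList v))
      ≈⟨ couple-cong x v (λ x v → V.trans (V.reflexive (raised-suc (pairs n) φ x (Vec.toList v)))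
           (raised-pairs v (λ w → φ (x ∷ w)))) ⟩
    block (x ∷ v) (λ v → φ (Vec.toList v))  ∎

  concatMap-applyUpTo : ∀ n (s : ℕ → ℕ) (φ : ℕ → Sym) → concatMap φ (applyUpTo s n) ≡ Σ< n (λ i → φ (s i))
  concatMap-applyUpTo zero s φ = ≡.refl
  concatMap-applyUpTo (suc n) s φ = ≡.cong (φ (s 0) ++_) (concatMap-applyUpTo n (λ i → s (suc i)) φ)

  -- General adjoints and degrees

  perpS-+ : ∀ g k f → perpS (g + k) f ≡ perpS g f + perpS k f
  perpS-+ g k f = Listₚ.concatMap-++ _ g k

  Lin-perpMono : ∀ λ' → Lin (perpMono λ')
  Lin-perpMono [] = record { cong = λ e → e ; add = λ _ _ → ≋-refl ; homogeneous = λ _ _ → ≋-refl }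
  Lin-perpMono (r ∷ λ') = ∘-Lin (perpOne-Lin r) (Lin-perpMono λ')

  perpS-Lin : ∀ g → Lin (perpS g)
  perpS-Lin [] = zero-Lin
  perpS-Lin ((c , λ') ∷ g) = +-Lin (•-Lin c (Lin-perpMono λ')) (perpS-Lin g)

  commute-perpMono : ∀ {L} → Lin L → (∀ r f → L (perpOne r f) ≋ perpOne r (L f)) →
                     ∀ λ' f → L (perpMono λ' f) ≋ perpMono λ' (L f)
  commute-perpMono l e [] f = ≋-refl
  commute-perpMono l e (r ∷ λ') f = V.trans (e r (perpMono λ' f)) (cong (perpOne-Lin r) (commute-perpMono l e λ' f))

  commute-perpS : ∀ {L} → Lin L → (∀ r f → L (perpOne r f) ≋ perpOne r (L f)) →
                  ∀ g f → L (perpS g f) ≋ perpS g (L f)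
  commute-perpS l e [] f = zero-image l
  commute-perpS l e ((c , λ') ∷ g) f = V.trans (add l (c • perpMono λ' f) (perpS g f)) (+-cong
    (V.trans (homogeneous l c (perpMono λ' f)) (•-congˡ (commute-perpMono l e λ' f))) (commute-perpS l e g f))

  perpOne-perpS : ∀ r g f → perpOne r (perpS g f) ≋ perpS g (perpOne r f)
  perpOne-perpS r = commute-perpS (perpOne-Lin r) (λ s f → perpOne-comm r s f)

  perpS-comm : ∀ g k f → perpS g (perpS k f) ≋ perpS k (perpS g f)
  perpS-comm g = commute-perpS (perpS-Lin g) (λ r f → V.sym (perpOne-perpS r g f))

  Below : ℕ → Sym → Set
  Below n f = LAll.All (λ x → weight (proj₂ x) ℕ.< n) f

  remOcc-weight : ∀ r μ → LAll.All (λ ν → weight ν ℕ.+ suc r ≡ weight μ) (remOcc r μ)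
  remOcc-weight r [] = []
  remOcc-weight r (x ∷ μ) = LAllₚ.++⁺ (this (x ≡ᵇ r) ≡.refl) (LAllₚ.map⁺ (LAll.map
    (λ {ν} e → ≡.trans (ℕₚ.+-assoc (suc x) (weight ν) (suc r)) (≡.cong (suc x ℕ.+_) e)) (remOcc-weight r μ)))
    where
    this : ∀ b → (x ≡ᵇ r) ≡ b →
           LAll.All (λ ν → weight ν ℕ.+ suc r ≡ suc x ℕ.+ weight μ) (if b then μ ∷ [] else [])
    this false e = []
    this true e with ℕₚ.≡ᵇ⇒≡ x r (≡.subst T (≡.sym e) tt)
    ... | ≡.refl = ℕₚ.+-comm (weight μ) (suc r) ∷ []

  perpOne-Below : ∀ r n f → Below (suc (r ℕ.+ n)) f → Below n (perpOne r f)
  perpOne-Below r n [] [] = []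
  perpOne-Below r n ((c , μ) ∷ f) (l ∷ ls) = LAllₚ.++⁺
    (LAllₚ.map⁺ (LAll.map (λ {ν} → lower ν) (remOcc-weight r μ))) (perpOne-Below r n f ls)
    where
    lower : ∀ ν → weight ν ℕ.+ suc r ≡ weight μ → weight ν ℕ.< n
    lower ν e = ℕₚ.+-cancelʳ-< (suc r) (weight ν) n
      (≡.subst₂ ℕ._<_ (≡.sym e) (≡.trans (≡.cong suc (ℕₚ.+-comm r n)) (≡.sym (ℕₚ.+-suc n r))) l)

  deg-Below : ∀ f i → suc (deg f) ℕ.≤ i → Below i f
  deg-Below [] i l = []
  deg-Below ((c , μ) ∷ f) i l =
    ℕₚ.≤-trans (s≤s (ℕₚ.m≤m+n (weight μ) (deg f))) l ∷
    deg-Below f i (ℕₚ.≤-trans (s≤s (ℕₚ.m≤n+m (deg f) (weight μ))) l)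

  -- The relations of h, its plethystic adjoint and B for symmetric functions

  module Laws
    (nat-suc : ∀ n → nat (suc n) ≃ 𝟙 ⊕ nat n) (nat-zero : nat 0 ≃ 𝟘)
    (inv-nat : ∀ n → inv (suc n) ⊗ nat (suc n) ≃ 𝟙)
    (τ-zero : τ 0 ⊕ (𝟙 ⊕ κ) ≃ 𝟘) (τ-suc : ∀ r → τ (suc r) ⊕ κ ⊗ τ r ≃ τ 0)
    (tfac-[] : tfac [] ≃ 𝟙) (tfac-∷ : ∀ r μ → tfac (r ∷ μ) ≃ τ r ⊗ tfac μ) where

    nat-inv : ∀ n f → nat (suc n) • inv (suc n) • f ≋ f
    nat-inv n f = V.trans (V.sym (•-assoc _ _ f)) (V.trans (•-cong (R.trans (R.*-comm _ _) (inv-nat n)) ≋-refl) (𝟙• f))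

    newton-h : ∀ n f → nat (suc n) • mul (h (suc n)) f ≋ ad n (λ a b → mul (p a) (mul (h b) f))
    newton-h n f = V.trans (•-congˡ (mul-• (inv (suc n)) (newtonAux 0 (hList n)) f))
      (V.trans (nat-inv n _) (aux 0 n))
      where
      aux : ∀ r n → mul (newtonAux r (hList n)) f ≋ ad n (λ a b → mul (p (r ℕ.+ a)) (mul (h b) f))
      aux r zero = V.trans (mul-+ (mul (p r) one) [] f) (V.trans (V.identityʳ _)
        (V.trans (mul-mul (p r) one f) (V.reflexive (≡.cong (λ k → mul (p k) (mul one f)) (≡.sym (ℕₚ.+-identityʳ r))))))
      aux r (suc n) = V.trans (mul-+ (mul (p r) (h (suc n))) (newtonAux (suc r) (hList n)) f) (+-cong
        (V.trans (mul-mul (p r) (h (suc n)) f)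
          (V.reflexive (≡.cong (λ k → mul (p k) (mul (h (suc n)) f)) (≡.sym (ℕₚ.+-identityʳ r)))))
        (V.trans (aux (suc r) n) (ad-cong n (λ a b _ →
          V.reflexive (≡.cong (λ k → mul (p k) (mul (h b) f)) (≡.sym (ℕₚ.+-suc r a)))))))

    pleth-+ : ∀ f g → pleth (f + g) ≡ pleth f + pleth g
    pleth-+ f g = Listₚ.map-++ _ f g

    perpS-pleth-• : ∀ c g f → perpS (pleth (c • g)) f ≋ c • perpS (pleth g) f
    perpS-pleth-• c [] f = ≋-refl
    perpS-pleth-• c ((d , λ') ∷ g) f = V.trans
      (+-cong (V.trans (•-cong (R.*-assoc _ _ _) ≋-refl) (•-assoc c (d ⊗ tfac λ') (perpMono λ' f)))
        (perpS-pleth-• c g f))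
      (V.sym (•-distribˡ c ((d ⊗ tfac λ') • perpMono λ' f) (perpS (pleth g) f)))

    perpS-pleth-p : ∀ r g f → perpS (pleth (mul (p r) g)) f ≋ τ r • perpOne r (perpS (pleth g) f)
    perpS-pleth-p r g f = V.trans (V.reflexive (≡.cong (λ k → perpS (pleth k) f) (Listₚ.++-identityʳ (map _ g)))) (go g)
      where
      go : ∀ g → perpS (pleth (map (λ { (d , ν) → (𝟙 ⊗ d , r ∷ ν) }) g)) f ≋ τ r • perpOne r (perpS (pleth g) f)
      go [] = V.sym (null-image (•-Lin (τ r) (perpOne-Lin r)) ≋-refl)
      go ((d , ν) ∷ g) = V.trans (+-cong
        (V.trans (•-cong coefficient ≋-refl) (V.trans (•-assoc (τ r) (d ⊗ tfac ν) _)
          (•-congˡ (V.sym (homogeneous (perpOne-Lin r) (d ⊗ tfac ν) (perpMono ν f))))))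
        (go g))
        (V.sym (add (•-Lin (τ r) (perpOne-Lin r)) ((d ⊗ tfac ν) • perpMono ν f) (perpS (pleth g) f)))
        where
        open import Algebra.Properties.CommutativeSemigroup R.*-commutativeSemigroup using (x∙yz≈y∙xz)
        coefficient : (𝟙 ⊗ d) ⊗ tfac (r ∷ ν) ≃ τ r ⊗ (d ⊗ tfac ν)
        coefficient = R.trans (R.*-cong (R.*-identityˡ d) (tfac-∷ r ν)) (x∙yz≈y∙xz d (τ r) (tfac ν))

    -- Newton's identity for h_(n+1), after the plethysm has multiplied each p_(a+1) by `τ a`, and
    -- passed to adjoints.
    newton-g : ∀ n f → nat (suc n) • perpS (pleth (h (suc n))) f ≋
               ad n (λ a b → τ a • perpOne a (perpS (pleth (h b)) f))
    newton-g n f = V.trans (•-congˡ (perpS-pleth-• (inv (suc n)) (newtonAux 0 (hList n)) f))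
      (V.trans (nat-inv n _) (aux 0 n))
      where
      X : ℕ → ℕ → Sym
      X a b = τ a • perpOne a (perpS (pleth (h b)) f)

      split : ∀ g k → perpS (pleth (g + k)) f ≋ perpS (pleth g) f + perpS (pleth k) f
      split g k = V.reflexive (≡.trans (≡.cong (λ z → perpS z f) (pleth-+ g k)) (perpS-+ (pleth g) (pleth k) f))

      aux : ∀ r n → perpS (pleth (newtonAux r (hList n))) f ≋ ad n (λ a b → X (r ℕ.+ a) b)
      aux r zero = V.trans (split (mul (p r) one) []) (V.trans (V.identityʳ _)
        (V.trans (perpS-pleth-p r one f) (V.reflexive (≡.cong (λ k → X k 0) (≡.sym (ℕₚ.+-identityʳ r))))))
      aux r (suc n) = V.trans (split (mul (p r) (h (suc n))) (newtonAux (suc r) (hList n))) (+-cong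
        (V.trans (perpS-pleth-p r (h (suc n)) f)
          (V.reflexive (≡.cong (λ k → X k (suc n)) (≡.sym (ℕₚ.+-identityʳ r)))))
        (V.trans (aux (suc r) n) (ad-cong n (λ a b _ →
          V.reflexive (≡.cong (λ k → X k b) (≡.sym (ℕₚ.+-suc r a)))))))

    g-0 : ∀ f → perpS (pleth (h 0)) f ≋ f
    g-0 f = V.trans (V.identityʳ _) (V.trans (•-cong (R.trans (R.*-identityˡ _) tfac-[]) ≋-refl) (𝟙• f))

    private
      open module Ops = Operators κ τ nat inv nat-suc nat-zero inv-nat τ-zero τ-suc
        (λ z → mul (hZ z)) (λ z → mul-Lin (hZ z)) mul-one (λ _ _ → ≋-refl)
        (λ i → perpS (pleth (h i))) (λ i → perpS-Lin (pleth (h i))) g-0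
        (λ r → mul (p r)) perpOne (λ r → mul-Lin (p r)) perpOne-Lin
        newton-h newton-g heisenberg (λ r i → perpOne-perpS r (pleth (h i)))
        using (nat-cancel; module VertexOperators)

    -- In the Newton recursion the factor p_(a+1)^⊥ lowers the weight by a + 1, just as the index
    -- falls from i to i - a - 1. This is what makes the sum defining B stop at the degree.
    g-Below : ∀ i f → Below i f → perpS (pleth (h i)) f ≋ []
    g-Below = <-rec _ step
      where
      step : ∀ i → (∀ {j} → j ℕ.< i → ∀ f → Below j f → perpS (pleth (h j)) f ≋ []) →
             ∀ f → Below i f → perpS (pleth (h i)) f ≋ []
      step zero rec [] [] = zero-image (perpS-Lin (pleth (h 0)))
      step (suc i) rec f below = nat-cancel i (V.trans (newton-g i f) (V.trans
        (zero-sum i λ a b e → null-image (•-Lin (τ a) id-Lin) (V.trans (perpOne-perpS a (pleth (h b)) f)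
          (rec (s≤s (≡.subst (b ℕ.≤_) e (ℕₚ.m≤n+m b a))) (perpOne a f)
            (perpOne-Below a b f (≡.subst (λ k → Below (suc k) f) (≡.sym e) below)))))
        (V.sym (null-image (•-Lin (nat (suc i)) id-Lin) ≋-refl))))
        where
        zero-sum : ∀ n {φ : ℕ → ℕ → Sym} → (∀ a b → a ℕ.+ b ≡ n → φ a b ≋ []) → ad n φ ≋ []
        zero-sum zero e = e 0 0 ≡.refl
        zero-sum (suc n) e = +-cong (e 0 (suc n) ≡.refl) (zero-sum n (λ a b q → e (suc a) b (≡.cong suc q)))

    open VertexOperators (λ y z → mul-comm (hZ y) (hZ z)) (λ i j → perpS-comm (pleth (h i)) (pleth (h j)))
      (λ f → suc (deg f)) (λ f i l → g-Below i f (deg-Below f i l)) B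
      (λ n f → V.reflexive (concatMap-applyUpTo (suc (deg f)) (λ i → i) _))
      public using (B-Lin; B-exchange)

    -- On `one`, of degree 0, only the summand i = 0 is present, and there h has a negative index.
    B-one-neg : ∀ m → B -[1+ m ] one ≋ []
    B-one-neg m = ≋-refl

    B-one-0 : B (+ 0) one ≋ one
    B-one-0 = V.trans (V.identityʳ _) (V.trans (mul-one _) (g-0 one))

    open module Raise′ = Raising V (κ •_) •-congˡ (•-distribˡ κ) public
      using (Linear; module Straightening)

    halve : ∀ {f} → f + f ≋ [] → f ≋ []
    halve {f} e = nat-cancel 1 (V.trans (V.trans (•-cong two ≋-refl) (V.trans (•-distribʳ 𝟙 𝟙 f)
      (V.trans (+-cong (𝟙• f) (𝟙• f)) e))) (V.sym (null-image (•-Lin (nat 2) id-Lin) ≋-refl)))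
      where
      two : nat 2 ≃ 𝟙 ⊕ 𝟙
      two = R.trans (nat-suc 1) (R.+-congˡ (R.trans (nat-suc 0) (R.trans (R.+-congˡ nat-zero) (R.+-identityʳ 𝟙))))

    B-Linear : ∀ n → Linear (B n)
    B-Linear n = record { cong = cong (B-Lin n) ; add = add (B-Lin n) ; scale = homogeneous (B-Lin n) κ }

    open Straightening halve public
    open Blocks B B-Linear B-exchange public

    Bseq-word : ∀ {n} (v : Vec ℤ n) f → Bseq (Vec.toList v) f ≡ word v f
    Bseq-word [] f = ≡.refl
    Bseq-word (x ∷ v) f = ≡.cong (B x) (Bseq-word v f)

    Bμ-toList : ∀ {n} (v : Vec ℕ n) f → Bμ (Vec.toList v) f ≋ Block (Vec.map +_ v) f
    Bμ-toList {n} v f = V.trans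
      (V.reflexive (≡.cong₂ (λ k w → combination (λ v → Bseq v f) (foldr raise ((𝟙 , w) ∷ []) (pairs k)))
        (Vecₚ.length-toList v) (≡.sym (Vecₚ.toList-map +_ v))))
      (V.trans (combination-foldr (λ v → Bseq v f) (pairs n) ((𝟙 , Vec.toList (Vec.map +_ v)) ∷ []))
        (V.trans (V.identityʳ _) (V.trans (𝟙• _)
          (V.trans (raised-pairs (Vec.map +_ v) (λ v → Bseq v f))
            (block-cong (Vec.map +_ v) (λ v → V.reflexive (Bseq-word v f)))))))

    Bμ-Block : ∀ μ f → Bμ μ f ≋ Block (Vec.map +_ (Vec.fromList μ)) f
    Bμ-Block μ f = V.trans (V.reflexive (≡.cong (λ ν → Bμ ν f) (≡.sym (Vecₚ.toList∘fromList μ))))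
                           (Bμ-toList (Vec.fromList μ) f)

    Bμ-cong : ∀ μ {f g} → f ≋ g → Bμ μ f ≋ Bμ μ g
    Bμ-cong μ {f} {g} e = V.trans (Bμ-Block μ f)
      (V.trans (Linear.cong (Block-linear (Vec.map +_ (Vec.fromList μ))) e) (V.sym (Bμ-Block μ g)))

    -- Trailing zeros in an index

    coupleColumn-negative : ∀ {n} (v : Vec ℤ n) m {θ : Vec ℤ n → ℤ → Sym} →
      (∀ v m → θ v -[1+ m ] ≋ []) → Raise′.coupleColumn v -[1+ m ] θ ≋ []
    coupleColumn-negative [] m e = e [] m
    coupleColumn-negative (a ∷ v) m e = +-cong (coupleColumn-negative v m (λ v → e (a ∷ v)))
      (null-image (•-Lin κ id-Lin) (coupleColumn-negative v (suc (m ℕ.+ 0)) (λ v → e (up a ∷ v))))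

    coupleColumn-zero : ∀ {n} (v : Vec ℤ n) (θ : Vec ℤ n → ℤ → Sym) →
      (∀ v m → θ v -[1+ m ] ≋ []) → Raise′.coupleColumn v (+ 0) θ ≋ θ v (+ 0)
    coupleColumn-zero [] θ e = ≋-refl
    coupleColumn-zero (a ∷ v) θ e = V.trans (+-cong (coupleColumn-zero v (λ v → θ (a ∷ v)) (λ v → e (a ∷ v)))
      (null-image (•-Lin κ id-Lin) (coupleColumn-negative v 0 (λ v → e (up a ∷ v))))) (V.identityʳ _)

    -- Every raising against the final 0 makes it negative and kills `one`; the unraised term ends
    -- with B_0, which fixes `one`.
    Block-snoc-zero : ∀ {n} (v : Vec ℤ n) → Block (v ++ᵛ (+ 0) ∷ []) one ≋ Block v one
    Block-snoc-zero v = V.trans (Block-++ v ((+ 0) ∷ []) one) (V.trans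
      (Raise′.coupleAll-∷ v (+ 0) [] (λ v w → Block v (Block w one))) (V.trans
      (Raise′.coupleColumn-cong v (+ 0) (λ v b → ≋-coupleAll-[] v b)) (V.trans
      (coupleColumn-zero v (λ v b → Block v (B b one)) (λ v m → vanish v m))
      (Linear.cong (Block-linear v) B-one-0))))
      where
      ≋-coupleAll-[] : ∀ {m} (v : Vec ℤ m) b {φ : Vec ℤ m → Vec ℤ 0 → Sym} →
                       Raise′.coupleAll v [] φ ≋ φ v []
      ≋-coupleAll-[] [] b = ≋-refl
      ≋-coupleAll-[] (a ∷ v) b = ≋-coupleAll-[] v b
      vanish : ∀ v m → Block v (B -[1+ m ] one) ≋ []
      vanish v m = V.trans (Linear.cong (Block-linear v) (B-one-neg m)) (Raise′.linear-0 (Block-linear v))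

    -- Allows a short last block to be treated as one with the full number of rows, and zeros
    -- created by straightening to be discarded.
    Bμ-trailing-zeros : ∀ μ r → Bμ (μ ++ List.replicate r 0) one ≋ Bμ μ one
    Bμ-trailing-zeros μ zero = V.reflexive (≡.cong (λ ν → Bμ ν one) (Listₚ.++-identityʳ μ))
    Bμ-trailing-zeros μ (suc r) = V.trans
      (V.reflexive (≡.cong (λ ν → Bμ ν one) (≡.sym (Listₚ.++-assoc μ (0 ∷ []) (List.replicate r 0)))))
      (V.trans (Bμ-trailing-zeros (μ ++ 0 ∷ []) r) snoc)
      where
      v : Vec ℕ (List.length μ)
      v = Vec.fromList μ

      snoc : Bμ (μ ++ 0 ∷ []) one ≋ Bμ μ one
      snoc = begin
        Bμ (μ ++ 0 ∷ []) one
          ≈⟨ V.reflexive (≡.cong (λ ν → Bμ ν one) (≡.trans (≡.cong (_++ 0 ∷ []) (≡.sym (Vecₚ.toList∘fromList μ)))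
               (≡.sym (Vecₚ.toList-++ v (0 ∷ []))))) ⟩
        Bμ (Vec.toList (v ++ᵛ 0 ∷ [])) one  ≈⟨ Bμ-toList (v ++ᵛ 0 ∷ []) one ⟩
        Block (Vec.map +_ (v ++ᵛ 0 ∷ [])) one
          ≈⟨ V.reflexive (≡.cong (λ w → Block w one) (Vecₚ.map-++ +_ v (0 ∷ []))) ⟩
        Block (Vec.map +_ v ++ᵛ (+ 0) ∷ []) one  ≈⟨ Block-snoc-zero (Vec.map +_ v) ⟩
        Block (Vec.map +_ v) one  ≈⟨ Bμ-Block μ one ⟨
        Bμ μ one  ∎

    -- k-split polynomials and their spans

    Gfuel : ℕ → ℕ → List ℕ → Sym
    Gfuel k zero _ = one
    Gfuel k (suc n) [] = one
    Gfuel k (suc n) (m ∷ ms) =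
      Bμ (take (suc (k ℕ.∸ m)) (m ∷ ms)) (Gfuel k n (drop (suc (k ℕ.∸ m)) (m ∷ ms)))

    G : ℕ → List ℕ → Sym
    G k μ = Gfuel k (List.length μ) μ

    -- Each step consumes at least one row, so fuel beyond the length has no effect; `G-∷` is then
    -- the recursion by blocks free of fuel.
    Gfuel-enough : ∀ k n n′ μ → List.length μ ℕ.≤ n → List.length μ ℕ.≤ n′ → Gfuel k n μ ≡ Gfuel k n′ μ
    Gfuel-enough k zero zero [] l l′ = ≡.refl
    Gfuel-enough k zero (suc n′) [] l l′ = ≡.refl
    Gfuel-enough k (suc n) zero [] l l′ = ≡.refl
    Gfuel-enough k (suc n) (suc n′) [] l l′ = ≡.refl
    Gfuel-enough k (suc n) (suc n′) (m ∷ ms) (s≤s l) (s≤s l′) = ≡.cong (Bμ (m ∷ take (k ℕ.∸ m) ms))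
      (Gfuel-enough k n n′ (drop (k ℕ.∸ m) ms) (ℕₚ.≤-trans shorter l) (ℕₚ.≤-trans shorter l′))
      where
      shorter : List.length (drop (k ℕ.∸ m) ms) ℕ.≤ List.length ms
      shorter = ℕₚ.≤-trans (ℕₚ.≤-reflexive (Listₚ.length-drop (k ℕ.∸ m) ms)) (ℕₚ.m∸n≤m _ (k ℕ.∸ m))

    G-∷ : ∀ k m ms → G k (m ∷ ms) ≡ Bμ (m ∷ take (k ℕ.∸ m) ms) (G k (drop (k ℕ.∸ m) ms))
    G-∷ k m ms = ≡.cong (Bμ (m ∷ take (k ℕ.∸ m) ms)) (Gfuel-enough k (List.length ms) _ (drop (k ℕ.∸ m) ms)
      (ℕₚ.≤-trans (ℕₚ.≤-reflexive (Listₚ.length-drop (k ℕ.∸ m) ms)) (ℕₚ.m∸n≤m _ (k ℕ.∸ m))) ℕₚ.≤-refl)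

    -- β is a first block of the k-split of β ++ ν, either complete or followed by nothing.
    IsBlock : ℕ → List ℕ → List ℕ → Set
    IsBlock k [] ν = ⊥
    IsBlock k (b ∷ β) ν = List.length β ≡ k ℕ.∸ b ⊎ (List.length β ℕ.≤ k ℕ.∸ b × ν ≡ [])

    G-++ : ∀ k β ν → IsBlock k β ν → G k (β ++ ν) ≡ Bμ β (G k ν)
    G-++ k (b ∷ β) ν block = ≡.trans (G-∷ k b (β ++ ν))
      (≡.cong₂ (λ x y → Bμ (b ∷ x) (G k y)) (proj₁ (split β (k ℕ.∸ b) block)) (proj₂ (split β (k ℕ.∸ b) block)))
      where
      split : ∀ β n → List.length β ≡ n ⊎ (List.length β ℕ.≤ n × ν ≡ []) →
              take n (β ++ ν) ≡ β × drop n (β ++ ν) ≡ ν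
      split [] n (inj₁ ≡.refl) = ≡.refl , ≡.refl
      split [] zero (inj₂ (_ , ≡.refl)) = ≡.refl , ≡.refl
      split [] (suc n) (inj₂ (_ , ≡.refl)) = ≡.refl , ≡.refl
      split (x ∷ β) (suc n) (inj₁ e) with split β n (inj₁ (ℕₚ.suc-injective e))
      ... | p , q = ≡.cong (x ∷_) p , q
      split (x ∷ β) (suc n) (inj₂ (s≤s l , e)) with split β n (inj₂ (l , e))
      ... | p , q = ≡.cong (x ∷_) p , q

    Admissible : ℕ → ℕ → List ℕ → Set
    Admissible k j μ = IsPartition μ × LAll.All (ℕ._≤ k) μ × headOr0 μ ≡ j

    span : ℕ → List (C × List ℕ) → Sym
    span k = concatMap (λ { (c , μ) → scale c (G k μ) })

    record Ω (k j : ℕ) (f : Sym) : Set where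
      constructor spanned
      field
        terms : List (C × List ℕ)
        admissible : LAll.All (λ w → Admissible k j (proj₂ w)) terms
        equal : f ≋ span k terms

    Ω-G : ∀ k j μ → Admissible k j μ → Ω k j (G k μ)
    Ω-G k j μ a = spanned ((𝟙 , μ) ∷ []) (a ∷ []) (V.sym (V.trans (V.identityʳ _) (𝟙• (G k μ))))

    Ω-resp : ∀ {k j f g} → f ≋ g → Ω k j f → Ω k j g
    Ω-resp e (spanned ws a q) = spanned ws a (V.trans (V.sym e) q)

    Ω-• : ∀ {k j f} c → Ω k j f → Ω k j (c • f)
    Ω-• {k} c (spanned ws a q) = spanned (map (λ { (d , μ) → (c ⊗ d , μ) }) ws) (LAllₚ.map⁺ a)
      (V.trans (•-congˡ q) (distribute ws))
      where
      distribute : ∀ ws → c • span k ws ≋ span k (map (λ { (d , μ) → (c ⊗ d , μ) }) ws)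
      distribute [] = ≋-refl
      distribute ((d , μ) ∷ ws) = V.trans (•-distribˡ c (d • G k μ) (span k ws))
        (+-cong (V.sym (•-assoc c d (G k μ))) (distribute ws))

    Ω-+ : ∀ {k j f g} → Ω k j f → Ω k j g → Ω k j (f + g)
    Ω-+ {k} (spanned ws a q) (spanned ws′ a′ q′) = spanned (ws ++ ws′) (LAllₚ.++⁺ a a′)
      (V.trans (+-cong q q′) (V.reflexive (≡.sym (Listₚ.concatMap-++ _ ws ws′))))

    Ω-closed : ∀ k j → Closed (Ω k j)
    Ω-closed k j = record
      { resp = Ω-resp
      ; zero-closed = spanned [] [] ≋-refl
      ; sum-closed = Ω-+
      ; ν-closed = Ω-• κ
      ; neg-closed = Ω-• (R.- 𝟙)
      }

    Ω-image : ∀ {L} → Lin L → ∀ {k i j f} → Ω k i f →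
              (∀ μ → Admissible k i μ → Ω k j (L (G k μ))) → Ω k j (L f)
    Ω-image {L} l {k} {i} {j} (spanned ws a q) s = Ω-resp (V.sym (cong l q)) (go ws a)
      where
      go : ∀ ws → LAll.All (λ w → Admissible k i (proj₂ w)) ws → Ω k j (L (span k ws))
      go [] [] = Ω-resp (V.sym (zero-image l)) (spanned [] [] ≋-refl)
      go ((c , μ) ∷ ws) (a ∷ as) = Ω-resp
        (V.sym (V.trans (add l (c • G k μ) (span k ws)) (+-cong (homogeneous l c (G k μ)) ≋-refl)))
        (Ω-+ (Ω-• c (s μ a)) (go ws as))

    Block-Lin : ∀ {n} (v : Vec ℤ n) → Lin (Block v)
    Block-Lin v = record
      { cong = Linear.cong (Block-linear v)
      ; add = Linear.add (Block-linear v)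
      ; homogeneous = λ c f → V.trans (block-cong v (λ w → homogeneous (word-Lin w) c f))
          (V.sym (Raise′.block-linear (•-Linear c) v (λ w → word w f)))
      }
      where
      word-Lin : ∀ {n} (w : Vec ℤ n) → Lin (word w)
      word-Lin [] = id-Lin
      word-Lin (x ∷ w) = ∘-Lin (B-Lin x) (word-Lin w)
      •-Linear : ∀ c → Linear (c •_)
      •-Linear c = record { cong = •-congˡ ; add = •-distribˡ c ; scale = λ f → •-comm c κ f }

    naturals : ∀ {n} (v : Vec ℤ n) → VAll.All ((+ 0) ℤ.≤_) v → Σ (Vec ℕ n) (λ w → v ≡ Vec.map +_ w)
    naturals [] [] = [] , ≡.refl
    naturals ((+ m) ∷ v) (_ ∷ ps) with naturals v ps
    ... | w , e = m ∷ w , ≡.cong ((+ m) ∷_) e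

    all-toList : ∀ {P : ℤ → Set} {Q : ℕ → Set} → (∀ m → P (+ m) → Q m) →
                 ∀ {n} (w : Vec ℕ n) → VAll.All P (Vec.map +_ w) → LAll.All Q (Vec.toList w)
    all-toList f [] [] = []
    all-toList f (m ∷ w) (q ∷ qs) = f m q ∷ all-toList f w qs

    pairs-toList : ∀ {n} (w : Vec ℕ n) → Descending (Vec.map +_ w) → AllPairs ℕ._≥_ (Vec.toList w)
    pairs-toList [] _ = []
    pairs-toList (m ∷ w) (q , qs) = all-toList (λ _ → ℤₚ.drop‿+≤+) w q ∷ pairs-toList w qs

    head-max : ∀ {μ} → AllPairs ℕ._≥_ μ → LAll.All (ℕ._≤ headOr0 μ) μ
    head-max [] = []
    head-max (q ∷ qs) = ℕₚ.≤-refl ∷ q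

    admissible-++ : ∀ {k h} b β ν → LAll.All (1 ℕ.≤_) (b ∷ β) → AllPairs ℕ._≥_ (b ∷ β) →
      LAll.All (ℕ._≤ k) (b ∷ β) → LAll.All (h ℕ.≤_) (b ∷ β) → Admissible k h ν → Admissible k b (b ∷ β ++ ν)
    admissible-++ b β ν pos desc small above ((pos′ , desc′) , small′ , ≡.refl) =
      (LAllₚ.++⁺ pos pos′ , Linkedₚ.AllPairs⇒Linked (AllPairsₚ.++⁺ desc pairs-ν
        (LAll.map (λ h≤x → LAll.map (λ y≤h → ℕₚ.≤-trans y≤h h≤x) (head-max pairs-ν)) above))) ,
      LAllₚ.++⁺ small small′ , ≡.refl
      where
      pairs-ν : AllPairs ℕ._≥_ ν
      pairs-ν = Linkedₚ.Linked⇒AllPairs (λ p q → ℕₚ.≤-trans q p) desc′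

    -- Blocks of fixed length: removing and adding zeros

    -- A straightened index may end in zeros, which a partition must not contain.
    strip-zeros : ∀ γ → AllPairs ℕ._≥_ γ →
      Σ (List ℕ) λ γ⁺ → Σ ℕ λ r → γ ≡ γ⁺ ++ List.replicate r 0 × LAll.All (1 ℕ.≤_) γ⁺
    strip-zeros [] [] = [] , 0 , ≡.refl , []
    strip-zeros (zero ∷ γ) (q ∷ qs) = [] , suc (List.length γ) , ≡.cong (0 ∷_) (zeros γ q) , []
      where
      zeros : ∀ γ → LAll.All (ℕ._≤ 0) γ → γ ≡ List.replicate (List.length γ) 0
      zeros [] [] = ≡.refl
      zeros (zero ∷ γ) (_ ∷ qs) = ≡.cong (0 ∷_) (zeros γ qs)
    strip-zeros (suc g ∷ γ) (q ∷ qs) with strip-zeros γ qs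
    ... | γ⁺ , r , e , pos = suc g ∷ γ⁺ , r , ≡.cong (suc g ∷_) e , s≤s z≤n ∷ pos

    pad : ∀ n → List ℕ → Vec ℕ n
    pad zero _ = []
    pad (suc n) [] = 0 ∷ pad n []
    pad (suc n) (m ∷ μ) = m ∷ pad n μ

    toList-pad : ∀ n μ → Vec.toList (pad n μ) ≡ take n μ ++ List.replicate (n ℕ.∸ List.length μ) 0
    toList-pad zero [] = ≡.refl
    toList-pad zero (m ∷ μ) = ≡.refl
    toList-pad (suc n) [] = ≡.cong (0 ∷_) (≡.trans (toList-pad n []) (≡.cong (_++ List.replicate n 0) (Listₚ.take-[] n)))
    toList-pad (suc n) (m ∷ μ) = ≡.cong (m ∷_) (toList-pad n μ)

    drop-all : ∀ n (μ : List ℕ) → List.length μ ℕ.≤ n → drop n μ ≡ []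
    drop-all zero [] l = ≡.refl
    drop-all (suc n) [] l = ≡.refl
    drop-all (suc n) (m ∷ μ) (s≤s l) = drop-all n μ l

    -- Zeros are added only if μ has fewer than n rows; then nothing is left after the block, and
    -- the operator acts on `one`.
    Bμ-pad : ∀ k n μ → Bμ (take n μ) (G k (drop n μ)) ≋ Block (Vec.map +_ (pad n μ)) (G k (drop n μ))
    Bμ-pad k n μ = V.trans (V.sym padded) (Bμ-toList (pad n μ) (G k (drop n μ)))
      where
      padded : Bμ (Vec.toList (pad n μ)) (G k (drop n μ)) ≋ Bμ (take n μ) (G k (drop n μ))
      padded with ℕₚ.≤-total n (List.length μ)
      ... | inj₁ l = V.reflexive (≡.cong (λ ν → Bμ ν (G k (drop n μ))) (≡.trans (toList-pad n μ)
              (≡.trans (≡.cong (λ r → take n μ ++ List.replicate r 0) (ℕₚ.m≤n⇒m∸n≡0 l))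
                (Listₚ.++-identityʳ (take n μ)))))
      ... | inj₂ l = ≡.subst (λ ν → Bμ (Vec.toList (pad n μ)) (G k ν) ≋ Bμ (take n μ) (G k ν))
              (≡.sym (drop-all n μ l))
              (V.trans (V.reflexive (≡.cong (λ ν → Bμ ν one) (toList-pad n μ)))
                (Bμ-trailing-zeros (take n μ) (n ℕ.∸ List.length μ)))

    pad-all : ∀ {P : ℤ → Set} → P (+ 0) → ∀ n μ → LAll.All (λ m → P (+ m)) μ → VAll.All P (Vec.map +_ (pad n μ))
    pad-all z zero μ qs = []
    pad-all z (suc n) [] [] = z ∷ pad-all z n [] []
    pad-all z (suc n) (m ∷ μ) (q ∷ qs) = q ∷ pad-all z n μ qs

    pad-descending : ∀ n μ → AllPairs ℕ._≥_ μ → Descending (Vec.map +_ (pad n μ))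
    pad-descending zero μ qs = tt
    pad-descending (suc n) [] [] = pad-all ℤₚ.≤-refl n [] [] , pad-descending n [] []
    pad-descending (suc n) (m ∷ μ) (q ∷ qs) =
      pad-all (ℤ.+≤+ z≤n) n μ (LAll.map ℤ.+≤+ q) , pad-descending n μ qs

    -- When zeros have been added the rest is empty and its first part counts as 0, so the bound
    -- persists.
    pad-above : ∀ n μ → AllPairs ℕ._≥_ μ → VAll.All ((+ headOr0 (drop n μ)) ℤ.≤_) (Vec.map +_ (pad n μ))
    pad-above zero μ qs = []
    pad-above (suc n) [] [] = ℤₚ.≤-refl ∷ ≡.subst (λ ν → VAll.All ((+ headOr0 ν) ℤ.≤_) (Vec.map +_ (pad n [])))
      (drop-all n [] z≤n) (pad-above n [] [])
    pad-above (suc n) (m ∷ μ) (q ∷ qs) = ℤ.+≤+ (below (drop n μ) (LAllₚ.drop⁺ n q)) ∷ pad-above n μ qs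
      where
      below : ∀ ν → LAll.All (ℕ._≤ m) ν → headOr0 ν ℕ.≤ m
      below [] [] = z≤n
      below (x ∷ ν) (l ∷ _) = l

    pointwise-above : ∀ {n b} {u α : Vec ℤ n} → VAll.All (b ℤ.≤_) u → Pointwise ℤ._≤_ u α → VAll.All (b ℤ.≤_) α
    pointwise-above [] [] = []
    pointwise-above (q ∷ qs) (l ∷ ls) = ℤₚ.≤-trans q l ∷ pointwise-above qs ls

    all-equal : ∀ {ℓ} γ → LAll.All (ℓ ℕ.≤_) γ → LAll.All (ℕ._≤ ℓ) γ → γ ≡ List.replicate (List.length γ) ℓ
    all-equal [] [] [] = ≡.refl
    all-equal (x ∷ γ) (p ∷ ps) (q ∷ qs) = ≡.cong₂ _∷_ (ℕₚ.≤-antisym q p) (all-equal γ ps qs)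

    pairs-replicate : ∀ {ℓ} n → AllPairs ℕ._≥_ (List.replicate n ℓ)
    pairs-replicate zero = []
    pairs-replicate (suc n) = LAllₚ.replicate⁺ n ℕₚ.≤-refl ∷ pairs-replicate n

    -- The induction along the k-split

    module MainInduction (k ℓ : ℕ) (1≤ℓ : 1 ℕ.≤ ℓ) (ℓ≤k : ℓ ℕ.≤ k) where

      rect-∷ : rect k ℓ ≡ ℓ ∷ List.replicate (k ℕ.∸ ℓ) ℓ
      rect-∷ = ≡.cong (λ n → List.replicate n ℓ) (ℕₚ.+-∸-assoc 1 ℓ≤k)

      -- The rectangle has main hook-length ℓ + (k + 1 - ℓ) - 1 = k, so in front of parts of size at
      -- most ℓ it is a complete first block.
      prepend-rect : ∀ j μ → j ℕ.≤ ℓ → Admissible k j μ → Ω k ℓ (Bμ (rect k ℓ) (G k μ))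
      prepend-rect j μ j≤ℓ a = ≡.subst (λ ν → Ω k ℓ (Bμ ν (G k μ))) (≡.sym rect-∷) (Ω-resp
        (V.reflexive (G-++ k (ℓ ∷ List.replicate (k ℕ.∸ ℓ) ℓ) μ (inj₁ (Listₚ.length-replicate (k ℕ.∸ ℓ)))))
        (Ω-G k ℓ _ (admissible-++ ℓ (List.replicate (k ℕ.∸ ℓ) ℓ) μ
          (LAllₚ.replicate⁺ (suc (k ℕ.∸ ℓ)) 1≤ℓ) (pairs-replicate (suc (k ℕ.∸ ℓ)))
          (LAllₚ.replicate⁺ (suc (k ℕ.∸ ℓ)) ℓ≤k) (LAllₚ.replicate⁺ (suc (k ℕ.∸ ℓ)) j≤ℓ) a)))

      module Exchanging (d : ℕ) (j≤k : ℓ ℕ.+ suc d ℕ.≤ k) (ms : List ℕ)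
        (a : Admissible k (ℓ ℕ.+ suc d) (ℓ ℕ.+ suc d ∷ ms)) where

        j n : ℕ
        j = ℓ ℕ.+ suc d
        n = suc (k ℕ.∸ j)
        μ rest : List ℕ
        μ = j ∷ ms
        rest = drop (k ℕ.∸ j) ms

        u : Vec ℤ n
        u = Vec.map +_ (pad n μ)

        top : up^ (suc d) (+ ℓ) ≡ + j
        top = up^≡+ (suc d) (+ ℓ)

        -- The right factor has as many rows as a complete block with first part ℓ, which is why the
        -- exchange produces k-split polynomials again.
        size : suc d ℕ.+ n ≡ suc (k ℕ.∸ ℓ)
        size = ≡.trans (ℕₚ.+-suc (suc d) (k ℕ.∸ j)) (≡.cong suc (≡.trans
          (≡.cong (suc d ℕ.+_) (≡.sym (ℕₚ.∸-+-assoc k ℓ (suc d))))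
          (ℕₚ.m+[n∸m]≡n (ℕₚ.≤-trans (ℕₚ.≤-reflexive (≡.sym (ℕₚ.m+n∸m≡n ℓ (suc d)))) (ℕₚ.∸-monoˡ-≤ ℓ j≤k)))))

        pairs-μ : AllPairs ℕ._≥_ μ
        pairs-μ = Linkedₚ.Linked⇒AllPairs (λ p q → ℕₚ.≤-trans q p) (proj₂ (proj₁ a))

        rest-admissible : Admissible k (headOr0 rest) rest
        rest-admissible =
          (LAllₚ.drop⁺ n (proj₁ (proj₁ a)) , Linkedₚ.AllPairs⇒Linked (AllPairsₚ.drop⁺ n pairs-μ)) ,
          LAllₚ.drop⁺ n (proj₁ (proj₂ a)) , ≡.refl

        split-rect : Block (Vec.replicate n (+ ℓ) ++ᵛ Vec.replicate (suc d) (+ ℓ)) (Block u (G k rest)) ≋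
                     Bμ (rect k ℓ) (G k μ)
        split-rect = begin
          Block (Vec.replicate n (+ ℓ) ++ᵛ Vec.replicate (suc d) (+ ℓ)) (Block u (G k rest))
            ≈⟨ V.reflexive (≡.cong (λ v → Block v (Block u (G k rest))) (replicates n)) ⟨
          Block (Vec.map +_ (Vec.replicate (n ℕ.+ suc d) ℓ)) (Block u (G k rest))
            ≈⟨ Bμ-toList (Vec.replicate (n ℕ.+ suc d) ℓ) _ ⟨
          Bμ (Vec.toList (Vec.replicate (n ℕ.+ suc d) ℓ)) (Block u (G k rest))
            ≈⟨ V.reflexive (≡.cong (λ ν → Bμ ν (Block u (G k rest))) as-rect) ⟩
          Bμ (rect k ℓ) (Block u (G k rest))
            ≈⟨ Bμ-cong (rect k ℓ) (V.trans (V.reflexive (G-∷ k j ms)) (Bμ-pad k n μ)) ⟨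
          Bμ (rect k ℓ) (G k μ)  ∎
          where
          replicates : ∀ n → Vec.map +_ (Vec.replicate (n ℕ.+ suc d) ℓ) ≡
                       Vec.replicate n (+ ℓ) ++ᵛ Vec.replicate (suc d) (+ ℓ)
          replicates zero = Vecₚ.map-replicate +_ ℓ (suc d)
          replicates (suc n) = ≡.cong ((+ ℓ) ∷_) (replicates n)

          as-rect : Vec.toList (Vec.replicate (n ℕ.+ suc d) ℓ) ≡ rect k ℓ
          as-rect = ≡.trans (Vecₚ.toList-replicate (n ℕ.+ suc d) ℓ)
            (≡.cong (λ m → List.replicate m ℓ) (≡.trans (ℕₚ.+-comm n (suc d))
              (≡.trans size (≡.sym (ℕₚ.+-∸-assoc 1 ℓ≤k)))))

        Left : Vec ℕ n → Set
        Left α = Pointwise ℤ._≤_ u (Vec.map +_ α) × VAll.All ((+ ℓ) ℤ.≤_) (Vec.map +_ α) ×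
                 VAll.All (ℤ._≤ (+ j)) (Vec.map +_ α) × Descending (Vec.map +_ α)

        -- The first row of `u` is j and α lies between `u` and j, so α begins with j; its n = k + 1
        -- - j rows then form a complete block.
        prepend-left : ∀ h α ν → Left α → VAll.All ((+ h) ℤ.≤_) (Vec.map +_ α) → Admissible k h ν →
                       Ω k j (Block (Vec.map +_ α) (G k ν))
        prepend-left h (x ∷ α) ν (j≤x ∷ _ , ℓ≤ , ≤j , desc) h≤ b = Ω-resp
          (V.trans (V.reflexive (G-++ k (x ∷ Vec.toList α) ν (inj₁ (≡.trans (Vecₚ.length-toList α)
            (≡.cong (k ℕ.∸_) (≡.sym x≡j)))))) (Bμ-toList (x ∷ α) (G k ν)))
          (≡.subst (λ i → Ω k i (G k (x ∷ Vec.toList α ++ ν))) x≡j (Ω-G k x _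
            (admissible-++ x (Vec.toList α) ν
              (all-toList (λ m ℓ≤m → ℕₚ.≤-trans 1≤ℓ (ℤₚ.drop‿+≤+ ℓ≤m)) (x ∷ α) ℓ≤)
              (pairs-toList (x ∷ α) desc)
              (all-toList (λ m m≤j → ℕₚ.≤-trans (ℤₚ.drop‿+≤+ m≤j) j≤k) (x ∷ α) ≤j)
              (all-toList (λ m → ℤₚ.drop‿+≤+) (x ∷ α) h≤) b)))
          where
          x≡j : x ≡ j
          x≡j = ℕₚ.≤-antisym (ℤₚ.drop‿+≤+ (VAll.head ≤j)) (ℤₚ.drop‿+≤+ j≤x)

        exchange-with : ∀ lo → VAll.All ((+ lo) ℤ.≤_) u → lo ℕ.≤ ℓ →
          (∀ α (γ : Vec ℕ (suc d ℕ.+ n)) → Left α → LAll.All (lo ℕ.≤_) (Vec.toList γ) →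
             LAll.All (ℕ._≤ ℓ) (Vec.toList γ) → AllPairs ℕ._≥_ (Vec.toList γ) → headOr0 (Vec.toList γ) ≡ ℓ →
             Ω k j (Block (Vec.map +_ α) (Bμ (Vec.toList γ) (G k rest)))) →
          Ω k j (Bμ (rect k ℓ) (G k μ))
        exchange-with lo lo≤u lo≤ℓ s = Ω-resp split-rect
          (exchange-blocks (Ω-closed k j) n d (+ ℓ) (+ lo) u (G k rest)
            (pad-descending n μ pairs-μ)
            (≡.subst (λ t → VAll.All (ℤ._≤ t) u) (≡.sym top)
              (pad-all (ℤ.+≤+ z≤n) n μ (LAll.map ℤ.+≤+ (head-max pairs-μ))))
            (≡.sym top) lo≤u (ℤ.+≤+ lo≤ℓ) convert)
          where
          convert′ : ∀ {α : Vec ℤ n} {γ : Vec ℤ (suc d ℕ.+ n)} →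
            Σ (Vec ℕ n) (λ w → α ≡ Vec.map +_ w) → Σ (Vec ℕ (suc d ℕ.+ n)) (λ w → γ ≡ Vec.map +_ w) →
            Pointwise ℤ._≤_ u α → VAll.All ((+ ℓ) ℤ.≤_) α → VAll.All (ℤ._≤ (+ j)) α → Descending α →
            VAll.All ((+ lo) ℤ.≤_) γ → VAll.All (ℤ._≤ (+ ℓ)) γ → Descending γ → HeadIs (+ ℓ) γ →
            Ω k j (Block α (Block γ (G k rest)))
          convert′ (α , ≡.refl) (g ∷ γ , ≡.refl) u≤α ℓ≤α α≤ desc-α lo≤γ γ≤ desc-γ head = Ω-resp
            (Linear.cong (Block-linear (Vec.map +_ α)) (Bμ-toList (g ∷ γ) (G k rest)))
            (s α (g ∷ γ) (u≤α , ℓ≤α , α≤ , desc-α)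
              (all-toList (λ _ → ℤₚ.drop‿+≤+) (g ∷ γ) lo≤γ) (all-toList (λ _ → ℤₚ.drop‿+≤+) (g ∷ γ) γ≤)
              (pairs-toList (g ∷ γ) desc-γ) (ℤₚ.+-injective head))

          convert : ∀ (α : Vec ℤ n) (γ : Vec ℤ (suc d ℕ.+ n)) → Pointwise ℤ._≤_ u α →
            VAll.All ((+ ℓ) ℤ.≤_) α → VAll.All (ℤ._≤ up^ (suc d) (+ ℓ)) α → Descending α →
            VAll.All ((+ lo) ℤ.≤_) γ → VAll.All (ℤ._≤ (+ ℓ)) γ → Descending γ → HeadIs (+ ℓ) γ →
            Ω k j (Block α (Block γ (G k rest)))
          convert α γ u≤α ℓ≤α α≤ desc-α lo≤γ γ≤ desc-γ head = convert′
            (naturals α (VAll.map (ℤₚ.≤-trans (ℤ.+≤+ z≤n)) ℓ≤α))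
            (naturals γ (VAll.map (ℤₚ.≤-trans (ℤ.+≤+ z≤n)) lo≤γ))
            u≤α ℓ≤α (≡.subst (λ t → VAll.All (ℤ._≤ t) α) top α≤) desc-α lo≤γ γ≤ desc-γ head

        pairs-prefix : ∀ xs {ys} → AllPairs ℕ._≥_ (xs ++ ys) → AllPairs ℕ._≥_ xs
        pairs-prefix [] _ = []
        pairs-prefix (x ∷ xs) (q ∷ qs) = LAllₚ.++⁻ˡ xs q ∷ pairs-prefix xs qs

        empty : ∀ ν → LAll.All (1 ℕ.≤_) ν → headOr0 ν ℕ.≤ 0 → ν ≡ []
        empty [] _ _ = ≡.refl
        empty (suc x ∷ ν) (_ ∷ _) ()

        -- A zero among the rows bounds the first part of the rest from above. Hence a right factor
        -- that loses rows to `strip-zeros` is a last block, which may be short.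
        rest-empty : ∀ γ r → LAll.All (headOr0 rest ℕ.≤_) (γ ++ List.replicate (suc r) 0) → rest ≡ []
        rest-empty γ r lo≤γ = empty rest (proj₁ (proj₁ rest-admissible)) (LAll.head (LAllₚ.++⁻ʳ γ lo≤γ))

        is-block : ∀ γ r → List.length (ℓ ∷ γ ++ List.replicate r 0) ≡ suc d ℕ.+ n →
          LAll.All (headOr0 rest ℕ.≤_) (ℓ ∷ γ ++ List.replicate r 0) → IsBlock k (ℓ ∷ γ) rest
        is-block γ zero len lo≤γ = inj₁ (≡.trans (≡.cong List.length (≡.sym (Listₚ.++-identityʳ γ)))
          (ℕₚ.suc-injective (≡.trans len size)))
        is-block γ (suc r) len lo≤γ = inj₂
          (ℕₚ.≤-trans (ℕₚ.≤-trans (ℕₚ.m≤m+n (List.length γ) (suc r)) (ℕₚ.≤-reflexive (≡.sym (≡.trans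
            (Listₚ.length-++ γ) (≡.cong (List.length γ ℕ.+_) (Listₚ.length-replicate (suc r)))))))
            (ℕₚ.≤-reflexive (ℕₚ.suc-injective (≡.trans len size))) , rest-empty (ℓ ∷ γ) r lo≤γ)

        restore : ∀ γ r → LAll.All (headOr0 rest ℕ.≤_) (γ ++ List.replicate r 0) →
                  Bμ γ (G k rest) ≋ Bμ (γ ++ List.replicate r 0) (G k rest)
        restore γ zero _ = V.reflexive (≡.cong (λ ν → Bμ ν (G k rest)) (≡.sym (Listₚ.++-identityʳ γ)))
        restore γ (suc r) lo≤γ = ≡.subst
          (λ ν → Bμ γ (G k ν) ≋ Bμ (γ ++ List.replicate (suc r) 0) (G k ν))
          (≡.sym (rest-empty γ r lo≤γ)) (V.sym (Bμ-trailing-zeros γ (suc r)))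

        prepend-both : ∀ α γ → Left α → List.length γ ≡ suc d ℕ.+ n →
          LAll.All (headOr0 rest ℕ.≤_) γ → LAll.All (ℕ._≤ ℓ) γ → AllPairs ℕ._≥_ γ → headOr0 γ ≡ ℓ →
          (Σ (List ℕ) λ γ⁺ → Σ ℕ λ r → γ ≡ γ⁺ ++ List.replicate r 0 × LAll.All (1 ℕ.≤_) γ⁺) →
          Ω k j (Block (Vec.map +_ α) (Bμ γ (G k rest)))
        prepend-both α _ left len lo≤γ γ≤ℓ desc head ([] , zero , ≡.refl , pos) = contradiction head (ℕₚ.<⇒≢ 1≤ℓ)
        prepend-both α _ left len lo≤γ γ≤ℓ desc head ([] , suc r , ≡.refl , pos) = contradiction head (ℕₚ.<⇒≢ 1≤ℓ)
        prepend-both α _ left len lo≤γ γ≤ℓ desc ≡.refl (_ ∷ γ , r , ≡.refl , pos) = Ω-resp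
          (Linear.cong (Block-linear (Vec.map +_ α))
            (V.trans (V.reflexive (G-++ k (ℓ ∷ γ) rest (is-block γ r len lo≤γ))) (restore (ℓ ∷ γ) r lo≤γ)))
          (prepend-left ℓ α (ℓ ∷ γ ++ rest) left (proj₁ (proj₂ left))
            (admissible-++ ℓ γ rest pos (pairs-prefix (ℓ ∷ γ) desc)
              (LAll.map (λ x≤ℓ → ℕₚ.≤-trans x≤ℓ ℓ≤k) (LAllₚ.++⁻ˡ (ℓ ∷ γ) γ≤ℓ))
              (LAllₚ.++⁻ˡ (ℓ ∷ γ) lo≤γ) rest-admissible))

        below-rect : headOr0 rest ℕ.≤ ℓ → Ω k j (Bμ (rect k ℓ) (G k μ))
        below-rect h≤ℓ = exchange-with (headOr0 rest) (pad-above n μ pairs-μ) h≤ℓ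
          (λ α γ left lo≤γ γ≤ℓ desc head → prepend-both α (Vec.toList γ) left (Vecₚ.length-toList γ)
            lo≤γ γ≤ℓ desc head (strip-zeros (Vec.toList γ) desc))

        -- With lower bound ℓ the second index is squeezed to the constant ℓ. The inequality u ≤ α
        -- matters here: the rows of `u`, hence those of α, are at least the first part of `rest`,
        -- so α fits in front of every term given by the induction.
        above-rect : ℓ ℕ.< headOr0 rest → Ω k (headOr0 rest) (Bμ (rect k ℓ) (G k rest)) →
                     Ω k j (Bμ (rect k ℓ) (G k μ))
        above-rect ℓ<h ih = exchange-with ℓ (VAll.map (ℤₚ.≤-trans (ℤ.+≤+ (ℕₚ.<⇒≤ ℓ<h))) above) ℕₚ.≤-refl
          (λ α γ left ℓ≤γ γ≤ℓ desc head → Ω-image (Block-Lin (Vec.map +_ α))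
            (≡.subst (λ ν → Ω k (headOr0 rest) (Bμ ν (G k rest))) (≡.sym (constant γ ℓ≤γ γ≤ℓ)) ih)
            (λ ν b → prepend-left (headOr0 rest) α ν left (pointwise-above above (proj₁ left)) b))
          where
          above : VAll.All ((+ headOr0 rest) ℤ.≤_) u
          above = pad-above n μ pairs-μ

          constant : ∀ (γ : Vec ℕ (suc d ℕ.+ n)) → LAll.All (ℓ ℕ.≤_) (Vec.toList γ) →
                     LAll.All (ℕ._≤ ℓ) (Vec.toList γ) → Vec.toList γ ≡ rect k ℓ
          constant γ p q = ≡.trans (all-equal (Vec.toList γ) p q) (≡.cong (λ m → List.replicate m ℓ)
            (≡.trans (Vecₚ.length-toList γ) (≡.trans size (≡.sym (ℕₚ.+-∸-assoc 1 ℓ≤k)))))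

      Claim : ℕ → List ℕ → Set
      Claim j μ = Ω k (j ℕ.⊔ ℓ) (Bμ (rect k ℓ) (G k μ))

      exchange-step : ∀ m ms d → m ≡ ℓ ℕ.+ suc d → Admissible k m (m ∷ ms) →
        (∀ i ν → List.length ν ℕ.≤ List.length ms → Admissible k i ν → Claim i ν) →
        Ω k m (Bμ (rect k ℓ) (G k (m ∷ ms)))
      exchange-step _ ms d ≡.refl a rec = by-cases (ℕₚ.≤-<-connex (headOr0 E.rest) ℓ)
        where
        module E = Exchanging d (LAll.head (proj₁ (proj₂ a))) ms a

        by-cases : headOr0 E.rest ℕ.≤ ℓ ⊎ ℓ ℕ.< headOr0 E.rest → Ω k E.j (Bμ (rect k ℓ) (G k E.μ))
        by-cases (inj₁ h≤ℓ) = E.below-rect h≤ℓ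
        by-cases (inj₂ ℓ<h) = E.above-rect ℓ<h
          (≡.subst (λ i → Ω k i (Bμ (rect k ℓ) (G k E.rest))) (ℕₚ.m≥n⇒m⊔n≡m (ℕₚ.<⇒≤ ℓ<h))
            (rec (headOr0 E.rest) E.rest
              (ℕₚ.≤-trans (ℕₚ.≤-reflexive (Listₚ.length-drop (k ℕ.∸ E.j) ms)) (ℕₚ.m∸n≤m _ (k ℕ.∸ E.j)))
              E.rest-admissible))

      -- The recursive call concerns what follows the first block, a shorter partition but no
      -- subterm; `N` bounds the length.
      Bμ-rect-G : ∀ N j μ → List.length μ ℕ.≤ N → Admissible k j μ → Claim j μ
      Bμ-rect-G N j μ l a = by-cases N μ l a (ℕₚ.≤-<-connex j ℓ)
        where
        by-cases : ∀ N μ → List.length μ ℕ.≤ N → Admissible k j μ → j ℕ.≤ ℓ ⊎ ℓ ℕ.< j → Claim j μ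
        by-cases N μ l a (inj₁ j≤ℓ) =
          ≡.subst (λ i → Ω k i (Bμ (rect k ℓ) (G k μ))) (≡.sym (ℕₚ.m≤n⇒m⊔n≡n j≤ℓ)) (prepend-rect j μ j≤ℓ a)
        by-cases N [] l (_ , _ , ≡.refl) (inj₂ ())
        by-cases (suc N) (m ∷ ms) (s≤s l) a@(_ , _ , ≡.refl) (inj₂ ℓ<m) =
          ≡.subst (λ i → Ω k i (Bμ (rect k ℓ) (G k (m ∷ ms)))) (≡.sym (ℕₚ.m≥n⇒m⊔n≡m (ℕₚ.<⇒≤ ℓ<m)))
            (exchange-step m ms (m ℕ.∸ suc ℓ)
              (≡.trans (≡.sym (ℕₚ.m+[n∸m]≡n ℓ<m)) (≡.sym (ℕₚ.+-suc ℓ (m ℕ.∸ suc ℓ)))) a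
              (λ i ν l′ → Bμ-rect-G N i ν (ℕₚ.≤-trans l′ l)))

      Bμ-rect-Ω : ∀ j f → Ω k j f → Ω k (j ℕ.⊔ ℓ) (Bμ (rect k ℓ) f)
      Bμ-rect-Ω j f o = Ω-resp (V.sym (Bμ-Block (rect k ℓ) f))
        (Ω-image (Block-Lin (Vec.map +_ (Vec.fromList (rect k ℓ)))) o (λ μ a →
          Ω-resp (Bμ-Block (rect k ℓ) (G k μ)) (Bμ-rect-G (List.length μ) j μ ℕₚ.≤-refl a)))

open import Defs

-- The field ℚ(q,t) and its constants

module RationalFunctions where
  open Polynomials
  private module P = CommutativeRing ring

  Nonzero : Poly → Set
  Nonzero b = ¬ (b ≈P [])

  nonzero-* : ∀ a b → Nonzero a → Nonzero b → Nonzero (a *P b)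
  nonzero-* a b a≉0 b≉0 e = a≉0 (≋P⇒≈P (domain a b b≉0 (≈P⇒≋P (a *P b) [] e)))

  nonzero-1 : Nonzero (constP 1ℚ)
  nonzero-1 e = contradiction (e 0 0) λ ()

  open Fractions ring Nonzero nonzero-1 nonzero-* domain public
    using (Fraction; _≃_; cross; _⊞_; _⊠_; oneF; zeroF; fractions) renaming (eq to cross-eq)

  polynomial : Poly → Fraction
  polynomial a = polyK a , nonzero-1

  private
    module F = CommutativeRing fractions
    module Q = +-*-Solver
  open import Algebra.Solver.Ring.NaturalCoefficients.Default P.commutativeSemiring
    using (solve; _:=_; _:+_; _:*_; con)

  polynomial-cong : ∀ {a b} → a ≋P b → polynomial a ≃ polynomial b
  polynomial-cong e = cross (P.*-congʳ e)

  polynomial-+ : ∀ a b → polynomial a ⊞ polynomial b ≃ polynomial (a +P b)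
  polynomial-+ a b = cross (solve 2 (λ a b →
    (a :* con 1 :+ b :* con 1) :* con 1 := (a :+ b) :* (con 1 :* con 1)) P.refl a b)

  polynomial-* : ∀ a b → polynomial a ⊠ polynomial b ≃ polynomial (a *P b)
  polynomial-* a b = cross (solve 2 (λ a b → (a :* b) :* con 1 := (a :* b) :* (con 1 :* con 1)) P.refl a b)

  ℕtoℚ≡ : ∀ n → ℕtoℚ n ≡ mkℚ (+ n) 0 (Coprime.sym (Coprime.1-coprimeTo n))
  ℕtoℚ≡ n = ℚₚ.normalize-coprime (Coprime.sym (Coprime.1-coprimeTo n))

  ℕtoℚ-suc : ∀ n → ℕtoℚ (suc n) ≡ 1ℚ ℚ.+ ℕtoℚ n
  ℕtoℚ-suc n = ≡.sym (≡.trans (≡.cong (1ℚ ℚ.+_) (ℕtoℚ≡ n))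
    (≡.cong (λ m → ((+ 1) ℤ.+ m) ℚ./ 1) (ℤₚ.*-identityʳ (+ n))))

  private
    0<suc : ∀ n → ℕtoℚ (suc n) ≢ 0ℚ
    0<suc n e = contradiction (≡.trans (≡.sym (ℕtoℚ≡ (suc n))) e) λ ()

  -t : Poly
  -t = (ℚ.- 1ℚ , 0 , 1) ∷ []

  t^suc-1 : ℕ → Poly
  t^suc-1 r = (1ℚ , 0 , suc r) ∷ (ℚ.- 1ℚ , 0 , 0) ∷ []

  nat inv τ : ℕ → Fraction
  nat n = polynomial (constP (ℕtoℚ n))
  -- A default value that makes `inv` total.
  inv zero = oneF
  inv (suc n) = natInvK (suc n) , λ e → 0<suc n (≡.trans (≡.sym (ℚₚ.+-identityʳ _)) (e 0 0))
  τ r = polynomial (t^suc-1 r)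

  κ : Fraction
  κ = negtK , nonzero-1

  tfac : Mono → Fraction
  tfac μ = polynomial (tFactor μ)

  nat-suc : ∀ n → nat (suc n) ≃ oneF ⊞ nat n
  nat-suc n = F.trans (polynomial-cong (functionals λ F → ≡.trans
      (≡.cong (λ c → c ℚ.* F (0 , 0) ℚ.+ 0ℚ) (ℕtoℚ-suc n))
      (Q.solve 2 (λ c x → (Q.con 1ℚ Q.:+ c) Q.:* x Q.:+ Q.con 0ℚ Q.:=
        Q.con 1ℚ Q.:* x Q.:+ (c Q.:* x Q.:+ Q.con 0ℚ)) ≡.refl (ℕtoℚ n) (F (0 , 0)))))
    (F.sym (polynomial-+ (constP 1ℚ) (constP (ℕtoℚ n))))

  nat-zero : nat 0 ≃ zeroF
  nat-zero = polynomial-cong (functionals λ F →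
    Q.solve 1 (λ x → Q.con 0ℚ Q.:* x Q.:+ Q.con 0ℚ Q.:= Q.con 0ℚ) ≡.refl (F (0 , 0)))

  inv-nat : ∀ n → inv (suc n) ⊠ nat (suc n) ≃ oneF
  inv-nat n = cross (solve 1 (λ c → (con 1 :* c) :* con 1 := con 1 :* (c :* con 1)) P.refl (constP (ℕtoℚ (suc n))))

  τ-zero : τ 0 ⊞ (oneF ⊞ κ) ≃ zeroF
  τ-zero = F.trans (F.+-congˡ {τ 0} (polynomial-+ (constP 1ℚ) -t))
    (F.trans (polynomial-+ (t^suc-1 0) (constP 1ℚ +P -t)) (polynomial-cong (functionals λ F →
      Q.solve 2 (λ x y → Q.con 1ℚ Q.:* x Q.:+ (Q.con (ℚ.- 1ℚ) Q.:* y Q.:+ (Q.con 1ℚ Q.:* y Q.:+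
        (Q.con (ℚ.- 1ℚ) Q.:* x Q.:+ Q.con 0ℚ))) Q.:= Q.con 0ℚ) ≡.refl (F (0 , 1)) (F (0 , 0)))))

  τ-suc : ∀ r → τ (suc r) ⊞ κ ⊠ τ r ≃ τ 0
  τ-suc r = F.trans (F.+-congˡ {τ (suc r)} (polynomial-* -t (t^suc-1 r)))
    (F.trans (polynomial-+ (t^suc-1 (suc r)) (-t *P t^suc-1 r)) (polynomial-cong (functionals λ F →
      Q.solve 3 (λ x y z → Q.con 1ℚ Q.:* x Q.:+ (Q.con (ℚ.- 1ℚ) Q.:* y Q.:+
        (Q.con (ℚ.- 1ℚ ℚ.* 1ℚ) Q.:* x Q.:+ (Q.con (ℚ.- 1ℚ ℚ.* ℚ.- 1ℚ) Q.:* z Q.:+ Q.con 0ℚ))) Q.:=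
        Q.con 1ℚ Q.:* z Q.:+ (Q.con (ℚ.- 1ℚ) Q.:* y Q.:+ Q.con 0ℚ)) ≡.refl
        (F (0 , suc (suc r))) (F (0 , 0)) (F (0 , 1)))))

  tfac-[] : tfac [] ≃ oneF
  tfac-[] = F.refl

  tfac-∷ : ∀ r μ → tfac (r ∷ μ) ≃ τ r ⊠ tfac μ
  tfac-∷ r μ = F.sym (polynomial-* (t^suc-1 r) (tFactor μ))

-- Sorting as a normal form up to permutation

insert-≤ : ∀ {x y} l → x ≤ y → insertℕ x (y ∷ l) ≡ x ∷ y ∷ l
insert-≤ {x} {y} l x≤y = ≡.cong (if_then x ∷ y ∷ l else y ∷ insertℕ x l) (Equivalence.to T-≡ (ℕₚ.≤⇒≤ᵇ x≤y))

insert-> : ∀ {x y} l → y ℕ.< x → insertℕ x (y ∷ l) ≡ y ∷ insertℕ x l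
insert-> {x} {y} l y<x = by-cases (x ℕ.≤ᵇ y) ≡.refl
  where
  by-cases : ∀ b → (x ℕ.≤ᵇ y) ≡ b → insertℕ x (y ∷ l) ≡ y ∷ insertℕ x l
  by-cases true e = contradiction (ℕₚ.≤ᵇ⇒≤ x y (Equivalence.from T-≡ e)) (ℕₚ.<⇒≱ y<x)
  by-cases false e = ≡.cong (if_then x ∷ y ∷ l else y ∷ insertℕ x l) e

insert-comm-≤ : ∀ {x y} l → x ≤ y → insertℕ x (insertℕ y l) ≡ insertℕ y (insertℕ x l)
insert-comm-≤ {x} {y} l x≤y with ℕₚ.m≤n⇒m<n∨m≡n x≤y
... | inj₂ ≡.refl = ≡.refl
... | inj₁ x<y = go l
  where
  go : ∀ l → insertℕ x (insertℕ y l) ≡ insertℕ y (insertℕ x l)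
  go [] = ≡.trans (insert-≤ [] x≤y) (≡.sym (insert-> [] x<y))
  go (z ∷ l) with ℕₚ.≤-<-connex y z | ℕₚ.≤-<-connex x z
  ... | inj₁ y≤z | _ = ≡.trans (≡.cong (insertℕ x) (insert-≤ l y≤z)) (≡.trans (insert-≤ (z ∷ l) x≤y)
        (≡.sym (≡.trans (≡.cong (insertℕ y) (insert-≤ l (ℕₚ.≤-trans x≤y y≤z)))
          (≡.trans (insert-> (z ∷ l) x<y) (≡.cong (x ∷_) (insert-≤ l y≤z))))))
  ... | inj₂ z<y | inj₁ x≤z = ≡.trans (≡.cong (insertℕ x) (insert-> l z<y)) (≡.trans (insert-≤ _ x≤z)
        (≡.sym (≡.trans (≡.cong (insertℕ y) (insert-≤ l x≤z))
          (≡.trans (insert-> (z ∷ l) x<y) (≡.cong (x ∷_) (insert-> l z<y))))))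
  ... | inj₂ z<y | inj₂ z<x = ≡.trans (≡.cong (insertℕ x) (insert-> l z<y)) (≡.trans (insert-> _ z<x)
        (≡.trans (≡.cong (z ∷_) (go l))
          (≡.sym (≡.trans (≡.cong (insertℕ y) (insert-> l z<x)) (insert-> _ z<y)))))

insert-comm : ∀ x y l → insertℕ x (insertℕ y l) ≡ insertℕ y (insertℕ x l)
insert-comm x y l with ℕₚ.≤-total x y
... | inj₁ x≤y = insert-comm-≤ l x≤y
... | inj₂ y≤x = ≡.sym (insert-comm-≤ l y≤x)

sort-cong : ∀ {μ ν} → μ ↭ ν → sortℕ μ ≡ sortℕ ν
sort-cong Perm.refl = ≡.refl
sort-cong (Perm.prep x e) = ≡.cong (insertℕ x) (sort-cong e)
sort-cong (Perm.swap {xs} x y e) = ≡.trans (insert-comm x y (sortℕ xs)) (≡.cong (λ l → insertℕ y (insertℕ x l)) (sort-cong e))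
sort-cong (Perm.trans e f) = ≡.trans (sort-cong e) (sort-cong f)

insert-↭ : ∀ x l → insertℕ x l ↭ x ∷ l
insert-↭ x [] = Perm.refl
insert-↭ x (y ∷ l) with x ℕ.≤ᵇ y
... | true = Perm.refl
... | false = Perm.trans (Perm.prep y (insert-↭ x l)) (Perm.swap y x Perm.refl)

sort-↭ : ∀ μ → sortℕ μ ↭ μ
sort-↭ [] = Perm.refl
sort-↭ (x ∷ μ) = Perm.trans (insert-↭ x (sortℕ μ)) (Perm.prep x (sort-↭ μ))

eqL-refl : ∀ a → eqL a a ≡ true
eqL-refl [] = ≡.refl
eqL-refl (x ∷ a) = ≡.cong₂ _∧_ (Equivalence.to T-≡ (ℕₚ.≡⇒≡ᵇ x x ≡.refl)) (eqL-refl a)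

eqL-sound : ∀ a b → eqL a b ≡ true → a ≡ b
eqL-sound [] [] e = ≡.refl
eqL-sound (x ∷ a) (y ∷ b) e with Equivalence.to T-∧ (Equivalence.from T-≡ e)
... | p , q = ≡.cong₂ _∷_ (ℕₚ.≡ᵇ⇒≡ x y p) (eqL-sound a b (Equivalence.to T-≡ q))

-- Return to the original definitions

module Transfer where
  open RationalFunctions
  module S = SymmetricFunctions fractions κ nat inv τ tfac
  module L = S.Laws nat-suc nat-zero inv-nat τ-zero τ-suc tfac-[] tfac-∷
  open L using (Ω; spanned)

  -- Sums and products of fractions compute on the underlying pairs exactly as in `K`, so forgetting
  -- the proofs commutes with every construction on the nose.
  forget : ∀ {X : Set} → List (Fraction × X) → List (K × X)
  forget = map (λ { (c , x) → (proj₁ c , x) })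

  private variable
    A A′ B′ B″ : Set

  map-natural : (u : A → A′) (v : B′ → B″) (k : A → B′) (k′ : A′ → B″) → (∀ x → v (k x) ≡ k′ (u x)) →
                ∀ f → map v (map k f) ≡ map k′ (map u f)
  map-natural u v k k′ e [] = ≡.refl
  map-natural u v k k′ e (x ∷ f) = ≡.cong₂ _∷_ (e x) (map-natural u v k k′ e f)

  concatMap-natural : (u : A → A′) (v : B′ → B″) (k : A → List B′) (k′ : A′ → List B″) →
                      (∀ x → map v (k x) ≡ k′ (u x)) → ∀ f → map v (concatMap k f) ≡ concatMap k′ (map u f)
  concatMap-natural u v k k′ e [] = ≡.refl
  concatMap-natural u v k k′ e (x ∷ f) = ≡.trans (Listₚ.map-++ v (k x) (concatMap k f))
    (≡.cong₂ _++_ (e x) (concatMap-natural u v k k′ e f))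

  forget-scale : ∀ c f → forget (S.scale c f) ≡ scaleS (proj₁ c) (forget f)
  forget-scale c f = map-natural _ _ _ _ (λ _ → ≡.refl) f

  forget-mul : ∀ f g → forget (S.mul f g) ≡ mulS (forget f) (forget g)
  forget-mul f g = concatMap-natural _ _ _ _ (λ _ → map-natural _ _ _ _ (λ _ → ≡.refl) g) f

  forget-newtonAux : ∀ r gs → forget (S.newtonAux r gs) ≡ newtonAux r (map forget gs)
  forget-newtonAux r [] = ≡.refl
  forget-newtonAux r (g ∷ gs) = ≡.trans (Listₚ.map-++ _ (S.mul (S.p r) g) _)
    (≡.cong₂ _++_ (forget-mul (S.p r) g) (forget-newtonAux (suc r) gs))

  forget-hList : ∀ n → map forget (S.hList n) ≡ hList n
  forget-hList zero = ≡.refl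
  forget-hList (suc n) = ≡.cong₂ _∷_ (≡.trans (forget-scale (inv (suc n)) (S.newtonAux 0 (S.hList n)))
    (≡.cong (scaleS (natInvK (suc n))) (≡.trans (forget-newtonAux 0 (S.hList n))
      (≡.cong (newtonAux 0) (forget-hList n))))) (forget-hList n)

  forget-h : ∀ n → forget (S.h n) ≡ h n
  forget-h n = ≡.trans (heads (S.hList n)) (≡.cong headS (forget-hList n))
    where
    heads : ∀ gs → forget (S.head gs) ≡ headS (map forget gs)
    heads [] = ≡.refl
    heads (g ∷ gs) = ≡.refl

  forget-hZ : ∀ z → forget (S.hZ z) ≡ hZ z
  forget-hZ (+ n) = forget-h n
  forget-hZ -[1+ n ] = ≡.refl

  forget-pleth : ∀ f → forget (S.pleth f) ≡ plethT (forget f)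
  forget-pleth f = map-natural _ _ _ _ (λ _ → ≡.refl) f

  forget-perpOne : ∀ r f → forget (S.perpOne r f) ≡ perpOne r (forget f)
  forget-perpOne r f = concatMap-natural _ _ _ _ (λ { (c , μ) → ≡.sym (Listₚ.map-∘ (remOcc r μ)) }) f

  forget-perpMono : ∀ λ' f → forget (S.perpMono λ' f) ≡ perpMono λ' (forget f)
  forget-perpMono [] f = ≡.refl
  forget-perpMono (r ∷ λ') f = ≡.trans (forget-perpOne r (S.perpMono λ' f)) (≡.cong (perpOne r) (forget-perpMono λ' f))

  forget-perpS : ∀ g f → forget (S.perpS g f) ≡ perpS (forget g) (forget f)
  forget-perpS g f = concatMap-natural _ _ _ _ (λ { (c , λ') → ≡.trans (forget-scale c _)
    (≡.cong (scaleS (proj₁ c)) (forget-perpMono λ' f)) }) g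

  forget-deg : ∀ f → S.deg f ≡ degS (forget f)
  forget-deg [] = ≡.refl
  forget-deg ((c , μ) ∷ f) = ≡.cong (S.weight μ ℕ.+_) (forget-deg f)

  forget-B : ∀ n f → forget (S.B n f) ≡ B n (forget f)
  forget-B n f = ≡.trans (concatMap-natural (λ i → i) _ _ _ summand (upTo (suc (S.deg f))))
    (≡.trans (≡.cong (concatMap term) (Listₚ.map-id (upTo (suc (S.deg f)))))
      (≡.cong (λ d → concatMap term (upTo (suc d))) (forget-deg f)))
    where
    term : ℕ → Sym
    term i = mulS (hZ (n ℤ.+ (+ i))) (perpS (plethT (h i)) (forget f))

    summand : ∀ i → forget (S.mul (S.hZ (n ℤ.+ (+ i))) (S.perpS (S.pleth (S.h i)) f)) ≡ term i
    summand i = ≡.trans (forget-mul (S.hZ (n ℤ.+ (+ i))) _) (≡.cong₂ mulS (forget-hZ (n ℤ.+ (+ i)))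
      (≡.trans (forget-perpS (S.pleth (S.h i)) f) (≡.cong (λ g → perpS g (forget f))
        (≡.trans (forget-pleth (S.h i)) (≡.cong plethT (forget-h i))))))

  forget-Bseq : ∀ v f → forget (S.Bseq v f) ≡ Bseq v (forget f)
  forget-Bseq [] f = ≡.refl
  forget-Bseq (n ∷ v) f = ≡.trans (forget-B n _) (≡.cong (B n) (forget-Bseq v f))

  forget-raise : ∀ q ts → forget (S.raise q ts) ≡ raise q (forget ts)
  forget-raise q ts = concatMap-natural _ _ _ _ (λ _ → ≡.refl) ts

  forget-Bμ : ∀ μ f → forget (S.Bμ μ f) ≡ Bμ μ (forget f)
  forget-Bμ μ f = ≡.trans (concatMap-natural _ _ _ _ (λ { (c , v) → ≡.trans (forget-scale c _)
    (≡.cong (scaleS (proj₁ c)) (forget-Bseq v f)) }) (foldr S.raise _ (pairs (length μ))))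
    (≡.cong (concatMap _) (raises (pairs (length μ))))
    where
    raises : ∀ qs → forget (foldr S.raise ((oneF , map +_ μ) ∷ []) qs) ≡ foldr raise ((1K , map +_ μ) ∷ []) qs
    raises [] = ≡.refl
    raises (q ∷ qs) = ≡.trans (forget-raise q (foldr S.raise ((oneF , map +_ μ) ∷ []) qs)) (≡.cong (raise q) (raises qs))

  forget-Gfuel : ∀ k n μ → forget (L.Gfuel k n μ) ≡ Gfuel k n μ
  forget-Gfuel k zero μ = ≡.refl
  forget-Gfuel k (suc n) [] = ≡.refl
  forget-Gfuel k (suc n) (m ∷ ms) = ≡.trans (forget-Bμ (take (suc (k ℕ.∸ m)) (m ∷ ms)) _)
    (≡.cong (Bμ (take (suc (k ℕ.∸ m)) (m ∷ ms))) (forget-Gfuel k n (drop (suc (k ℕ.∸ m)) (m ∷ ms))))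

  forget-G : ∀ k μ → forget (L.G k μ) ≡ G k μ
  forget-G k μ = forget-Gfuel k (length μ) μ

  forget-span : ∀ k ws → forget (L.span k ws) ≡ concatMap (λ { (c , μ) → scaleS c (G k μ) }) (forget ws)
  forget-span k ws = concatMap-natural _ _ _ _ (λ { (c , μ) → ≡.trans (forget-scale c (L.G k μ))
    (≡.cong (scaleS (proj₁ c)) (forget-G k μ)) }) ws

  private
    module F = CommutativeRing fractions
    open LinearCombinations fractions using (module Coefficients)
    open Coefficients {X = Mono} sortℕ eqL eqL-refl eqL-sound using (coef; ev-ext; coef-ext)

  forget-coef : ∀ f μ → proj₁ (coef f μ) ≡ coeffS (forget f) μ
  forget-coef [] μ = ≡.refl
  forget-coef ((c , ν) ∷ f) μ = ≡.trans (forget-if (eqL (sortℕ ν) (sortℕ μ)) (c ⊞ coef f μ) (coef f μ))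
    (≡.cong (λ x → if eqL (sortℕ ν) (sortℕ μ) then proj₁ c +K x else x) (forget-coef f μ))
    where
    forget-if : ∀ b (x y : Fraction) → proj₁ (if b then x else y) ≡ (if b then proj₁ x else proj₁ y)
    forget-if true x y = ≡.refl
    forget-if false x y = ≡.refl

  -- Every list is a permutation of its sorted form, so a permutation-invariant functional is
  -- constant on the classes by which `coeffS` collects terms.
  ≈S⇒≋ : ∀ f g → forget f ≈S forget g → f S.≋ g
  ≈S⇒≋ f g e = S.functionals λ F inv → ev-ext F
    (λ μ ν q → inv (Perm.trans (Perm.↭-sym (sort-↭ μ)) (Perm.trans (Perm.↭-reflexive q) (sort-↭ ν)))) f g
    (λ μ → cross (Polynomials.≈P⇒≋P _ _
      (≡.subst₂ _≈K_ (≡.sym (forget-coef f μ)) (≡.sym (forget-coef g μ)) (e μ))))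

  ≋⇒≈S : ∀ f g → f S.≋ g → forget f ≈S forget g
  ≋⇒≈S f g e μ = ≡.subst₂ _≈K_ (forget-coef f μ) (forget-coef g μ) (Polynomials.≋P⇒≈P (cross-eq
    (coef-ext f g (λ F inv → S.at e F (λ q → inv _ _ (sort-cong q))) μ)))

  -- Validity of the coefficients supplies the proofs that denominators are nonzero.
  remember : ∀ {X : Set} (f : List (K × X)) → LAll.All (λ x → ValidK (proj₁ x)) f → List (Fraction × X)
  remember [] [] = []
  remember ((c , x) ∷ f) (v ∷ vs) = ((c , v) , x) ∷ remember f vs

  forget-remember : ∀ {X : Set} (f : List (K × X)) vs → forget (remember f vs) ≡ f
  forget-remember [] [] = ≡.refl
  forget-remember (x ∷ f) (v ∷ vs) = ≡.cong (x ∷_) (forget-remember f vs)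

  InΩ⇒Ω : ∀ k j f → InΩ k j (forget f) → Ω k j f
  InΩ⇒Ω k j f (ws , conditions , e) = spanned terms (admissible ws conditions)
    (≈S⇒≋ f (L.span k terms) (≡.subst (forget f ≈S_)
      (≡.sym (≡.trans (forget-span k terms) (≡.cong (concatMap _) (forget-remember ws _)))) e))
    where
    terms : List (Fraction × List ℕ)
    terms = remember ws (LAll.map proj₁ conditions)

    admissible : ∀ ws (cs : LAll.All _ ws) →
                 LAll.All (λ w → L.Admissible k j (proj₂ w)) (remember ws (LAll.map proj₁ cs))
    admissible [] [] = []
    admissible (w ∷ ws) (c ∷ cs) = proj₂ c ∷ admissible ws cs

  Ω⇒InΩ : ∀ k j f → Ω k j f → InΩ k j (forget f)
  Ω⇒InΩ k j f (spanned ws admissible e) =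
    forget ws , LAllₚ.map⁺ (LAll.map (λ {w} a → proj₂ (proj₁ w) , a) admissible) ,
    ≡.subst (forget f ≈S_) (forget-span k ws) (≋⇒≈S f (L.span k ws) e)

theorem2 : (k : ℕ) → 1 ≤ k → (ℓ : ℕ) → 1 ≤ ℓ → ℓ ≤ k → (j : ℕ) → j ≤ k →
    (f : Sym) → ValidS f → InΩ k j f → InΩ k (j ⊔ ℓ) (Bμ (rect k ℓ) f)
theorem2 k 1≤k ℓ 1≤ℓ ℓ≤k j j≤k f valid f∈Ω =
  ≡.subst (InΩ k (j ⊔ ℓ)) (≡.trans (forget-Bμ (rect k ℓ) f̂) (≡.cong (Bμ (rect k ℓ)) (forget-remember f valid)))
    (Ω⇒InΩ k (j ⊔ ℓ) (S.Bμ (rect k ℓ) f̂) (L.MainInduction.Bμ-rect-Ω k ℓ 1≤ℓ ℓ≤k j f̂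
      (InΩ⇒Ω k j f̂ (≡.subst (InΩ k j) (≡.sym (forget-remember f valid)) f∈Ω))))
  where
  open Transfer
  f̂ : S.Sym
  f̂ = remember f valid
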